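{- Let $S$ be a Seidel matrix of order $n$ with spectrum $\{ [\lambda]^{a}, [\mu]^{b}, [\nu]^{1} \}$, where $a$ and $b$ are positive integers. Then the switching class of $S$ contains a strongly regular graph (in particular, a regular graph) whose multiset of adjacency eigenvalues consists of $(-1-\lambda)/2$ taken $a$ times, $(-1-\mu)/2$ taken $b$ times, and $(n-1-\nu)/2$ taken once.
   Context: A Seidel matrix is a symmetric $\{0,\pm1\}$-matrix with zero diagonal and all off-diagonal entries nonzero. The notation $\{[\lambda]^a,[\mu]^b,[\nu]^1\}$ for the spectrum of $S$ means that $S$ has precisely three distinct eigenvalues $\lambda,\mu,\nu$ (pairwise distinct, in no particular order) with multiplicities $a,b,1$. Two integer matrices $X,Y$ of order $n$ are switching equivalent if $X=P^{\top}YP$ for some signed permutation matrix $P$. The underlying graph of a Seidel matrix $S$ is the graph with adjacency matrix $(J-I-S)/2$, where $J$ is the all-ones matrix and $I$ the identity matrix. The switching class of $S$ is the set of underlying graphs of Seidel matrices that are switching equivalent to $S$. A strongly regular graph is a regular graph, neither complete nor empty, in which the number of common neighbours of two distinct vertices depends only on whether they are adjacent or not (connectedness of the graph or its complement is not required). -}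

module Defs where

open import Level as Level using (_⊔_)
open import Algebra.Bundles using (CommutativeRing; Semiring)
open import Algebra.Apartness.Bundles using (HeytingField; HeytingCommutativeRing)
import Algebra.Definitions.RawSemiring as RawSemiringOps
import Algebra.Properties.Ring as RingProperties
open import Data.Bool.Base using (Bool; true; false; if_then_else_)
open import Data.Fin.Base using (Fin; zero; suc; punchIn)
open import Data.Fin.Properties using (_≟_)
open import Data.Fin.Subset using (Subset; ∣_∣; _∩_)
open import Data.Integer.Base as ℤ using (ℤ; +_; -[1+_]; 0ℤ; 1ℤ; -1ℤ)
import Data.Integer.Properties as ℤₚ
open import Data.List.Base using (List; []; _∷_; foldr)
open import Data.Nat.Base as ℕ using (ℕ)
open import Data.Product using (_×_; _,_; proj₁; Σ-syntax; ∃-syntax; ∃!)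
open import Data.Sum.Base using (_⊎_; inj₁; inj₂)
open import Data.Vec.Base using (tabulate)
open import Relation.Binary.Core using (Rel)
open import Relation.Binary.Structures using (IsStrictPartialOrder)
open import Relation.Binary.PropositionalEquality using (_≡_; _≢_)
open import Relation.Nullary using (¬_)
open import Relation.Nullary.Decidable using (⌊_⌋)

-- Ordered fields, over a stdlib Heyting field so that constructive real
-- numbers are an instance; a classical ordered field is one with
-- x # y = ¬ (x ≈ y).  The real numbers are the intended model.

record OrderedField c ℓ₁ ℓ₂ ℓ₃ : Set (Level.suc (c ⊔ ℓ₁ ⊔ ℓ₂ ⊔ ℓ₃)) where
  field
    heytingField : HeytingField c ℓ₁ ℓ₂
  open HeytingField heytingField public
  infix 4 _<_
  field
    _<_                  : Rel Carrier ℓ₃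
    isStrictPartialOrder : IsStrictPartialOrder _≈_ _<_
    #⇒<⊎>                : ∀ {x y} → x # y → x < y ⊎ y < x
    <⇒#                  : ∀ {x y} → x < y → x # y
    +-monoʳ-<            : ∀ z {x y} → x < y → z + x < z + y
    *-pos                : ∀ {x y} → 0# < x → 0# < y → 0# < x * y

  commutativeRing : CommutativeRing c ℓ₁
  commutativeRing =
    HeytingCommutativeRing.commutativeRing
      (HeytingField.heytingCommutativeRing heytingField)

  open CommutativeRing commutativeRing public using (ring; semiring)
  open IsStrictPartialOrder isStrictPartialOrder public
    using (<-respʳ-≈; <-respˡ-≈)
    renaming (irrefl to <-irrefl; trans to <-trans)

  open RingProperties ring using (-‿distribˡ-*; -‿involutive; -0#≈0#)

  1#0 : 1# # 0#
  1#0 = invertible⇒#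
    (1# , trans (*-identityˡ _) 1-0≈1 , trans (*-identityʳ _) 1-0≈1)
    where
    1-0≈1 : 1# - 0# ≈ 1#
    1-0≈1 = trans (+-congˡ -0#≈0#) (+-identityʳ 1#)

  0<1 : 0# < 1#
  0<1 with #⇒<⊎> 1#0
  ... | inj₂ 0<1 = 0<1
  ... | inj₁ 1<0 = <-respʳ-≈ [-1]²≈1 (*-pos 0<-1 0<-1)
    where
    0<-1 : 0# < - 1#
    0<-1 = <-respˡ-≈ (-‿inverseˡ 1#)
             (<-respʳ-≈ (+-identityʳ (- 1#)) (+-monoʳ-< (- 1#) 1<0))
    [-1]²≈1 : - 1# * - 1# ≈ 1#
    [-1]²≈1 = trans (sym (-‿distribˡ-* 1# (- 1#)))
                (trans (-‿cong (*-identityˡ (- 1#))) (-‿involutive 1#))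

  2#0 : (1# + 1#) # 0#
  2#0 = #-sym (<⇒# (<-trans 0<1
          (<-respˡ-≈ (+-identityʳ 1#) (+-monoʳ-< 1# 0<1))))

  -- The inverse of 1 + 1 - 0, which is the form #⇒invertible supplies.
  ½ : Carrier
  ½ = proj₁ (#⇒invertible 2#0)

  infixl 7 _/2
  _/2 : Carrier → Carrier
  x /2 = x * ½

  fromℕ : ℕ → Carrier
  fromℕ m = m · 1#
    where open RawSemiringOps (Semiring.rawSemiring semiring)
            using () renaming (_×_ to _·_)

  fromℤ : ℤ → Carrier
  fromℤ (+ m)    = fromℕ m
  fromℤ -[1+ m ] = - fromℕ (ℕ.suc m)

Matrix : ∀ {a} → Set a → ℕ → Set a
Matrix A n = Fin n → Fin n → A

infix 30 _ᵀ
_ᵀ : ∀ {a} {A : Set a} {n} → Matrix A n → Matrix A n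
(M ᵀ) i j = M j i

module MatrixOps {c ℓ} (R : CommutativeRing c ℓ) where
  open CommutativeRing R hiding (zero)
  open RawSemiringOps (Semiring.rawSemiring semiring) using (sum; _^_)

  𝟙 : ∀ {n} → Matrix Carrier n
  𝟙 i j = if ⌊ i ≟ j ⌋ then 1# else 0#

  infixl 7 _⊗_
  _⊗_ : ∀ {n} → Matrix Carrier n → Matrix Carrier n → Matrix Carrier n
  (M ⊗ N) i j = sum (λ k → M i k * N k j)

  sign : ∀ {n} → Fin n → Carrier
  sign zero    = 1#
  sign (suc j) = - sign j

  -- Laplace expansion along the first row.
  det : ∀ {n} → Matrix Carrier n → Carrier
  det {ℕ.zero}  M = 1#
  det {ℕ.suc n} M =
    sum (λ j → sign j * M zero j * det (λ i k → M (suc i) (punchIn j k)))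

  charPoly : ∀ {n} → Matrix Carrier n → Carrier → Carrier
  charPoly M x = det (λ i j → x * 𝟙 i j - M i j)

  -- The eigenvalues of M, counted with multiplicity, are the θ's, each taken m
  -- times: det (x I - M) = ∏ (x - θ)^m.  An ordered field is infinite, so
  -- agreement at every x is equality of polynomials; in particular the m's sum
  -- to the order of M.  The θ's need not be distinct.
  HasEigenvalues : ∀ {n} → Matrix Carrier n → List (Carrier × ℕ) → Set (c ⊔ ℓ)
  HasEigenvalues M θs =
    ∀ x → charPoly M x ≈ foldr (λ (θ , m) p → (x - θ) ^ m * p) 1# θs

open MatrixOps ℤₚ.+-*-commutativeRing public
  using () renaming (𝟙 to Iℤ; _⊗_ to _⊗ℤ_)

record IsSeidel {n} (S : Matrix ℤ n) : Set where
  field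
    symmetric   : ∀ i j → S i j ≡ S j i
    diagonal    : ∀ i → S i i ≡ 0ℤ
    offDiagonal : ∀ {i j} → i ≢ j → S i j ≡ 1ℤ ⊎ S i j ≡ -1ℤ

record IsSignedPermutation {n} (P : Matrix ℤ n) : Set where
  field
    entries : ∀ i j → P i j ≡ 0ℤ ⊎ P i j ≡ 1ℤ ⊎ P i j ≡ -1ℤ
    rows    : ∀ i → ∃! _≡_ (λ j → P i j ≢ 0ℤ)
    columns : ∀ j → ∃! _≡_ (λ i → P i j ≢ 0ℤ)

SwitchingEquivalent : ∀ {n} → Matrix ℤ n → Matrix ℤ n → Set
SwitchingEquivalent {n} X Y =
  Σ[ P ∈ Matrix ℤ n ] IsSignedPermutation P ×
    (∀ i j → X i j ≡ (P ᵀ ⊗ℤ Y ⊗ℤ P) i j)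

record Graph (n : ℕ) : Set where
  field
    adj       : Fin n → Fin n → Bool
    symmetric : ∀ u v → adj u v ≡ adj v u
    loopless  : ∀ v → adj v v ≡ false

module _ {n} (G : Graph n) where
  open Graph G

  adjacencyMatrix : Matrix ℤ n
  adjacencyMatrix u v = if adj u v then 1ℤ else 0ℤ

  neighbours : Fin n → Subset n
  neighbours v = tabulate (adj v)

  IsRegular : Set
  IsRegular = ∃[ k ] ∀ v → ∣ neighbours v ∣ ≡ k

  IsComplete : Set
  IsComplete = ∀ {u v} → u ≢ v → adj u v ≡ true

  IsEmpty : Set
  IsEmpty = ∀ u v → adj u v ≡ false

  record IsStronglyRegular : Set where
    field
      regular     : IsRegular
      notComplete : ¬ IsComplete
      notEmpty    : ¬ IsEmpty
      adjacent    : ∃[ e ] ∀ {u v} → u ≢ v → adj u v ≡ true →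
                      ∣ neighbours u ∩ neighbours v ∣ ≡ e
      nonAdjacent : ∃[ f ] ∀ {u v} → u ≢ v → adj u v ≡ false →
                      ∣ neighbours u ∩ neighbours v ∣ ≡ f

-- A(G) = (J - I - S) / 2, with the denominator cleared.
IsUnderlyingGraph : ∀ {n} → Graph n → Matrix ℤ n → Set
IsUnderlyingGraph G S =
  ∀ i j → + 2 ℤ.* adjacencyMatrix G i j ≡ 1ℤ ℤ.- Iℤ i j ℤ.- S i j

_∈SwitchingClass_ : ∀ {n} → Graph n → Matrix ℤ n → Set
_∈SwitchingClass_ {n} G S =
  Σ[ S′ ∈ Matrix ℤ n ] IsSeidel S′ × SwitchingEquivalent S′ S ×
    IsUnderlyingGraph G S′

module IntegerSpectrum {c ℓ₁ ℓ₂ ℓ₃} (K : OrderedField c ℓ₁ ℓ₂ ℓ₃) where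
  open OrderedField K
  open MatrixOps commutativeRing using (HasEigenvalues)

  HasEigenvaluesℤ : ∀ {n} → Matrix ℤ n → List (Carrier × ℕ) → Set (c ⊔ ℓ₁)
  HasEigenvaluesℤ M = HasEigenvalues (λ i j → fromℤ (M i j))

  record HasThreeEigenvalues {n} (M : Matrix ℤ n)
      (θ₁ : Carrier) (m₁ : ℕ) (θ₂ : Carrier) (m₂ : ℕ) (θ₃ : Carrier) (m₃ : ℕ)
      : Set (c ⊔ ℓ₁ ⊔ ℓ₂) where
    field
      θ₁#θ₂       : θ₁ # θ₂
      θ₁#θ₃       : θ₁ # θ₃
      θ₂#θ₃       : θ₂ # θ₃
      eigenvalues : HasEigenvaluesℤ M
                      ((θ₁ , m₁) ∷ (θ₂ , m₂) ∷ (θ₃ , m₃) ∷ [])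

{-# OPTIONS --safe #-}

-- E = (λI - S)(μI - S) has spectrum {0, …, 0, κ} with κ = (λ - ν)(μ - ν) and
-- constant diagonal.  Then tr E² = κ² and tr E⁴ = κ⁴, so (tr E²)² = tr E⁴; as E is
-- symmetric, the difference of the two sides is half the sum of the squares of all
-- 2 × 2 minors of E.  Hence E has rank one and entries ± δ, where δ is its diagonal
-- entry, and switching by the signs of one row turns it into δJ.  The switched matrix
-- commutes with J, so its underlying graph is regular, and its square is a combination of
-- itself, I and J, so the graph is strongly regular.
--
-- The spectrum is only available through the characteristic polynomial.  That of a
-- quadratic polynomial in S is obtained from multiplicativity of det, by
-- factoring x I + (pI - S)(qI - S) for infinitely many x, and traces are read off
-- from det (I + wM) = 1 + w tr M + O(w²).
module Submission where

open import Algebra.Apartness.Bundles using (HeytingField)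
import Algebra.Apartness.Properties.HeytingCommutativeRing as HeytingProperties
open import Algebra.Bundles using (CommutativeRing)
import Algebra.Properties.AbelianGroup as AbelianGroupProperties
import Algebra.Properties.Ring as RingProperties
import Algebra.Properties.Semiring.Exp as ExpProperties
import Algebra.Properties.Semiring.Mult.TCOptimised as MultProperties
import Algebra.Properties.Semiring.Sum as SumProperties
import Algebra.Solver.Ring
open import Algebra.Solver.Ring.AlmostCommutativeRing
  using (fromCommutativeRing; _-Raw-AlmostCommutative⟶_)
open import Data.Bool.Base using (Bool; true; false; if_then_else_; _∧_)
import Data.Bool.Properties as Boolₚ
open import Data.Empty using (⊥; ⊥-elim)
open import Data.Fin.Base using (Fin; zero; suc; punchIn)
open import Data.Fin.Properties using (_≟_; any?; suc-injective)
open import Data.Fin.Subset using (∣_∣; _∩_)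
open import Data.Integer.Base as ℤ using (ℤ; +_; -[1+_]; 0ℤ; 1ℤ; -1ℤ)
import Data.Integer.Properties as ℤₚ
open import Data.List.Base using (List; []; _∷_; _++_; foldr; length; map; replicate)
import Data.List.Properties as Listₚ
open import Data.Maybe.Base using (Maybe; just; nothing)
open import Data.Nat.Base as ℕ using (ℕ)
import Data.Nat.Properties as ℕₚ
open import Data.Product using (_×_; _,_; Σ-syntax; ∃-syntax; proj₁; proj₂)
open import Data.Sum.Base using (_⊎_; inj₁; inj₂; [_,_]′)
open import Data.Unit.Base using (⊤)
import Data.Vec.Base as Vec
open import Data.Vec.Functional using () renaming (_∷_ to _∷ᵛ_)
open import Function.Base using (id; _∘_)
open import Level using (Lift; lift; _⊔_)
open import Relation.Binary.Definitions using (tri<; tri≈; tri>)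
open import Relation.Binary.PropositionalEquality as ≡ using (_≡_; _≢_)
import Relation.Binary.Reasoning.Setoid as SetoidReasoning
open import Relation.Nullary using (yes; no; ¬_; ¬?; _×-dec_)
open import Defs

-- Equality in the field is undecidable and only elements apart from 0 can be cancelled. No pivot
-- can be chosen, so rank and eigenspaces are not within reach of elimination; this is why rank one
-- is extracted from an identity between traces, with tightness of the apartness turning a vanishing
-- sum of squares into vanishing terms. Since `nu` is apart from `lam` and `mu`, κ is apart from 0,
-- and as the trace of the quadratic gives n δ = κ, δ can be cancelled in everything that follows.
-- That the row sum r after switching is constant is not enough; it has to be ν. Applying the
-- quadratic to the all-ones vector shows that (r - λ)(r - μ) is κ up to sign, so r is apart from λ
-- and μ; as r is also a root of the characteristic polynomial, only ν is left. The spectrum of the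
-- graph is found without eigenvectors as well: J is a multiple of the quadratic, so subtracting J
-- amounts to multiplying by a matrix of known determinant. Apartness of `lam` and `mu` excludes
-- complete and empty graphs, for which S would be ± (J - I).

-- With coefficients in the ring itself, whose equality is undecidable, the solver
-- could not cancel x against - x.
module IntegerCoefficients {c ℓ} (R : CommutativeRing c ℓ) where
  open CommutativeRing R
  open RingProperties ring
  open AbelianGroupProperties +-abelianGroup using (⁻¹-∙-comm)
  open MultProperties semiring
    using (1+×; ×-homo-+; ×1-homo-*) renaming (_×_ to infixl 8 _·_)
  open SetoidReasoning setoid

  private
    -- This version of the multiple makes `1 · 1#` the element `1#` itself and not `1# + 0#`, so
    -- that `con (+ 1)` in a solver goal matches a literal `1#` definitionally.
    ⟦_⟧ : ℤ → Carrier
    ⟦ + n ⟧      = n · 1#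
    ⟦ -[1+ n ] ⟧ = - (ℕ.suc n · 1#)

    neg-homo : ∀ i → ⟦ ℤ.- i ⟧ ≈ - ⟦ i ⟧
    neg-homo (+ ℕ.zero)    = sym -0#≈0#
    neg-homo (+ (ℕ.suc n)) = refl
    neg-homo -[1+ n ]      = sym (-‿involutive _)

    ⊖-homo : ∀ m n → ⟦ m ℤ.⊖ n ⟧ ≈ m · 1# - n · 1#
    ⊖-homo m ℕ.zero = begin
      ⟦ m ℤ.⊖ 0 ⟧ ≈⟨ reflexive (≡.cong ⟦_⟧ (ℤₚ.⊖-≥ {m} {0} ℕ.z≤n)) ⟩
      m · 1#      ≈⟨ +-identityʳ _ ⟨
      m · 1# + 0# ≈⟨ +-congˡ -0#≈0# ⟨
      m · 1# - 0# ∎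
    ⊖-homo ℕ.zero (ℕ.suc n) = sym (+-identityˡ _)
    ⊖-homo (ℕ.suc m) (ℕ.suc n) = begin
      ⟦ ℕ.suc m ℤ.⊖ ℕ.suc n ⟧
        ≈⟨ reflexive (≡.cong ⟦_⟧ (ℤₚ.[1+m]⊖[1+n]≡m⊖n m n)) ⟩
      ⟦ m ℤ.⊖ n ⟧
        ≈⟨ ⊖-homo m n ⟩
      m · 1# - n · 1#
        ≈⟨ +-congʳ (+-identityˡ _) ⟨
      0# + m · 1# - n · 1#
        ≈⟨ +-congʳ (+-congʳ (-‿inverseʳ 1#)) ⟨
      1# - 1# + m · 1# - n · 1#
        ≈⟨ +-congʳ (trans (+-assoc _ _ _) (trans (+-congˡ (+-comm _ _)) (sym (+-assoc _ _ _)))) ⟩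
      1# + m · 1# - 1# - n · 1#
        ≈⟨ trans (+-assoc _ _ _) (+-congˡ (⁻¹-∙-comm 1# _)) ⟩
      1# + m · 1# - (1# + n · 1#)
        ≈⟨ +-cong (1+× m 1#) (-‿cong (1+× n 1#)) ⟨
      ℕ.suc m · 1# - ℕ.suc n · 1# ∎

    +-homo : ∀ i j → ⟦ i ℤ.+ j ⟧ ≈ ⟦ i ⟧ + ⟦ j ⟧
    +-homo (+ m)    (+ n)    = ×-homo-+ 1# m n
    +-homo (+ m)    -[1+ n ] = ⊖-homo m (ℕ.suc n)
    +-homo -[1+ m ] (+ n)    = trans (⊖-homo n (ℕ.suc m)) (+-comm _ _)
    +-homo -[1+ m ] -[1+ n ] = begin
      ⟦ -[1+ m ] ℤ.+ -[1+ n ] ⟧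
        ≈⟨ reflexive (≡.cong ⟦_⟧ (ℤₚ.neg-distrib-+ (+ ℕ.suc m) (+ ℕ.suc n))) ⟨
      - ⟦ + (ℕ.suc m ℕ.+ ℕ.suc n) ⟧
        ≈⟨ -‿cong (×-homo-+ 1# (ℕ.suc m) (ℕ.suc n)) ⟩
      - (ℕ.suc m · 1# + ℕ.suc n · 1#)
        ≈⟨ ⁻¹-∙-comm _ _ ⟨
      - (ℕ.suc m · 1#) - ℕ.suc n · 1# ∎

    pos-*-homo : ∀ m j → ⟦ + m ℤ.* j ⟧ ≈ ⟦ + m ⟧ * ⟦ j ⟧
    pos-*-homo m (+ n) =
      trans (reflexive (≡.cong ⟦_⟧ (≡.sym (ℤₚ.pos-* m n)))) (×1-homo-* m n)
    pos-*-homo m -[1+ n ] = begin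
      ⟦ + m ℤ.* -[1+ n ] ⟧
        ≈⟨ reflexive (≡.cong ⟦_⟧ (ℤₚ.neg-distribʳ-* (+ m) (+ ℕ.suc n))) ⟨
      ⟦ ℤ.- (+ m ℤ.* + ℕ.suc n) ⟧
        ≈⟨ neg-homo (+ m ℤ.* + ℕ.suc n) ⟩
      - ⟦ + m ℤ.* + ℕ.suc n ⟧
        ≈⟨ -‿cong (pos-*-homo m (+ ℕ.suc n)) ⟩
      - (⟦ + m ⟧ * ⟦ + ℕ.suc n ⟧)
        ≈⟨ -‿distribʳ-* _ _ ⟩
      ⟦ + m ⟧ * ⟦ -[1+ n ] ⟧ ∎

    *-homo : ∀ i j → ⟦ i ℤ.* j ⟧ ≈ ⟦ i ⟧ * ⟦ j ⟧
    *-homo (+ m)    j = pos-*-homo m j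
    *-homo -[1+ m ] j = begin
      ⟦ -[1+ m ] ℤ.* j ⟧
        ≈⟨ reflexive (≡.cong ⟦_⟧ (ℤₚ.neg-distribˡ-* (+ ℕ.suc m) j)) ⟨
      ⟦ ℤ.- (+ ℕ.suc m ℤ.* j) ⟧
        ≈⟨ neg-homo (+ ℕ.suc m ℤ.* j) ⟩
      - ⟦ + ℕ.suc m ℤ.* j ⟧
        ≈⟨ -‿cong (pos-*-homo (ℕ.suc m) j) ⟩
      - (⟦ + ℕ.suc m ⟧ * ⟦ j ⟧)
        ≈⟨ -‿distribˡ-* _ _ ⟩
      ⟦ -[1+ m ] ⟧ * ⟦ j ⟧ ∎

    morphism : CommutativeRing.rawRing ℤₚ.+-*-commutativeRing
                 -Raw-AlmostCommutative⟶ fromCommutativeRing R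
    morphism = record
      { ⟦_⟧    = ⟦_⟧
      ; +-homo = +-homo
      ; *-homo = *-homo
      ; -‿homo = neg-homo
      ; 0-homo = refl
      ; 1-homo = refl
      }

    ⟦⟧-≟ : ∀ i j → Maybe (⟦ i ⟧ ≈ ⟦ j ⟧)
    ⟦⟧-≟ i j with i ℤₚ.≟ j
    ... | yes i≡j = just (reflexive (≡.cong ⟦_⟧ i≡j))
    ... | no  _   = nothing

  open Algebra.Solver.Ring _ _ morphism ⟦⟧-≟ public
    using (solve; _:=_; _:+_; _:*_; _:-_; :-_; con)

-- Determinants as alternating forms of the rows.

-- The determinant is characterised, up to a scalar, as the alternating
-- multilinear form of the rows; multiplicativity follows.
module Determinant {c ℓ} (R : CommutativeRing c ℓ) where
  open CommutativeRing R hiding (zero)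
  open RingProperties ring using (-‿distribˡ-*)
  open MatrixOps R
  open SumProperties semiring
    using (sum; sum-cong-≋; ∑-distrib-+; ∑-comm; *-distribˡ-sum; *-distribʳ-sum; sum-replicate-zero)
  open ExpProperties semiring using (_^_)
  open IntegerCoefficients R
  open SetoidReasoning setoid

  V : ℕ → Set c
  V m = Fin m → Carrier

  infix 4 _≋_
  _≋_ : ∀ {m} → V m → V m → Set ℓ
  u ≋ v = ∀ k → u k ≈ v k

  sum-zero : ∀ {n} {f : V n} → (∀ i → f i ≈ 0#) → sum f ≈ 0#
  sum-zero {n} f≈0 = trans (sum-cong-≋ f≈0) (sum-replicate-zero n)

  sum-linear : ∀ {n} a (f g : V n) → sum (λ i → a * f i + g i) ≈ a * sum f + sum g
  sum-linear a f g = trans (∑-distrib-+ (λ i → a * f i) g) (+-congʳ (sym (*-distribˡ-sum a f)))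

  𝟙-suc : ∀ {n} (i j : Fin n) → 𝟙 (suc i) (suc j) ≈ 𝟙 i j
  𝟙-suc i j with i ≟ j
  ... | yes _ = refl
  ... | no  _ = refl

  𝟙-sym : ∀ {n} (i j : Fin n) → 𝟙 i j ≈ 𝟙 j i
  𝟙-sym i j with i ≟ j | j ≟ i
  ... | yes _   | yes _   = refl
  ... | no  _   | no  _   = refl
  ... | yes i≡j | no  j≢i = ⊥-elim (j≢i (≡.sym i≡j))
  ... | no  i≢j | yes j≡i = ⊥-elim (i≢j (≡.sym j≡i))

  sum-𝟙 : ∀ {n} i (f : V n) → sum (λ k → 𝟙 i k * f k) ≈ f i
  sum-𝟙 zero f = trans (+-cong (*-identityˡ _) (sum-zero λ k → zeroˡ (f (suc k)))) (+-identityʳ _)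
  sum-𝟙 (suc i) f = trans (+-cong (zeroˡ _)
    (trans (sum-cong-≋ λ k → *-congʳ {f (suc k)} (𝟙-suc i k)) (sum-𝟙 i (λ k → f (suc k)))))
    (+-identityˡ _)

  sum-𝟙ʳ : ∀ {n} j (f : V n) → sum (λ k → f k * 𝟙 k j) ≈ f j
  sum-𝟙ʳ j f = trans
    (sum-cong-≋ λ k → trans (*-comm _ _) (*-congʳ {f k} (𝟙-sym k j)))
    (sum-𝟙 j f)

  sum-linear₃ : ∀ {n} a b c (f g h : V n) →
    sum (λ i → a * f i + (b * g i + c * h i)) ≈ a * sum f + (b * sum g + c * sum h)
  sum-linear₃ a b c f g h = trans (sum-linear a f _)
    (+-congˡ (trans (sum-linear b g _) (+-congˡ (sym (*-distribˡ-sum c h)))))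

  ⊗-assoc : ∀ {n} (M N P : Matrix Carrier n) i j → ((M ⊗ N) ⊗ P) i j ≈ (M ⊗ (N ⊗ P)) i j
  ⊗-assoc M N P i j = begin
    sum (λ k → sum (λ l → M i l * N l k) * P k j)
      ≈⟨ sum-cong-≋ (λ k → trans (*-distribʳ-sum (P k j) (λ l → M i l * N l k))
           (sum-cong-≋ λ l → *-assoc (M i l) (N l k) (P k j))) ⟩
    sum (λ k → sum (λ l → M i l * (N l k * P k j)))
      ≈⟨ ∑-comm (λ k l → M i l * (N l k * P k j)) ⟩
    sum (λ l → sum (λ k → M i l * (N l k * P k j)))
      ≈⟨ sum-cong-≋ (λ l → sym (*-distribˡ-sum (M i l) (λ k → N l k * P k j))) ⟩
    sum (λ l → M i l * sum (λ k → N l k * P k j)) ∎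

  diagonal : ∀ {n} → V n → Matrix Carrier n
  diagonal v i j = v i * 𝟙 i j

  diagonal-sym : ∀ {n} (v : V n) i j → diagonal v i j ≈ diagonal v j i
  diagonal-sym v i j with i ≟ j | j ≟ i
  ... | yes i≡j | yes _   = *-congʳ (reflexive (≡.cong v i≡j))
  ... | no  _   | no  _   = trans (zeroʳ _) (sym (zeroʳ _))
  ... | yes i≡j | no  j≢i = ⊥-elim (j≢i (≡.sym i≡j))
  ... | no  i≢j | yes j≡i = ⊥-elim (i≢j (≡.sym j≡i))

  diagonal-conjugate : ∀ {n} (v : V n) (M : Matrix Carrier n) i j →
                       (diagonal v ᵀ ⊗ M ⊗ diagonal v) i j ≈ v i * M i j * v j
  diagonal-conjugate v M i j = begin
    sum (λ k → sum (λ l → diagonal v l i * M l k) * diagonal v k j)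
      ≈⟨ sum-cong-≋ (λ k → *-congʳ {diagonal v k j} (begin
           sum (λ l → v l * 𝟙 l i * M l k)
             ≈⟨ sum-cong-≋ (λ l → solve 3 (λ v e m → v :* e :* m := v :* m :* e) refl (v l) (𝟙 l i)
                  (M l k)) ⟩
           sum (λ l → v l * M l k * 𝟙 l i)
             ≈⟨ sum-𝟙ʳ i (λ l → v l * M l k) ⟩
           v i * M i k ∎)) ⟩
    sum (λ k → v i * M i k * (v k * 𝟙 k j))
      ≈⟨ sum-cong-≋ (λ k → sym (*-assoc (v i * M i k) (v k) (𝟙 k j))) ⟩
    sum (λ k → v i * M i k * v k * 𝟙 k j)
      ≈⟨ sum-𝟙ʳ j (λ k → v i * M i k * v k) ⟩
    v i * M i j * v j ∎

  record IsLinear {m} (L : V m → Carrier) : Set (c ⊔ ℓ) where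
    field
      cong   : ∀ {u v} → u ≋ v → L u ≈ L v
      linear : ∀ a u v → L (λ k → a * u k + v k) ≈ a * L u + L v

  open IsLinear

  linear-zero : ∀ {m} {L : V m → Carrier} → IsLinear L → L (λ _ → 0#) ≈ 0#
  linear-zero {L = L} lin = begin
    L (λ _ → 0#)                            ≈⟨ lin .cong (λ _ →
      solve 0 (con (+ 0) := :- con (+ 1) :* con (+ 0) :+ con (+ 0)) refl) ⟩
    L (λ _ → - 1# * 0# + 0#)                ≈⟨ lin .linear (- 1#) (λ _ → 0#) (λ _ → 0#) ⟩
    - 1# * L (λ _ → 0#) + L (λ _ → 0#)      ≈⟨ solve 1 (λ x → :- con (+ 1) :* x :+ x := con (+ 0))
      refl (L (λ _ → 0#)) ⟩
    0#                                      ∎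

  linear-expand : ∀ {m} {L : V m → Carrier} → IsLinear L →
                  ∀ u → L u ≈ sum (λ j → u j * L (𝟙 j))
  linear-expand {ℕ.zero} lin u = trans (lin .cong λ ()) (linear-zero lin)
  linear-expand {ℕ.suc m} {L} lin u = begin
    L u
      ≈⟨ lin .cong split ⟩
    L (λ k → u zero * 𝟙 zero k + (0# ∷ᵛ λ k → u (suc k)) k)
      ≈⟨ lin .linear (u zero) (𝟙 zero) _ ⟩
    u zero * L (𝟙 zero) + L (0# ∷ᵛ λ k → u (suc k))
      ≈⟨ +-congˡ (linear-expand tail-linear (λ k → u (suc k))) ⟩
    u zero * L (𝟙 zero) + sum (λ j → u (suc j) * L (0# ∷ᵛ 𝟙 j))
      ≈⟨ +-congˡ (sum-cong-≋ λ j → *-congˡ {u (suc j)} (lin .cong λ { zero →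
           refl ; (suc k) → sym (𝟙-suc j k) })) ⟩
    u zero * L (𝟙 zero) + sum (λ j → u (suc j) * L (𝟙 (suc j))) ∎
    where
    split : u ≋ (λ k → u zero * 𝟙 zero k + (0# ∷ᵛ λ k → u (suc k)) k)
    split zero    = solve 1 (λ x → x := x :* con (+ 1) :+ con (+ 0)) refl (u zero)
    split (suc k) = solve 2 (λ x y → x := y :* con (+ 0) :+ x) refl (u (suc k)) (u zero)
    tail-linear : IsLinear (λ w → L (0# ∷ᵛ w))
    tail-linear .cong u≋v = lin .cong λ { zero → refl ; (suc k) → u≋v k }
    tail-linear .linear a u v = trans
      (lin .cong λ { zero → solve 1 (λ x → con (+ 0) := x :* con (+ 0) :+ con (+ 0))
        refl a ; (suc k) → refl })
      (lin .linear a (0# ∷ᵛ u) (0# ∷ᵛ v))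

  Form : ℕ → ℕ → Set c
  Form n m = (Fin n → V m) → Carrier

  VanishesOnEqualHeads : ∀ n {m} → Form (ℕ.suc n) m → Set (c ⊔ ℓ)
  VanishesOnEqualHeads ℕ.zero    F = Lift _ ⊤
  VanishesOnEqualHeads (ℕ.suc n) F = ∀ u A → F (u ∷ᵛ u ∷ᵛ A) ≈ 0#

  Congruent : ∀ {n m} → Form n m → Set (c ⊔ ℓ)
  Congruent F = ∀ {A B} → (∀ i → A i ≋ B i) → F A ≈ F B

  -- Only equal adjacent rows are required to kill the form.
  data IsAlternating {m} : ∀ {n} → Form n m → Set (c ⊔ ℓ) where
    constant : {F : Form 0 m} → Congruent F → IsAlternating F
    rowwise  : ∀ {n} {F : Form (ℕ.suc n) m} →
               Congruent F →
               (∀ A → IsLinear (λ u → F (u ∷ᵛ A))) →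
               VanishesOnEqualHeads n F →
               (∀ u → IsAlternating (λ A → F (u ∷ᵛ A))) →
               IsAlternating F

  alt-cong : ∀ {n m} {F : Form n m} → IsAlternating F → Congruent F
  alt-cong (constant F-cong)      = F-cong
  alt-cong (rowwise F-cong _ _ _) = F-cong

  ∷-η : ∀ {n m} (A : Fin (ℕ.suc n) → V m) i → A i ≋ (A zero ∷ᵛ λ i → A (suc i)) i
  ∷-η A zero    k = refl
  ∷-η A (suc i) k = refl

  ∷-cong : ∀ {n m} {u v : V m} {A B : Fin n → V m} → u ≋ v → (∀ i → A i ≋ B i) →
           ∀ i → (u ∷ᵛ A) i ≋ (v ∷ᵛ B) i
  ∷-cong u≋v A≋B zero    = u≋v
  ∷-cong u≋v A≋B (suc i) = A≋B i

  -- Polarisation: expanding the form at `w , w` with `w` the sum of `u` and `v` gives 0, and of the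
  -- four terms only the two mixed ones survive.
  swap-heads : ∀ {n m} {F : Form (ℕ.suc (ℕ.suc n)) m} → IsAlternating F →
               ∀ u v A → F (u ∷ᵛ v ∷ᵛ A) ≈ - F (v ∷ᵛ u ∷ᵛ A)
  swap-heads {F = F} (rowwise F-cong F-linear F-vanish F-tail) u v A = begin
    F (u ∷ᵛ v ∷ᵛ A)
      ≈⟨ solve 2 (λ x y → x := (con (+ 1) :* (con (+ 1) :* con (+ 0) :+ x)
           :+ (con (+ 1) :* y :+ con (+ 0))) :- y) refl
           (F (u ∷ᵛ v ∷ᵛ A)) (F (v ∷ᵛ u ∷ᵛ A)) ⟩
    (1# * (1# * 0# + F (u ∷ᵛ v ∷ᵛ A)) + (1# * F (v ∷ᵛ u ∷ᵛ A) + 0#)) - F (v ∷ᵛ u ∷ᵛ A)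
      ≈⟨ +-congʳ (+-cong (*-congˡ (+-congʳ (*-congˡ (F-vanish u A)))) (+-congˡ (F-vanish v A))) ⟨
    (1# * (1# * F (u ∷ᵛ u ∷ᵛ A) + F (u ∷ᵛ v ∷ᵛ A)) + (1# * F (v ∷ᵛ u ∷ᵛ A) + F (v ∷ᵛ v ∷ᵛ A))) - F
      (v ∷ᵛ u ∷ᵛ A)
      ≈⟨ +-congʳ (+-cong (*-congˡ (second u)) (second v)) ⟨
    (1# * F (u ∷ᵛ w ∷ᵛ A) + F (v ∷ᵛ w ∷ᵛ A)) - F (v ∷ᵛ u ∷ᵛ A)
      ≈⟨ +-congʳ (F-linear (w ∷ᵛ A) .linear 1# u v) ⟨
    F (w ∷ᵛ w ∷ᵛ A) - F (v ∷ᵛ u ∷ᵛ A)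
      ≈⟨ +-congʳ (F-vanish w A) ⟩
    0# - F (v ∷ᵛ u ∷ᵛ A)
      ≈⟨ +-identityˡ _ ⟩
    - F (v ∷ᵛ u ∷ᵛ A) ∎
    where
    w : V _
    w k = 1# * u k + v k
    second : ∀ x → F (x ∷ᵛ w ∷ᵛ A) ≈ 1# * F (x ∷ᵛ u ∷ᵛ A) + F (x ∷ᵛ v ∷ᵛ A)
    second x with F-tail x
    ... | rowwise _ tail-linear _ _ = tail-linear A .linear 1# u v

  -- The row is first brought to second place inside the tail form, by induction, and then one swap
  -- of the heads adds the remaining sign.
  move-to-head : ∀ {n m} {F : Form (ℕ.suc n) m} → IsAlternating F → ∀ j f →
                 F (f j ∷ᵛ λ k → f (punchIn j k)) ≈ sign j * F f
  move-to-head {F = F} alt zero f =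
    trans (alt-cong alt (λ i k → sym (∷-η f i k))) (sym (*-identityˡ _))
  move-to-head {ℕ.suc n} {F = F} alt@(rowwise F-cong _ _ F-tail) (suc j) f = begin
    F (f (suc j) ∷ᵛ λ k → f (punchIn (suc j) k))
      ≈⟨ F-cong (∷-cong (λ _ → refl) λ { zero k → refl ; (suc i) k → refl }) ⟩
    F (f (suc j) ∷ᵛ f zero ∷ᵛ λ k → f (suc (punchIn j k)))
      ≈⟨ swap-heads alt _ _ _ ⟩
    - F (f zero ∷ᵛ f (suc j) ∷ᵛ λ k → f (suc (punchIn j k)))
      ≈⟨ -‿cong (move-to-head (F-tail (f zero)) j (λ i → f (suc i))) ⟩
    - (sign j * F (f zero ∷ᵛ λ i → f (suc i)))
      ≈⟨ -‿cong (*-congˡ (F-cong λ i k → sym (∷-η f i k))) ⟩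
    - (sign j * F f)
      ≈⟨ -‿distribˡ-* _ _ ⟩
    - sign j * F f ∎

  sign-square : ∀ {n} (j : Fin n) → sign j * sign j ≈ 1#
  sign-square zero    = *-identityˡ 1#
  sign-square (suc j) = trans (solve 1 (λ x → :- x :* :- x := x :* x) refl (sign j)) (sign-square j)

  -- Moving the equal row to second place makes it adjacent to the head. The sign incurred is its
  -- own inverse, so it can be introduced beforehand.
  repeated-head : ∀ {n m} {F : Form (ℕ.suc n) m} → IsAlternating F →
                  ∀ u A i → A i ≋ u → F (u ∷ᵛ A) ≈ 0#
  repeated-head {ℕ.suc n} {F = F} (rowwise F-cong _ F-vanish F-tail) u A i Ai≋u = begin
    F (u ∷ᵛ A)
      ≈⟨ *-identityˡ _ ⟨
    1# * F (u ∷ᵛ A)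
      ≈⟨ *-congʳ (sign-square i) ⟨
    sign i * sign i * F (u ∷ᵛ A)
      ≈⟨ *-assoc _ _ _ ⟩
    sign i * (sign i * F (u ∷ᵛ A))
      ≈⟨ *-congˡ (move-to-head (F-tail u) i A) ⟨
    sign i * F (u ∷ᵛ A i ∷ᵛ λ k → A (punchIn i k))
      ≈⟨ *-congˡ (F-cong (∷-cong (λ _ → refl) (∷-cong Ai≋u λ _ _ → refl))) ⟩
    sign i * F (u ∷ᵛ u ∷ᵛ λ k → A (punchIn i k))
      ≈⟨ *-congˡ (F-vanish u _) ⟩
    sign i * 0#
      ≈⟨ zeroʳ _ ⟩
    0# ∎

  -- Rows are cleared from the top: by linearity each multiple of `u` contributes a form with a row
  -- equal to `u`, which is killed. With `u` a unit vector this empties a whole column.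
  shear : ∀ {n m} {F : Form n m} → IsAlternating F → ∀ u →
          (∀ A i → A i ≋ u → F A ≈ 0#) →
          ∀ (a : Fin n → Carrier) A B → (∀ i k → A i k ≈ a i * u k + B i k) → F A ≈ F B
  shear (constant F-cong) u kill a A B A≈ = F-cong λ ()
  shear {F = F} (rowwise F-cong F-linear _ F-tail) u kill a A B A≈ = begin
    F A
      ≈⟨ F-cong (λ { zero → A≈ zero ; (suc i) k → refl }) ⟩
    F ((λ k → a zero * u k + B zero k) ∷ᵛ tail A)
      ≈⟨ F-linear (tail A) .linear (a zero) u (B zero) ⟩
    a zero * F (u ∷ᵛ tail A) + F (B zero ∷ᵛ tail A)
      ≈⟨ +-congʳ (trans (*-congˡ (kill _ zero λ _ → refl)) (zeroʳ _)) ⟩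
    0# + F (B zero ∷ᵛ tail A)
      ≈⟨ +-identityˡ _ ⟩
    F (B zero ∷ᵛ tail A)
      ≈⟨ shear (F-tail (B zero)) u (λ C i → kill _ (suc i)) (λ i → a (suc i)) (tail A) (tail B)
           (λ i → A≈ (suc i)) ⟩
    F (B zero ∷ᵛ tail B)
      ≈⟨ F-cong (λ i k → sym (∷-η B i k)) ⟩
    F B ∎
    where
    tail : ∀ {n m} → (Fin (ℕ.suc n) → V m) → Fin n → V m
    tail C i = C (suc i)

  record IsLinearMap {m m′} (T : V m → V m′) : Set (c ⊔ ℓ) where
    field
      map-cong   : ∀ {u v} → u ≋ v → T u ≋ T v
      map-linear : ∀ a u v → T (λ k → a * u k + v k) ≋ (λ k → a * T u k + T v k)

  open IsLinearMap

  -- Applying a map to all rows commutes with prepending a row only pointwise, so being alternating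
  -- has to be carried along pointwise equality of forms.
  alternating-resp : ∀ {n m} {F G : Form n m} → (∀ A → F A ≈ G A) → IsAlternating F →
    IsAlternating G
  alternating-resp F≈G (constant F-cong) =
    constant λ A≋B → trans (sym (F≈G _)) (trans (F-cong A≋B) (F≈G _))
  alternating-resp {ℕ.suc n} {F = F} {G} F≈G (rowwise F-cong F-linear F-vanish F-tail) = rowwise
    (λ A≋B → trans (sym (F≈G _)) (trans (F-cong A≋B) (F≈G _)))
    (λ A → record
      { cong   = λ u≋v → trans (sym (F≈G _)) (trans (F-linear A .cong u≋v) (F≈G _))
      ; linear = λ a u v → trans (sym (F≈G _))
                   (trans (F-linear A .linear a u v) (+-cong (*-congˡ (F≈G _)) (F≈G _)))
      })
    (vanish n F≈G F-vanish)
    (λ u → alternating-resp (λ A → F≈G _) (F-tail u))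
    where
    vanish : ∀ n {m} {F G : Form (ℕ.suc n) m} → (∀ A → F A ≈ G A) →
             VanishesOnEqualHeads n F → VanishesOnEqualHeads n G
    vanish ℕ.zero    F≈G F-vanish     = lift _
    vanish (ℕ.suc n) F≈G F-vanish u A = trans (sym (F≈G _)) (F-vanish u A)

  alternating-map : ∀ {n m m′} {T : V m → V m′} → IsLinearMap T → {F : Form n m′} →
                    IsAlternating F → IsAlternating (λ A → F (λ i → T (A i)))
  alternating-map T-lin (constant F-cong) = constant λ _ → F-cong λ ()
  alternating-map {ℕ.suc n} {T = T} T-lin {F} (rowwise F-cong F-linear F-vanish F-tail) = rowwise
    (λ A≋B → F-cong λ i → T-lin .map-cong (A≋B i))
    (λ A → record
      { cong   = λ u≋v → F-cong λ { zero → T-lin .map-cong u≋v ; (suc i) k → refl }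
      ; linear = λ a u v → trans
          (F-cong λ { zero → T-lin .map-linear a u v ; (suc i) k → refl })
          (trans (F-linear (λ i → T (A i)) .linear a (T u) (T v))
            (+-cong (*-congˡ (push u A)) (push v A)))
      })
    (vanish n F-cong F-vanish)
    (λ u → alternating-resp (λ A → push u A) (alternating-map T-lin (F-tail (T u))))
    where
    push : ∀ u A → F (T u ∷ᵛ λ i → T (A i)) ≈ F (λ i → T ((u ∷ᵛ A) i))
    push u A = F-cong λ { zero k → refl ; (suc i) k → refl }
    vanish : ∀ n {F : Form (ℕ.suc n) _} → Congruent F →
             VanishesOnEqualHeads n F → VanishesOnEqualHeads n (λ A → F (λ i → T (A i)))
    vanish ℕ.zero    F-cong F-vanish     = lift _
    vanish (ℕ.suc n) F-cong F-vanish u A = trans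
      (F-cong λ { zero k → refl ; (suc zero) k → refl ; (suc (suc i)) k → refl })
      (F-vanish (T u) (λ i → T (A i)))

  alternating-zero : ∀ {n m} → IsAlternating {m} {n} (λ _ → 0#)
  alternating-zero {ℕ.zero}  = constant λ _ → refl
  alternating-zero {ℕ.suc n} = rowwise (λ _ → refl)
    (λ A → record { cong = λ _ → refl
                  ; linear = λ a u v → solve 1 (λ x → con (+ 0) := x :* con (+ 0) :+ con (+ 0))
                    refl a })
    (vanish n) (λ u → alternating-zero)
    where
    vanish : ∀ n {m} → VanishesOnEqualHeads n {m} (λ _ → 0#)
    vanish ℕ.zero    = lift _
    vanish (ℕ.suc n) = λ u A → refl

  alternating-combine : ∀ {n m} a {F G : Form n m} → IsAlternating F → IsAlternating G →
                        IsAlternating (λ A → a * F A + G A)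
  alternating-combine a (constant F-cong) (constant G-cong) =
    constant λ A≋B → +-cong (*-congˡ (F-cong A≋B)) (G-cong A≋B)
  alternating-combine {ℕ.suc n} a {F} {G} (rowwise F-cong F-linear F-vanish F-tail)
                                          (rowwise G-cong G-linear G-vanish G-tail) = rowwise
    (λ A≋B → +-cong (*-congˡ (F-cong A≋B)) (G-cong A≋B))
    (λ A → record
      { cong   = λ u≋v → +-cong (*-congˡ (F-linear A .cong u≋v)) (G-linear A .cong u≋v)
      ; linear = λ b u v → trans
          (+-cong (*-congˡ (F-linear A .linear b u v)) (G-linear A .linear b u v))
          (solve 6 (λ a b x y z w → a :* (b :* x :+ y) :+ (b :* z :+ w)
                     := b :* (a :* x :+ z) :+ (a :* y :+ w)) refl
             a b (F (u ∷ᵛ A)) (F (v ∷ᵛ A)) (G (u ∷ᵛ A)) (G (v ∷ᵛ A)))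
      })
    (vanish n F-vanish G-vanish)
    (λ u → alternating-combine a (F-tail u) (G-tail u))
    where
    vanish : ∀ n {m} {F G : Form (ℕ.suc n) m} → VanishesOnEqualHeads n F →
             VanishesOnEqualHeads n G → VanishesOnEqualHeads n (λ A → a * F A + G A)
    vanish ℕ.zero    F-vanish G-vanish     = lift _
    vanish (ℕ.suc n) F-vanish G-vanish u A = trans (+-cong (*-congˡ (F-vanish u A)) (G-vanish u A))
      (solve 1 (λ x → x :* con (+ 0) :+ con (+ 0) := con (+ 0)) refl a)

  -- With the first row held fixed, the Laplace expansion is such a combination of minors of the
  -- remaining rows.
  alternating-sum : ∀ {n m k} (a : Fin k → Carrier) {F : Fin k → Form n m} →
                    (∀ j → IsAlternating (F j)) → IsAlternating (λ A → sum (λ j → a j * F j A))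
  alternating-sum {k = ℕ.zero}  a alt = alternating-zero
  alternating-sum {k = ℕ.suc k} a alt =
    alternating-combine (a zero) (alt zero) (alternating-sum (λ j → a (suc j)) (λ j → alt (suc j)))

  -- Embeds the vectors of length n as those with coordinate `j` equal to 0. A form in n + 1 columns
  -- thereby restricts to one in n columns, to which induction applies.
  insert-zero : ∀ {n} → Fin (ℕ.suc n) → V n → V (ℕ.suc n)
  insert-zero zero v zero    = 0#
  insert-zero zero v (suc k) = v k
  insert-zero {ℕ.suc n} (suc j) v zero    = v zero
  insert-zero {ℕ.suc n} (suc j) v (suc k) = insert-zero j (λ i → v (suc i)) k

  insert-zero-linear : ∀ {n} (j : Fin (ℕ.suc n)) → IsLinearMap (insert-zero j)
  insert-zero-linear j = record { map-cong = cong′ j ; map-linear = linear′ j }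
    where
    cong′ : ∀ {n} (j : Fin (ℕ.suc n)) {u v} → u ≋ v → insert-zero j u ≋ insert-zero j v
    cong′ zero u≋v zero    = refl
    cong′ zero u≋v (suc k) = u≋v k
    cong′ {ℕ.suc n} (suc j) u≋v zero    = u≋v zero
    cong′ {ℕ.suc n} (suc j) u≋v (suc k) = cong′ j (λ i → u≋v (suc i)) k
    linear′ : ∀ {n} (j : Fin (ℕ.suc n)) a u v → insert-zero j (λ k → a * u k + v k) ≋
              (λ k → a * insert-zero j u k + insert-zero j v k)
    linear′ zero a u v zero    = solve 1 (λ x → con (+ 0) := x :* con (+ 0) :+ con (+ 0)) refl a
    linear′ zero a u v (suc k) = refl
    linear′ {ℕ.suc n} (suc j) a u v zero    = refl
    linear′ {ℕ.suc n} (suc j) a u v (suc k) = linear′ j a (λ i → u (suc i)) (λ i → v (suc i)) k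

  -- This is the decomposition required by `shear` when the unit vector `𝟙 j` plays the role of `u`.
  insert-zero-punchIn : ∀ {n} (j : Fin (ℕ.suc n)) v →
                        v ≋ (λ k → v j * 𝟙 j k + insert-zero j (λ i → v (punchIn j i)) k)
  insert-zero-punchIn zero v zero    = solve 1 (λ x → x := x :* con (+ 1) :+ con (+ 0))
    refl (v zero)
  insert-zero-punchIn zero v (suc k) = solve 2 (λ x y → x := y :* con (+ 0) :+ x) refl (v (suc k))
    (v zero)
  insert-zero-punchIn {ℕ.suc n} (suc j) v zero =
    solve 2 (λ x y → x := y :* con (+ 0) :+ x) refl (v zero) (v (suc j))
  insert-zero-punchIn {ℕ.suc n} (suc j) v (suc k) =
    trans (insert-zero-punchIn j (λ i → v (suc i)) k) (+-congʳ (*-congˡ (sym (𝟙-suc j k))))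

  insert-zero-𝟙 : ∀ {n} (j : Fin (ℕ.suc n)) i → insert-zero j (𝟙 i) ≋ 𝟙 (punchIn j i)
  insert-zero-𝟙 zero    i zero    = refl
  insert-zero-𝟙 zero    i (suc k) = sym (𝟙-suc i k)
  insert-zero-𝟙 (suc j) zero zero    = refl
  insert-zero-𝟙 (suc j) (suc i) zero = refl
  insert-zero-𝟙 (suc j) zero (suc k) = insert-zero-0 j k
    where
    insert-zero-0 : ∀ {n} (j : Fin (ℕ.suc n)) → insert-zero j (λ _ → 0#) ≋ (λ _ → 0#)
    insert-zero-0 zero zero    = refl
    insert-zero-0 zero (suc k) = refl
    insert-zero-0 {ℕ.suc n} (suc j) zero    = refl
    insert-zero-0 {ℕ.suc n} (suc j) (suc k) = insert-zero-0 j k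
  insert-zero-𝟙 (suc j) (suc i) (suc k) =
    trans (insert-zero-linear j .map-cong (𝟙-suc i) k)
      (trans (insert-zero-𝟙 j i k) (sym (𝟙-suc (punchIn j i) k)))

  -- Linearity expands the first row over unit vectors. Once the head is `𝟙 j`, column `j` of the
  -- other rows can be cleared, and what is left is an alternating form of the minor; moving `𝟙 j`
  -- back into place supplies the sign, so the Laplace expansion reappears.
  alternating-unique : ∀ {n} {F : Form n n} → IsAlternating F → ∀ M → F M ≈ det M * F 𝟙
  alternating-unique {ℕ.zero} alt M = trans (alt-cong alt λ ()) (sym (*-identityˡ _))
  alternating-unique {ℕ.suc n} {F} alt@(rowwise F-cong F-linear _ F-tail) M = begin
    F M
      ≈⟨ F-cong (∷-η M) ⟩
    F (M zero ∷ᵛ tail)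
      ≈⟨ linear-expand (F-linear tail) (M zero) ⟩
    sum (λ j → M zero j * F (𝟙 j ∷ᵛ tail))
      ≈⟨ sum-cong-≋ (λ j → *-congˡ {M zero j} (cofactor j)) ⟩
    sum (λ j → M zero j * (det (minor j) * (sign j * F 𝟙)))
      ≈⟨ sum-cong-≋ (λ j → solve 4 (λ m d s f → m :* (d :* (s :* f)) := s :* m :* d :* f) refl
           (M zero j) (det (minor j)) (sign j) (F 𝟙)) ⟩
    sum (λ j → sign j * M zero j * det (minor j) * F 𝟙)
      ≈⟨ *-distribʳ-sum (F 𝟙) (λ j → sign j * M zero j * det (minor j)) ⟨
    det M * F 𝟙 ∎
    where
    tail : Fin n → V (ℕ.suc n)
    tail i = M (suc i)
    minor : Fin (ℕ.suc n) → Matrix Carrier n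
    minor j i k = M (suc i) (punchIn j k)
    cofactor : ∀ j → F (𝟙 j ∷ᵛ tail) ≈ det (minor j) * (sign j * F 𝟙)
    cofactor j = begin
      F (𝟙 j ∷ᵛ tail)
        ≈⟨ shear (F-tail (𝟙 j)) (𝟙 j) (repeated-head alt (𝟙 j)) (λ i → M (suc i) j)
             tail (λ i → insert-zero j (minor j i)) (λ i → insert-zero-punchIn j (tail i)) ⟩
      F (𝟙 j ∷ᵛ λ i → insert-zero j (minor j i))
        ≈⟨ alternating-unique (alternating-map (insert-zero-linear j) (F-tail (𝟙 j))) (minor j) ⟩
      det (minor j) * F (𝟙 j ∷ᵛ λ i → insert-zero j (𝟙 i))
        ≈⟨ *-congˡ (F-cong (∷-cong (λ _ → refl) (insert-zero-𝟙 j))) ⟩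
      det (minor j) * F (𝟙 j ∷ᵛ λ i → 𝟙 (punchIn j i))
        ≈⟨ *-congˡ (move-to-head alt j 𝟙) ⟩
      det (minor j) * (sign j * F 𝟙) ∎

  det-cong : ∀ {n} {M N : Matrix Carrier n} → (∀ i j → M i j ≈ N i j) → det M ≈ det N
  det-cong {ℕ.zero}  M≈N = refl
  det-cong {ℕ.suc n} M≈N = sum-cong-≋ λ j →
    *-cong (*-congˡ {sign j} (M≈N zero j)) (det-cong λ i k → M≈N (suc i) (punchIn j k))

  -- A pair of distinct columns is coded as a first column `j` and the index `k` of the second among
  -- the rest. The two equations say that `j , k` and `j′ , k′` code the same pair in opposite
  -- orders.
  ExchangeInvariant : ∀ {n a} {A : Set a} {ℓ′} → (A → A → Set ℓ′) →
                      (Fin (ℕ.suc n) → Fin n → A) → Set ℓ′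
  ExchangeInvariant {n} _∼_ Ψ = ∀ j k j′ k′ → punchIn j k ≡ j′ → punchIn j′ k′ ≡ j → Ψ j k ∼ Ψ j′ k′

  punchIn-exchange : ∀ {n} (c : Fin n) → ExchangeInvariant _≡_ λ j k → punchIn j (punchIn k c)
  punchIn-exchange c zero k .(suc k) zero ≡.refl _ = ≡.refl
  punchIn-exchange c (suc j) zero .zero .j ≡.refl ≡.refl = ≡.refl
  punchIn-exchange zero (suc j) (suc k) _ (suc k′) ≡.refl _ = ≡.refl
  punchIn-exchange (suc c) (suc j) (suc k) _ (suc k′) ≡.refl eq =
    ≡.cong suc (punchIn-exchange c j k _ k′ ≡.refl (suc-injective eq))

  -- In an iterated Laplace expansion with two equal rows x, the pair of columns
  -- (j , punchIn j k) cancels against the same pair reversed.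
  pairs-cancel : ∀ {n} (x : V (ℕ.suc n)) (Ψ : Fin (ℕ.suc n) → Fin n → Carrier) →
                 ExchangeInvariant _≈_ Ψ →
                 sum (λ j → sign j * x j * sum (λ k → sign k * x (punchIn j k) * Ψ j k)) ≈ 0#
  pairs-cancel {ℕ.zero} x Ψ inv = trans (+-identityʳ _) (zeroʳ _)
  pairs-cancel {ℕ.suc n} x Ψ inv = begin
    1# * x₀ * sum top + sum (λ j → - sign j * x (suc j) * (1# * x₀ * Ψ (suc j) zero + sum (rest j)))
      -- The pair coded by `suc j , zero` is the reverse of the one coded by `zero , j`, so these
      -- terms become the negative of the leading one. The pairs that avoid column `zero` form the
      -- same sum in one dimension less.
      ≈⟨ +-congˡ (sum-cong-≋ λ j → trans (distribˡ _ _ _) (+-cong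
           (trans (*-congˡ (*-congˡ (sym (inv zero j (suc j) zero ≡.refl ≡.refl))))
             (solve 4 (λ s y z p → :- s :* y :* (con (+ 1) :* z :* p) := :- z :* (s :* y :* p)) refl
               (sign j) (x (suc j)) x₀ (Ψ zero j)))
           (trans (*-congˡ (trans (sum-cong-≋ λ k →
               solve 3 (λ s y p → :- s :* y :* p := :- con (+ 1) :* (s :* y :* p)) refl
                 (sign k) (x (suc (punchIn j k))) (Ψ (suc j) (suc k)))
               (sym (*-distribˡ-sum (- 1#) (rest′ j)))))
             (solve 3 (λ s y q → :- s :* y :* (:- con (+ 1) :* q) := s :* y :* q) refl
               (sign j) (x (suc j)) (sum (rest′ j)))))) ⟩
    1# * x₀ * sum top + sum (λ j → - x₀ * top j + sign j * x (suc j) * sum (rest′ j))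
      ≈⟨ +-congˡ (sum-linear (- x₀) top (λ j → sign j * x (suc j) * sum (rest′ j))) ⟩
    1# * x₀ * sum top + (- x₀ * sum top + sum (λ j → sign j * x (suc j) * sum (rest′ j)))
      ≈⟨ +-congˡ (+-congˡ (pairs-cancel (λ j → x (suc j)) (λ j k → Ψ (suc j) (suc k))
           (λ j k j′ k′ p q → inv (suc j) (suc k) (suc j′) (suc k′) (≡.cong suc p)
             (≡.cong suc q)))) ⟩
    1# * x₀ * sum top + (- x₀ * sum top + 0#)
      ≈⟨ solve 2 (λ y q → con (+ 1) :* y :* q :+ (:- y :* q :+ con (+ 0)) := con (+ 0))
           refl x₀ (sum top) ⟩
    0# ∎
    where
    x₀ = x zero
    top : Fin (ℕ.suc n) → Carrier
    top k = sign k * x (suc k) * Ψ zero k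
    rest rest′ : Fin (ℕ.suc n) → Fin n → Carrier
    rest  j k = - sign k * x (suc (punchIn j k)) * Ψ (suc j) (suc k)
    rest′ j k = sign k * x (suc (punchIn j k)) * Ψ (suc j) (suc k)

  -- For two equal first rows the expansion is carried out twice, and pairs of columns cancel.
  -- Conditions on later rows are inherited from the minors by induction.
  det-alternating : ∀ {n} → IsAlternating {n} {n} det
  det-alternating {ℕ.zero}  = constant λ _ → refl
  det-alternating {ℕ.suc n} = rowwise det-cong head-linear (vanish n) λ u →
    alternating-sum (λ j → sign j * u j) λ j →
      alternating-map (record { map-cong = λ u≋v k → u≋v (punchIn j k) ; map-linear = λ a u v k →
        refl })
        det-alternating
    where
    minor : (Fin n → V (ℕ.suc n)) → Fin (ℕ.suc n) → Carrier
    minor A j = det (λ i k → A i (punchIn j k))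
    head-linear : ∀ A → IsLinear (λ u → det (u ∷ᵛ A))
    head-linear A .cong u≋v = sum-cong-≋ λ j → *-congʳ {minor A j} (*-congˡ {sign j} (u≋v j))
    head-linear A .linear a u v = trans
      (sum-cong-≋ λ j → solve 5 (λ s a x y d →
        s :* (a :* x :+ y) :* d := a :* (s :* x :* d) :+ s :* y :* d) refl
        (sign j) a (u j) (v j) (minor A j))
      (sum-linear a (λ j → sign j * u j * minor A j) (λ j → sign j * v j * minor A j))
    vanish : ∀ n → VanishesOnEqualHeads n {ℕ.suc n} det
    vanish ℕ.zero        = lift _
    vanish (ℕ.suc n) u A = pairs-cancel u (λ j k → det (λ i c → A i (punchIn j (punchIn k c))))
      λ j k j′ k′ p q → det-cong λ i c →
        reflexive (≡.cong (A i) (punchIn-exchange c j k j′ k′ p q))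

  -- For fixed `N` the left side is alternating in the rows of `M`, since each row is separately
  -- mapped through `N`. By uniqueness it is `det M` times its value at the identity.
  det-⊗ : ∀ {n} (M N : Matrix Carrier n) → det (M ⊗ N) ≈ det M * det N
  det-⊗ M N = trans
    (alternating-unique (alternating-map times-linear det-alternating) M)
    (*-congˡ (det-cong λ i j → sum-𝟙 i (λ k → N k j)))
    where
    times-linear : IsLinearMap (λ v j → sum (λ k → v k * N k j))
    times-linear .map-cong u≋v j = sum-cong-≋ λ k → *-congʳ {N k j} (u≋v k)
    times-linear .map-linear a u v j = trans
      (sum-cong-≋ λ k → solve 4 (λ a x y z → (a :* x :+ y) :* z := a :* (x :* z) :+ y :* z) refl
        a (u k) (v k) (N k j))
      (sum-linear a (λ k → u k * N k j) (λ k → v k * N k j))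

  det-𝟙 : ∀ {n} → det (𝟙 {n}) ≈ 1#
  det-𝟙 {ℕ.zero}  = refl
  det-𝟙 {ℕ.suc n} = trans
    (+-cong (trans (*-congʳ (*-identityˡ 1#))
      (trans (*-identityˡ _) (trans (det-cong (𝟙-suc {n})) (det-𝟙 {n}))))
      (sum-zero {n} {λ j → - sign j * 0# * det (λ i k → 𝟙 (suc i) (punchIn (suc j) k))} λ j → 
        trans (*-congʳ {det (λ i k → 𝟙 (suc i) (punchIn (suc j) k))} (zeroʳ (- sign j))) (zeroˡ _)))
    (+-identityʳ 1#)

  det-scale : ∀ {n} a (M : Matrix Carrier n) → det (λ i j → a * M i j) ≈ a ^ n * det M
  det-scale {ℕ.zero}  a M = sym (*-identityˡ _)
  det-scale {ℕ.suc n} a M = trans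
    (sum-cong-≋ λ j → trans (*-congˡ (det-scale a (minor j)))
      (solve 5 (λ s a x p d → s :* (a :* x) :* (p :* d) := a :* p :* (s :* x :* d)) refl
        (sign j) a (M zero j) (a ^ n) (det (minor j))))
    (sym (*-distribˡ-sum (a ^ ℕ.suc n) (λ j → sign j * M zero j * det (minor j))))
    where
    minor : Fin (ℕ.suc n) → Matrix Carrier n
    minor j i k = M (suc i) (punchIn j k)

  det-conjugate : ∀ {n} (v : V n) → (∀ i → v i * v i ≈ 1#) → (M : Matrix Carrier n) →
                  det (λ i j → v i * M i j * v j) ≈ det M
  det-conjugate {n} v v² M = begin
    det (λ i j → v i * M i j * v j)
      ≈⟨ det-cong (diagonal-conjugate v M) ⟨
    det (diagonal v ᵀ ⊗ M ⊗ diagonal v)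
      ≈⟨ trans (det-⊗ (diagonal v ᵀ ⊗ M) (diagonal v)) (*-congʳ (det-⊗ (diagonal v ᵀ) M)) ⟩
    det (diagonal v ᵀ) * det M * det (diagonal v)
      ≈⟨ *-congʳ (*-congʳ (det-cong λ i j → diagonal-sym v j i)) ⟩
    det (diagonal v) * det M * det (diagonal v)
      ≈⟨ solve 2 (λ d m → d :* m :* d := d :* d :* m) refl (det (diagonal v)) (det M) ⟩
    det (diagonal v) * det (diagonal v) * det M
      ≈⟨ *-congʳ (det-⊗ (diagonal v) (diagonal v)) ⟨
    det (diagonal v ⊗ diagonal v) * det M
      ≈⟨ *-congʳ (trans (det-cong square) (det-𝟙 {n})) ⟩
    1# * det M
      ≈⟨ *-identityˡ _ ⟩
    det M ∎
    where
    square : ∀ i j → (diagonal v ⊗ diagonal v) i j ≈ 𝟙 i j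
    square i j = begin
      sum (λ k → v i * 𝟙 i k * (v k * 𝟙 k j))
        ≈⟨ sum-cong-≋ (λ k → solve 4 (λ v e w f → v :* e :* (w :* f) := e :* (v :* w :* f)) refl
             (v i) (𝟙 i k) (v k) (𝟙 k j)) ⟩
      sum (λ k → 𝟙 i k * (v i * v k * 𝟙 k j))
        ≈⟨ sum-𝟙 i (λ k → v i * v k * 𝟙 k j) ⟩
      v i * v i * 𝟙 i j
        ≈⟨ trans (*-congʳ (v² i)) (*-identityˡ _) ⟩
      𝟙 i j ∎

-- Apartness, cancellation and characteristic zero.

module OrderedFieldProperties {c ℓ₁ ℓ₂ ℓ₃} (K : OrderedField c ℓ₁ ℓ₂ ℓ₃) where
  open OrderedField K hiding (zero)
  open HeytingProperties (HeytingField.heytingCommutativeRing heytingField) public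
    using (x#0y#0→xy#0; #-congʳ; #-congˡ)
  open IntegerCoefficients commutativeRing
  open SetoidReasoning setoid

  inverse : ∀ {x} → x # 0# → Σ[ y ∈ Carrier ] x * y ≈ 1#
  inverse {x} x#0 with #⇒invertible x#0
  ... | y , _ , xy≈1 = y , trans (solve 2 (λ x y → x :* y := (x :- con (+ 0)) :* y) refl x y) xy≈1

  inverse⇒#0 : ∀ {x y} → x * y ≈ 1# → x # 0#
  inverse⇒#0 {x} {y} xy≈1 = invertible⇒#
    ( y
    , trans (solve 2 (λ x y → y :* (x :- con (+ 0)) := x :* y) refl x y) xy≈1
    , trans (solve 2 (λ x y → (x :- con (+ 0)) :* y := x :* y) refl x y) xy≈1 )

  #⇒-#0 : ∀ {x y} → x # y → x - y # 0#
  #⇒-#0 x#y with #⇒invertible x#y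
  ... | z , _ , eq = inverse⇒#0 eq

  -#0⇒# : ∀ {x y} → x - y # 0# → x # y
  -#0⇒# {x} {y} x-y#0 with inverse x-y#0
  ... | z , eq = invertible⇒# (z , trans (*-comm z _) eq , eq)

  product#0ˡ : ∀ {x y} → x * y # 0# → x # 0#
  product#0ˡ {x} {y} xy#0 with inverse xy#0
  ... | z , eq = inverse⇒#0 (trans (sym (*-assoc x y z)) eq)

  product#0ʳ : ∀ {x y} → x * y # 0# → y # 0#
  product#0ʳ {x} {y} xy#0 = product#0ˡ (#-congʳ (*-comm x y) xy#0)

  cancel-zero : ∀ {x y} → x # 0# → x * y ≈ 0# → y ≈ 0#
  cancel-zero {x} {y} x#0 xy≈0 with inverse x#0
  ... | z , xz≈1 = begin
    y           ≈⟨ *-identityˡ y ⟨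
    1# * y      ≈⟨ *-congʳ xz≈1 ⟨
    x * z * y   ≈⟨ solve 3 (λ x y z → x :* z :* y := z :* (x :* y)) refl x y z ⟩
    z * (x * y) ≈⟨ *-congˡ xy≈0 ⟩
    z * 0#      ≈⟨ solve 1 (λ z → z :* con (+ 0) := con (+ 0)) refl z ⟩
    0#          ∎

  x-y≈0⇒x≈y : ∀ {x y} → x - y ≈ 0# → x ≈ y
  x-y≈0⇒x≈y {x} {y} eq = begin
    x           ≈⟨ solve 2 (λ x y → x := x :- y :+ y) refl x y ⟩
    x - y + y   ≈⟨ +-congʳ eq ⟩
    0# + y      ≈⟨ +-identityˡ y ⟩
    y           ∎

  x≈y⇒x-y≈0 : ∀ {x y} → x ≈ y → x - y ≈ 0#
  x≈y⇒x-y≈0 {x} {y} x≈y = trans (+-congʳ x≈y) (-‿inverseʳ y)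

  cancelˡ : ∀ {x y z} → x # 0# → x * y ≈ x * z → y ≈ z
  cancelˡ {x} {y} {z} x#0 eq = x-y≈0⇒x≈y (cancel-zero x#0 (trans
    (solve 3 (λ x y z → x :* (y :- z) := x :* y :- x :* z) refl x y z) (x≈y⇒x-y≈0 eq)))

  one-zero : ¬ 1# ≈ 0#
  one-zero 1≈0 = #-irrefl 1≈0 1#0

  0<fromℕ : ∀ n → 0# < fromℕ (ℕ.suc n)
  0<fromℕ ℕ.zero    = <-respʳ-≈ (sym (+-identityʳ 1#)) 0<1
  0<fromℕ (ℕ.suc n) = <-trans 0<1 (<-respˡ-≈ (+-identityʳ 1#) (+-monoʳ-< 1# (0<fromℕ n)))

  fromℕ-mono-< : ∀ {m n} → m ℕ.< n → fromℕ m < fromℕ n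
  fromℕ-mono-< {ℕ.zero}  {ℕ.suc n} _           = 0<fromℕ n
  fromℕ-mono-< {ℕ.suc m} {ℕ.suc n} (ℕ.s≤s m<n) = +-monoʳ-< 1# (fromℕ-mono-< m<n)

  -- Supplies the infinitely many pairwise apart points at which polynomial identities are tested.
  fromℕ-# : ∀ {m n} → m ≢ n → fromℕ m # fromℕ n
  fromℕ-# {m} {n} m≢n with ℕₚ.<-cmp m n
  ... | tri< m<n _ _ = <⇒# (fromℕ-mono-< m<n)
  ... | tri≈ _ m≡n _ = ⊥-elim (m≢n m≡n)
  ... | tri> _ _ n<m = #-sym (<⇒# (fromℕ-mono-< n<m))

  fromℕ-injective : ∀ {m n} → fromℕ m ≈ fromℕ n → m ≡ n
  fromℕ-injective {m} {n} eq with m ℕₚ.≟ n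
  ... | yes m≡n = m≡n
  ... | no  m≢n = ⊥-elim (#-irrefl eq (fromℕ-# m≢n))

  fromℕ-+ : ∀ m n → fromℕ (m ℕ.+ n) ≈ fromℕ m + fromℕ n
  fromℕ-+ ℕ.zero    n = sym (+-identityˡ _)
  fromℕ-+ (ℕ.suc m) n = trans (+-congˡ (fromℕ-+ m n)) (sym (+-assoc _ _ _))

-- Polynomial functions and the linear coefficient of a determinant.

module PolynomialFunctions {c ℓ₁ ℓ₂ ℓ₃} (K : OrderedField c ℓ₁ ℓ₂ ℓ₃) where
  open OrderedField K hiding (zero)
  open OrderedFieldProperties K
  open MatrixOps commutativeRing
  open Determinant commutativeRing
  open SumProperties semiring using (sum; sum-cong-≋; *-distribˡ-sum)
  open ExpProperties semiring using (_^_)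
  open IntegerCoefficients commutativeRing
  open SetoidReasoning setoid

  eval : List Carrier → Carrier → Carrier
  eval []       x = 0#
  eval (a ∷ as) x = a + x * eval as x

  -- The coefficient list is a mere witness and may end in zeros; identities are always stated
  -- between functions, which avoids degrees and normal forms.
  IsPoly : (Carrier → Carrier) → Set (c ⊔ ℓ₁)
  IsPoly f = Σ[ as ∈ List Carrier ] ∀ x → f x ≈ eval as x

  poly-resp : ∀ {f g} → (∀ x → f x ≈ g x) → IsPoly g → IsPoly f
  poly-resp f≈g (as , eq) = as , λ x → trans (f≈g x) (eq x)

  poly-const : ∀ a → IsPoly (λ _ → a)
  poly-const a = a ∷ [] , λ x → solve 2 (λ a x → a := a :+ x :* con (+ 0)) refl a x

  poly-id : IsPoly (λ x → x)
  poly-id = 0# ∷ 1# ∷ [] , λ x →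
    solve 1 (λ x → x := con (+ 0) :+ x :* (con (+ 1) :+ x :* con (+ 0))) refl x

  infixl 6 _⊞_
  _⊞_ : List Carrier → List Carrier → List Carrier
  []       ⊞ bs       = bs
  (a ∷ as) ⊞ []       = a ∷ as
  (a ∷ as) ⊞ (b ∷ bs) = a + b ∷ as ⊞ bs

  eval-⊞ : ∀ as bs x → eval (as ⊞ bs) x ≈ eval as x + eval bs x
  eval-⊞ []       bs       x = sym (+-identityˡ _)
  eval-⊞ (a ∷ as) []       x = sym (+-identityʳ _)
  eval-⊞ (a ∷ as) (b ∷ bs) x = trans (+-congˡ (*-congˡ (eval-⊞ as bs x)))
    (solve 5 (λ a b x p q → a :+ b :+ x :* (p :+ q) := a :+ x :* p :+ (b :+ x :* q)) refl
      a b x (eval as x) (eval bs x))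

  eval-scale : ∀ b as x → eval (map (b *_) as) x ≈ b * eval as x
  eval-scale b []       x = solve 1 (λ b → con (+ 0) := b :* con (+ 0)) refl b
  eval-scale b (a ∷ as) x = trans (+-congˡ (*-congˡ (eval-scale b as x)))
    (solve 4 (λ a b x p → b :* a :+ x :* (b :* p) := b :* (a :+ x :* p)) refl a b x (eval as x))

  infixl 7 _⊠_
  _⊠_ : List Carrier → List Carrier → List Carrier
  []       ⊠ bs = []
  (a ∷ as) ⊠ bs = map (a *_) bs ⊞ (0# ∷ as ⊠ bs)

  eval-⊠ : ∀ as bs x → eval (as ⊠ bs) x ≈ eval as x * eval bs x
  eval-⊠ []       bs x = solve 1 (λ p → con (+ 0) := con (+ 0) :* p) refl (eval bs x)
  eval-⊠ (a ∷ as) bs x = begin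
    eval (map (a *_) bs ⊞ (0# ∷ as ⊠ bs)) x
      ≈⟨ eval-⊞ (map (a *_) bs) _ x ⟩
    eval (map (a *_) bs) x + (0# + x * eval (as ⊠ bs) x)
      ≈⟨ +-cong (eval-scale a bs x) (+-congˡ (*-congˡ (eval-⊠ as bs x))) ⟩
    a * eval bs x + (0# + x * (eval as x * eval bs x))
      ≈⟨ solve 4 (λ a x p q → a :* q :+ (con (+ 0) :+ x :* (p :* q)) := (a :+ x :* p) :* q) refl
           a x (eval as x) (eval bs x) ⟩
    eval (a ∷ as) x * eval bs x ∎

  poly-+ : ∀ {f g} → IsPoly f → IsPoly g → IsPoly (λ x → f x + g x)
  poly-+ (as , p) (bs , q) = as ⊞ bs , λ x → trans (+-cong (p x) (q x)) (sym (eval-⊞ as bs x))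

  poly-* : ∀ {f g} → IsPoly f → IsPoly g → IsPoly (λ x → f x * g x)
  poly-* (as , p) (bs , q) = as ⊠ bs , λ x → trans (*-cong (p x) (q x)) (sym (eval-⊠ as bs x))

  poly-neg : ∀ {f} → IsPoly f → IsPoly (λ x → - f x)
  poly-neg {f} p = poly-resp (λ x → solve 1 (λ y → :- y := :- con (+ 1) :* y) refl (f x))
    (poly-* (poly-const (- 1#)) p)

  poly-^ : ∀ {f} → IsPoly f → ∀ n → IsPoly (λ x → f x ^ n)
  poly-^ p ℕ.zero    = poly-const 1#
  poly-^ p (ℕ.suc n) = poly-* p (poly-^ p n)

  poly-sum : ∀ {n} (f : Fin n → Carrier → Carrier) →
    (∀ i → IsPoly (f i)) → IsPoly (λ x → sum (λ i → f i x))
  poly-sum {ℕ.zero}  f p = poly-const 0#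
  poly-sum {ℕ.suc n} f p = poly-+ (p zero) (poly-sum (λ i → f (suc i)) (λ i → p (suc i)))

  poly-det : ∀ {n} (M : Carrier → Matrix Carrier n) → (∀ i j → IsPoly (λ x → M x i j)) →
             IsPoly (λ x → det (M x))
  poly-det {ℕ.zero}  M p = poly-const 1#
  poly-det {ℕ.suc n} M p = poly-sum _ λ j →
    poly-* (poly-* (poly-const (sign j)) (p zero j))
      (poly-det (λ x i k → M x (suc i) (punchIn j k)) (λ i k → p (suc i) (punchIn j k)))

  -- Horner's scheme: the coefficients of the quotient of `a ∷ as` by x - y, the remainder being the
  -- value at `y`.
  quotient : Carrier → List Carrier → Carrier → List Carrier
  quotient a []       y = []
  quotient a (b ∷ bs) y = eval (b ∷ bs) y ∷ quotient b bs y

  length-quotient : ∀ a as y → length (quotient a as y) ≡ length as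
  length-quotient a []       y = ≡.refl
  length-quotient a (b ∷ bs) y = ≡.cong ℕ.suc (length-quotient b bs y)

  eval-quotient : ∀ a as x y → eval (a ∷ as) x ≈ eval (a ∷ as) y + (x - y) * eval
    (quotient a as y) x
  eval-quotient a [] x y =
    solve 3 (λ a x y → a :+ x :* con (+ 0) := a :+ y :* con (+ 0) :+ (x :- y) :* con (+ 0))
      refl a x y
  eval-quotient a (b ∷ bs) x y = trans (+-congˡ (*-congˡ (eval-quotient b bs x y)))
    (solve 5 (λ a x y p q → a :+ x :* (p :+ (x :- y) :* q)
      := a :+ y :* p :+ (x :- y) :* (p :+ x :* q)) refl
      a x y (eval (b ∷ bs) y) (eval (quotient b bs y) x))

  PairwiseApart : (ℕ → Carrier) → Set ℓ₂
  PairwiseApart xs = ∀ {i j} → i ≢ j → xs i # xs j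

  -- Split off the root `xs 0`. The other points are apart from it, so the linear factor cancels and
  -- the shorter quotient vanishes at all of them. The length `n` is the induction measure, because
  -- the quotient is not a sublist of `as`.
  eval-vanishes : ∀ n as → length as ≡ n → ∀ xs → PairwiseApart xs →
                  (∀ k → eval as (xs k) ≈ 0#) → ∀ x → eval as x ≈ 0#
  eval-vanishes n         []       _  xs apart roots x = refl
  eval-vanishes (ℕ.suc n) (a ∷ as) eq xs apart roots x = begin
    eval (a ∷ as) x
      ≈⟨ eval-quotient a as x (xs 0) ⟩
    eval (a ∷ as) (xs 0) + (x - xs 0) * eval q x
      ≈⟨ +-cong (roots 0) (*-congˡ (q-vanishes x)) ⟩
    0# + (x - xs 0) * 0#
      ≈⟨ solve 1 (λ x → con (+ 0) :+ x :* con (+ 0) := con (+ 0)) refl (x - xs 0) ⟩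
    0# ∎
    where
    q = quotient a as (xs 0)
    q-vanishes : ∀ x → eval q x ≈ 0#
    q-vanishes = eval-vanishes n q (≡.trans (length-quotient a as (xs 0)) (ℕₚ.suc-injective eq))
      (λ k → xs (ℕ.suc k)) (λ i≢j → apart (λ eq → i≢j (ℕₚ.suc-injective eq))) λ k →
        cancel-zero (#⇒-#0 (apart {ℕ.suc k} {0} λ ())) (begin
          (xs (ℕ.suc k) - xs 0) * eval q (xs (ℕ.suc k))
            ≈⟨ +-identityˡ _ ⟨
          0# + (xs (ℕ.suc k) - xs 0) * eval q (xs (ℕ.suc k))
            ≈⟨ +-congʳ (roots 0) ⟨
          eval (a ∷ as) (xs 0) + (xs (ℕ.suc k) - xs 0) * eval q (xs (ℕ.suc k))
            ≈⟨ eval-quotient a as (xs (ℕ.suc k)) (xs 0) ⟨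
          eval (a ∷ as) (xs (ℕ.suc k))
            ≈⟨ roots (ℕ.suc k) ⟩
          0# ∎)

  poly-unique : ∀ {f g} → IsPoly f → IsPoly g → ∀ xs → PairwiseApart xs →
                (∀ k → f (xs k) ≈ g (xs k)) → ∀ x → f x ≈ g x
  poly-unique f-poly g-poly xs apart agree x with poly-+ f-poly (poly-neg g-poly)
  ... | as , eq = x-y≈0⇒x≈y (trans (eq x) (eval-vanishes _ as ≡.refl xs apart
    (λ k → trans (sym (eq (xs k))) (x≈y⇒x-y≈0 (agree k))) x))

  -- Allows an identity to be verified away from one pole `a`, by testing at a + 1, a + 2 and so on.
  poly-unique-off : ∀ {f g} → IsPoly f → IsPoly g → ∀ a →
                    (∀ x → x # a → f x ≈ g x) → ∀ x → f x ≈ g x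
  poly-unique-off f-poly g-poly a agree = poly-unique f-poly g-poly (λ k → a + fromℕ (ℕ.suc k))
    (λ {i} {j} i≢j → -#0⇒# (#-congʳ (solve 3 (λ a x y → x :- y := a :+ x :- (a :+ y)) refl a _ _)
      (#⇒-#0 (fromℕ-# {ℕ.suc i} {ℕ.suc j} λ eq → i≢j (ℕₚ.suc-injective eq)))))
    λ k → agree _ (-#0⇒# (#-congʳ (solve 2 (λ a x → x := a :+ x :- a) refl a _)
      (fromℕ-# {ℕ.suc k} {0} λ ())))

  Multiple : (p f : Carrier → Carrier) → Set (c ⊔ ℓ₁)
  Multiple p f = Σ[ g ∈ (Carrier → Carrier) ] IsPoly g × (∀ w → f w ≈ p w * g w)

  multiple-sum : ∀ {n p} (f : Fin n → Carrier → Carrier) → (∀ i → Multiple p (f i)) →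
                 Multiple p (λ w → sum (λ i → f i w))
  multiple-sum {p = p} f mult =
    (λ w → sum (λ i → proj₁ (mult i) w)) , poly-sum _ (λ i → proj₁ (proj₂ (mult i))) ,
    λ w → trans (sum-cong-≋ λ i → proj₂ (proj₂ (mult i)) w)
      (sym (*-distribˡ-sum (p w) (λ i → proj₁ (mult i) w)))

  -- A term of the expansion along the first row either contains the first entry of that row, or a
  -- minor that retains the first column and is divisible by induction.
  det-multiple : ∀ {n} (M : Carrier → Matrix Carrier (ℕ.suc n)) → (∀ i j → IsPoly (λ w → M w i j)) →
                 (∀ i → Multiple (λ w → w) (λ w → M w i zero)) →
                   Multiple (λ w → w) (λ w → det (M w))
  det-multiple {n} M p column = multiple-sum _ (term n M p column)
    where
    term : ∀ n (M : Carrier → Matrix Carrier (ℕ.suc n)) → (∀ i j → IsPoly (λ w → M w i j)) →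
           (∀ i → Multiple (λ w → w) (λ w → M w i zero)) →
           ∀ j → Multiple (λ w → w) (λ w →
             sign j * M w zero j * det (λ i k → M w (suc i) (punchIn j k)))
    term n M p column zero with column zero
    ... | h , h-poly , eq = (λ w → h w * minor w)
      , poly-* h-poly (poly-det _ λ i k → p (suc i) (suc k))
      , λ w → trans (*-congʳ (*-congˡ (eq w)))
          (solve 3 (λ w h d → con (+ 1) :* (w :* h) :* d := w :* (h :* d)) refl w (h w) (minor w))
      where
      minor : Carrier → Carrier
      minor w = det (λ i k → M w (suc i) (suc k))
    term (ℕ.suc n) M p column (suc j)
      with det-multiple (λ w i k → M w (suc i) (punchIn (suc j) k))
             (λ i k → p (suc i) (punchIn (suc j) k)) (λ i → column (suc i))
    ... | h , h-poly , eq = (λ w → sign (suc j) * M w zero (suc j) * h w)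
      , poly-* (poly-* (poly-const _) (p zero (suc j))) h-poly
      , λ w → trans (*-congˡ (eq w))
          (solve 3 (λ w h d → d :* (w :* h) := w :* (d :* h)) refl w (h w)
            (sign (suc j) * M w zero (suc j)))

  trace : ∀ {n} → Matrix Carrier n → Carrier
  trace M = sum (λ i → M i i)

  -- `s` is the derivative at 0 of a polynomial with value 1 there; the polynomial remainder takes
  -- the place of differentiation.
  HasSlope : (Carrier → Carrier) → Carrier → Set (c ⊔ ℓ₁)
  HasSlope f s = Σ[ g ∈ (Carrier → Carrier) ] IsPoly g × (∀ w → f w ≈ 1# + w * (s + w * g w))

  -- A factor `w` can be cancelled only when `w` is apart from 0. The slopes are values at 0, which
  -- are regained because the cancelled sides are polynomials.
  slope-unique : ∀ {f g s t} → HasSlope f s → HasSlope g t → (∀ w → f w ≈ g w) → s ≈ t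
  slope-unique {f} {g} {s} {t} (f′ , f-poly , f-eq) (g′ , g-poly , g-eq) f≈g = begin
    s             ≈⟨ solve 2 (λ s x → s := s :+ con (+ 0) :* x) refl s (f′ 0#) ⟩
    s + 0# * f′ 0# ≈⟨ poly-unique-off
                       (poly-+ (poly-const s) (poly-* poly-id f-poly))
                       (poly-+ (poly-const t) (poly-* poly-id g-poly)) 0#
                       (λ w w#0 → cancelˡ w#0 (agree w)) 0# ⟩
    t + 0# * g′ 0# ≈⟨ solve 2 (λ s x → s :+ con (+ 0) :* x := s) refl t (g′ 0#) ⟩
    t             ∎
    where
    agree : ∀ w → w * (s + w * f′ w) ≈ w * (t + w * g′ w)
    agree w = begin
      w * (s + w * f′ w)           ≈⟨ solve 1 (λ x → x := con (+ 1) :+ x :- con (+ 1)) refl _ ⟩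
      1# + w * (s + w * f′ w) - 1# ≈⟨ +-congʳ (trans (sym (f-eq w)) (trans (f≈g w) (g-eq w))) ⟩
      1# + w * (t + w * g′ w) - 1# ≈⟨ solve 1 (λ x → con (+ 1) :+ x :- con (+ 1) := x) refl _ ⟩
      w * (t + w * g′ w)           ∎

  slope-resp : ∀ {f g s} → (∀ w → f w ≈ g w) → HasSlope g s → HasSlope f s
  slope-resp f≈g (g′ , g-poly , eq) = g′ , g-poly , λ w → trans (f≈g w) (eq w)

  slope-linear-* : ∀ a {f s} → HasSlope f s → HasSlope (λ w → (1# + w * a) * f w) (a + s)
  slope-linear-* a {f} {s} (g , g-poly , eq) =
      (λ w → a * s + (1# + w * a) * g w)
    , poly-+ (poly-const _) (poly-* (poly-+ (poly-const 1#) (poly-* poly-id (poly-const a))) g-poly)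
    , λ w → trans (*-congˡ (eq w))
        (solve 4 (λ w a s g → (con (+ 1) :+ w :* a) :* (con (+ 1) :+ w :* (s :+ w :* g))
           := con (+ 1) :+ w :* (a :+ s :+ w :* (a :* s :+ (con (+ 1) :+ w :* a) :* g))) refl w a s
             (g w))

  entry-poly : ∀ {n} (M : Matrix Carrier n) i j → IsPoly (λ w → 𝟙 i j + w * M i j)
  entry-poly M i j = poly-+ (poly-const _) (poly-* poly-id (poly-const _))

  -- Off the diagonal of the first row, both the entry and its minor are
  -- multiples of w.
  off-diagonal : ∀ n (M : Matrix Carrier (ℕ.suc n)) (j : Fin n) →
    Multiple (λ w → w * w) (λ w → sign (suc j) * (0# + w * M zero (suc j)) *
      det (λ i k → 𝟙 (suc i) (punchIn (suc j) k) + w * M (suc i) (punchIn (suc j) k)))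
  off-diagonal (ℕ.suc n) M j = times-entry
    (det-multiple N (λ i k → entry-poly M (suc i) (punchIn (suc j) k))
      (λ i → (λ _ → M (suc i) zero) , poly-const _ , λ w → +-identityˡ _))
    where
    N : Carrier → Matrix Carrier (ℕ.suc n)
    N w i k = 𝟙 (suc i) (punchIn (suc j) k) + w * M (suc i) (punchIn (suc j) k)
    times-entry : Multiple (λ w → w) (λ w → det (N w)) →
      Multiple (λ w → w * w) (λ w → sign (suc j) * (0# + w * M zero (suc j)) * det (N w))
    times-entry (h , h-poly , eq) = (λ w → sign (suc j) * M zero (suc j) * h w)
      , poly-* (poly-const _) h-poly
      , λ w → trans (*-congˡ (eq w))
          (solve 4 (λ s w m h → s :* (con (+ 0) :+ w :* m) :* (w :* h) := w :* w :* (s :* m :* h))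
            refl
            (sign (suc j)) w (M zero (suc j)) (h w))

  -- In the expansion along the first row the diagonal term adds the first diagonal entry to the
  -- trace of the minor, and all other terms are divisible by w².
  det-slope : ∀ {n} (M : Matrix Carrier n) →
    HasSlope (λ w → det (λ i j → 𝟙 i j + w * M i j)) (trace M)
  det-slope {ℕ.zero} M = (λ _ → 0#) , poly-const 0# , λ w →
    solve 1 (λ w → con (+ 1) := con (+ 1) :+ w :* (con (+ 0) :+ w :* con (+ 0))) refl w
  det-slope {ℕ.suc n} M = add-multiple
    (slope-linear-* (M zero zero) (det-slope (λ i k → M (suc i) (suc k))))
    (multiple-sum _ (off-diagonal n M))
    where
    s = trace M
    minor : Carrier → Matrix Carrier n
    minor w i k = 𝟙 (suc i) (suc k) + w * M (suc i) (suc k)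
    minor′ : Carrier → Matrix Carrier n
    minor′ w i k = 𝟙 i k + w * M (suc i) (suc k)
    add-multiple : ∀ {r} → HasSlope (λ w → (1# + w * M zero zero) * det (minor′ w)) s →
                   Multiple (λ w → w * w) r →
                   HasSlope (λ w → 1# * (1# + w * M zero zero) * det (minor w) + r w) s
    add-multiple {r} (g , g-poly , g-eq) (h , h-poly , h-eq) =
      (λ w → g w + h w) , poly-+ g-poly h-poly , λ w → begin
        1# * (1# + w * M zero zero) * det (minor w) + r w
          ≈⟨ +-cong (trans (*-congʳ (*-identityˡ _))
               (trans (*-congˡ (det-cong {M = minor w} {minor′ w} λ i k → +-congʳ (𝟙-suc i k)))
                 (g-eq w))) (h-eq w) ⟩
        1# + w * (s + w * g w) + w * w * h w
          ≈⟨ solve 4 (λ w s g h → con (+ 1) :+ w :* (s :+ w :* g) :+ w :* w :* h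
               := con (+ 1) :+ w :* (s :+ w :* (g :+ h))) refl w s (g w) (h w) ⟩
        1# + w * (s + w * (g w + h w)) ∎

-- Traces and quadratic polynomials of a matrix with split characteristic polynomial.

module Spectrum {c ℓ₁ ℓ₂ ℓ₃} (K : OrderedField c ℓ₁ ℓ₂ ℓ₃) where
  open OrderedField K hiding (zero)
  open OrderedFieldProperties K
  open MatrixOps commutativeRing
  open Determinant commutativeRing
  open PolynomialFunctions K
  open SumProperties semiring using (sum; sum-cong-≋; *-distribˡ-sum)
  open ExpProperties semiring using (_^_)
  open IntegerCoefficients commutativeRing
  open SetoidReasoning setoid

  total product : (Carrier → Carrier) → List Carrier → Carrier
  total   f = foldr (λ θ s → f θ + s) 0#
  product f = foldr (λ θ p → f θ * p) 1#

  total-map : ∀ f g θs → total f (map g θs) ≈ total (f ∘ g) θs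
  total-map f g []       = refl
  total-map f g (θ ∷ θs) = +-congˡ (total-map f g θs)

  product-map : ∀ f g θs → product f (map g θs) ≈ product (f ∘ g) θs
  product-map f g []       = refl
  product-map f g (θ ∷ θs) = *-congˡ (product-map f g θs)

  product-cong : ∀ {f g} → (∀ θ → f θ ≈ g θ) → ∀ θs → product f θs ≈ product g θs
  product-cong f≈g []       = refl
  product-cong f≈g (θ ∷ θs) = *-cong (f≈g θ) (product-cong f≈g θs)

  product-* : ∀ f g θs → product f θs * product g θs ≈ product (λ θ → f θ * g θ) θs
  product-* f g []       = *-identityˡ 1#
  product-* f g (θ ∷ θs) = trans
    (solve 4 (λ a b p q → a :* p :* (b :* q) := a :* b :* (p :* q)) refl
      (f θ) (g θ) (product f θs) (product g θs))
    (*-congˡ (product-* f g θs))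

  product-scale : ∀ a f θs → product (λ θ → a * f θ) θs ≈ a ^ length θs * product f θs
  product-scale a f []       = sym (*-identityˡ 1#)
  product-scale a f (θ ∷ θs) = trans (*-congˡ (product-scale a f θs))
    (solve 4 (λ a x p q → a :* x :* (p :* q) := a :* p :* (x :* q)) refl
      a (f θ) (a ^ length θs) (product f θs))

  product-one : ∀ {f} → (∀ θ → f θ ≈ 1#) → ∀ θs → product f θs ≈ 1#
  product-one f≈1 []       = refl
  product-one f≈1 (θ ∷ θs) = trans (*-cong (f≈1 θ) (product-one f≈1 θs)) (*-identityˡ 1#)

  product-replicate-++ : ∀ f m θ θs → product f (replicate m θ ++ θs) ≈ f θ ^ m * product f θs
  product-replicate-++ f ℕ.zero    θ θs = sym (*-identityˡ _)
  product-replicate-++ f (ℕ.suc m) θ θs =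
    trans (*-congˡ (product-replicate-++ f m θ θs)) (sym (*-assoc _ _ _))

  total-replicate-++ : ∀ f m θ θs → total f (replicate m θ ++ θs) ≈ fromℕ m * f θ + total f θs
  total-replicate-++ f ℕ.zero    θ θs = solve 2 (λ x s → s := con (+ 0) :* x :+ s) refl (f θ)
    (total f θs)
  total-replicate-++ f (ℕ.suc m) θ θs = trans (+-congˡ (total-replicate-++ f m θ θs))
    (solve 3 (λ x k s → x :+ (k :* x :+ s) := (con (+ 1) :+ k) :* x :+ s) refl (f θ) (fromℕ m)
      (total f θs))

  poly-product : ∀ {f : Carrier → Carrier → Carrier} → (∀ θ → IsPoly (λ w → f w θ)) →
                 ∀ θs → IsPoly (λ w → product (f w) θs)
  poly-product p []       = poly-const 1#
  poly-product p (θ ∷ θs) = poly-* (p θ) (poly-product p θs)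

  record HasSpectrum {n} (M : Matrix Carrier n) (θs : List Carrier) : Set (c ⊔ ℓ₁) where
    constructor hasSpectrum
    field
      charPoly-splits : ∀ x → charPoly M x ≈ product (λ θ → x - θ) θs

  open HasSpectrum

  -- The homogenised characteristic matrix. Taking `u` = 1 gives I - w M, from which traces are
  -- read, and `w` = -1 gives u I + M.
  pencil : ∀ {n} → Carrier → Carrier → Matrix Carrier n → Matrix Carrier n
  pencil u w M i j = u * 𝟙 i j - w * M i j

  poly-pencil : ∀ {n} u (M : Matrix Carrier n) → IsPoly (λ w → det (pencil u w M))
  poly-pencil u M = poly-det (λ w → pencil u w M) λ i j →
    poly-+ (poly-const _) (poly-neg (poly-* poly-id (poly-const _)))

  poly-pencil-product : ∀ u θs → IsPoly (λ w → product (λ θ → u - w * θ) θs)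
  poly-pencil-product u = poly-product λ θ →
    poly-+ (poly-const u) (poly-neg (poly-* poly-id (poly-const θ)))

  pencil-zero : ∀ {n} u (M : Matrix Carrier n) → ∀ i j → pencil u 0# M i j ≈ u * 𝟙 i j
  pencil-zero u M i j = solve 3 (λ u e m → u :* e :- con (+ 0) :* m := u :* e) refl u (𝟙 i j)
    (M i j)

  -- Both sides are the charpoly of M at u / w, with denominators cleared.
  pencil-scaled : ∀ {n} {M : Matrix Carrier n} {θs} → HasSpectrum M θs → ∀ u w → w # 0# →
    w ^ length θs * det (pencil u w M) ≈ w ^ n * product (λ θ → u - w * θ) θs
  pencil-scaled {n} {M} {θs} spec u w w#0 with inverse w#0
  ... | v , wv≈1 = begin
    w ^ length θs * det (pencil u w M)
      ≈⟨ *-congˡ (det-cong λ i j → trans (+-congʳ (*-congʳ u≈)) (solve 4 (λ w x e m →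
           w :* x :* e :- w :* m := w :* (x :* e :- m)) refl w (u * v) (𝟙 i j) (M i j))) ⟩
    w ^ length θs * det (λ i j → w * (u * v * 𝟙 i j - M i j))
      ≈⟨ *-congˡ (trans (det-scale w (λ i j → u * v * 𝟙 i j - M i j))
           (*-congˡ (spec .charPoly-splits (u * v)))) ⟩
    w ^ length θs * (w ^ n * product (λ θ → u * v - θ) θs)
      ≈⟨ solve 3 (λ p q r → p :* (q :* r) := q :* (p :* r)) refl (w ^ length θs) (w ^ n) _ ⟩
    w ^ n * (w ^ length θs * product (λ θ → u * v - θ) θs)
      ≈⟨ *-congˡ (product-scale w (λ θ → u * v - θ) θs) ⟨
    w ^ n * product (λ θ → w * (u * v - θ)) θs
      ≈⟨ *-congˡ (product-cong (λ θ → trans (solve 3 (λ w x θ → w :* (x :- θ) := w :* x :- w :* θ)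
           refl w (u * v) θ)
           (+-congʳ (sym u≈))) θs) ⟩
    w ^ n * product (λ θ → u - w * θ) θs ∎
    where
    u≈ : u ≈ w * (u * v)
    u≈ = trans (trans (sym (*-identityʳ u)) (*-congˡ (sym wv≈1)))
           (solve 3 (λ u v w → u :* (w :* v) := w :* (u :* v)) refl u v w)

  -- Compares orders of vanishing at 0, where both `f` and `g` are 1. Applied to the cleared
  -- denominators of the pencil, it shows that the number of eigenvalues is the order of the matrix.
  powers-agree : ∀ m n {f g} → IsPoly f → IsPoly g → f 0# ≈ 1# → g 0# ≈ 1# →
                 (∀ w → w # 0# → w ^ m * f w ≈ w ^ n * g w) → m ≡ n
  powers-agree ℕ.zero    ℕ.zero    p q f0 g0 eq = ≡.refl
  powers-agree ℕ.zero    (ℕ.suc n) p q f0 g0 eq = ⊥-elim (one-zero (trans (sym f0) (trans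
    (sym (*-identityˡ _)) (trans
      (poly-unique-off (poly-* (poly-const 1#) p) (poly-* (poly-^ poly-id (ℕ.suc n)) q) 0# eq 0#)
      (solve 2 (λ x y → con (+ 0) :* x :* y := con (+ 0)) refl _ _)))))
  powers-agree (ℕ.suc m) ℕ.zero    p q f0 g0 eq =
    ≡.sym (powers-agree ℕ.zero (ℕ.suc m) q p g0 f0 (λ w w#0 → sym (eq w w#0)))
  powers-agree (ℕ.suc m) (ℕ.suc n) p q f0 g0 eq = ≡.cong ℕ.suc (powers-agree m n p q f0 g0
    λ w w#0 → cancelˡ w#0 (trans (sym (*-assoc _ _ _)) (trans (eq w w#0) (*-assoc _ _ _))))

  spectrum-length : ∀ {n} {M : Matrix Carrier n} {θs} → HasSpectrum M θs → length θs ≡ n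
  spectrum-length {n} {M} {θs} spec = powers-agree (length θs) n
    (poly-pencil 1# M) (poly-pencil-product 1# θs)
    (trans (det-cong λ i j → trans (pencil-zero 1# M i j) (*-identityˡ _)) (det-𝟙 {n}))
    (product-one (λ θ → solve 1 (λ θ → con (+ 1) :- con (+ 0) :* θ := con (+ 1)) refl θ) θs)
    (pencil-scaled spec 1#)

  power#0 : ∀ {x} → x # 0# → ∀ n → x ^ n # 0#
  power#0 x#0 ℕ.zero    = 1#0
  power#0 x#0 (ℕ.suc n) = x#0y#0→xy#0 x#0 (power#0 x#0 n)

  -- For `w` apart from 0 the equal powers of `w` cancel in `pencil-scaled`; the case of `w` = 0
  -- follows because both sides are polynomials in `w`.
  det-pencil : ∀ {n} {M : Matrix Carrier n} {θs} → HasSpectrum M θs →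
               ∀ u w → det (pencil u w M) ≈ product (λ θ → u - w * θ) θs
  det-pencil {n} {M} {θs} spec u = poly-unique-off (poly-pencil u M) (poly-pencil-product u θs) 0#
    λ w w#0 → cancelˡ (power#0 w#0 n) (trans
      (*-congʳ (reflexive (≡.cong (w ^_) (≡.sym (spectrum-length spec)))))
      (pencil-scaled spec u w w#0))

  total-slope : ∀ θs → HasSlope (λ w → product (λ θ → 1# - w * θ) θs) (total -_ θs)
  total-slope [] = (λ _ → 0#) , poly-const 0# , λ w →
    solve 1 (λ w → con (+ 1) := con (+ 1) :+ w :* (con (+ 0) :+ w :* con (+ 0))) refl w
  total-slope (θ ∷ θs) = slope-resp
    (λ w → *-congʳ (solve 2 (λ w θ → con (+ 1) :- w :* θ := con (+ 1) :+ w :* (:- θ)) refl w θ))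
    (slope-linear-* (- θ) (total-slope θs))

  -- Compares the coefficients of w in det (I - w M) and in the product of the 1 - w θ.
  trace-spectrum : ∀ {n} {M : Matrix Carrier n} {θs} → HasSpectrum M θs → trace M ≈ total id θs
  trace-spectrum {n} {M} {θs} spec = begin
    trace M
      ≈⟨ solve 1 (λ x → x := :- (:- con (+ 1) :* x)) refl (trace M) ⟩
    - (- 1# * trace M)
      ≈⟨ -‿cong (*-distribˡ-sum (- 1#) (λ i → M i i)) ⟩
    - trace (λ i j → - 1# * M i j)
      ≈⟨ -‿cong (slope-unique (det-slope (λ i j → - 1# * M i j)) (total-slope θs) λ w → trans
           (det-cong λ i j → solve 3 (λ e w m →
             e :+ w :* (:- con (+ 1) :* m) := con (+ 1) :* e :- w :* m) refl
             (𝟙 i j) w (M i j))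
           (det-pencil spec 1# w)) ⟩
    - total -_ θs
      ≈⟨ -total θs ⟩
    total id θs ∎
    where
    -total : ∀ θs → - total -_ θs ≈ total id θs
    -total []       = solve 0 (:- con (+ 0) := con (+ 0)) refl
    -total (θ ∷ θs) = trans (solve 2 (λ θ s → :- (:- θ :+ s) := θ :+ :- s) refl θ (total -_ θs))
                        (+-congˡ (-total θs))

  shift : ∀ {n} → Carrier → Matrix Carrier n → Matrix Carrier n
  shift x M i j = x * 𝟙 i j - M i j

  shift-⊗ : ∀ {n} x y (M N : Matrix Carrier n) i j →
            (shift x M ⊗ shift y N) i j ≈ x * (y * 𝟙 i j - N i j) + (- y * M i j + (M ⊗ N) i j)
  shift-⊗ x y M N i j = begin
    sum (λ k → (x * 𝟙 i k - M i k) * (y * 𝟙 k j - N k j))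
      ≈⟨ sum-cong-≋ (λ k → trans (*-congˡ (+-congʳ (*-congˡ (𝟙-sym k j)))) (solve 6 (λ x y e f m p →
           (x :* e :- m) :* (y :* f :- p)
             := x :* (e :* (y :* f :- p)) :+ (:- y :* (f :* m) :+ m :* p)) refl
           x y (𝟙 i k) (𝟙 j k) (M i k) (N k j))) ⟩
    sum (λ k → x * (𝟙 i k * (y * 𝟙 j k - N k j)) + (- y * (𝟙 j k * M i k) + M i k * N k j))
      ≈⟨ sum-linear x (λ k → 𝟙 i k * (y * 𝟙 j k - N k j)) _ ⟩
    x * sum (λ k → 𝟙 i k * (y * 𝟙 j k - N k j)) + sum (λ k → - y * (𝟙 j k * M i k) + M i k * N k j)
      ≈⟨ +-cong (*-congˡ (sum-𝟙 i (λ k → y * 𝟙 j k - N k j)))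
           (trans (sum-linear (- y) (λ k → 𝟙 j k * M i k) _) (+-congʳ (*-congˡ (sum-𝟙 j (M i))))) ⟩
    x * (y * 𝟙 j i - N i j) + (- y * M i j + (M ⊗ N) i j)
      ≈⟨ +-congʳ (*-congˡ (+-congʳ (*-congˡ (𝟙-sym j i)))) ⟩
    x * (y * 𝟙 i j - N i j) + (- y * M i j + (M ⊗ N) i j) ∎

  -- The sign gives the characteristic polynomial the form
  -- det (z I + (x I - M)(y I - M)).
  quadratic : ∀ {n} → Carrier → Carrier → Matrix Carrier n → Matrix Carrier n
  quadratic x y M i j = - (shift x M ⊗ shift y M) i j

  -- x I + (p I - M)(q I - M) factors as ((p - t) I - M)((q + t) I - M) when
  -- x = t (p - q) - t²; the x = d² - k², for d = (p - q) / 2 and natural k, are of this form.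
  quadratic-spectrum : ∀ {n} {M : Matrix Carrier n} {θs} → HasSpectrum M θs → ∀ p q →
                       HasSpectrum (quadratic p q M) (map (λ θ → - ((p - θ) * (q - θ))) θs)
  quadratic-spectrum {n} {M} {θs} spec p q .charPoly-splits = poly-unique
    (poly-det (λ x i j → x * 𝟙 i j - quadratic p q M i j) λ i j →
      poly-+ (poly-* poly-id (poly-const _)) (poly-const _))
    (poly-product {λ x θ → x - θ} (λ θ → poly-+ poly-id (poly-const _))
      (map (λ θ → - ((p - θ) * (q - θ))) θs))
    (λ k → d * d - fromℕ k * fromℕ k) apart
    λ k → agree k
    where
    d = (p - q) * ½
    1+1 = 1# + 1#
    2d : 1+1 * d ≈ p - q
    2d = begin
      1+1 * ((p - q) * ½)         ≈⟨ solve 2 (λ h x → (con (+ 1) :+ con (+ 1)) :* (x :* h)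
                                     := (con (+ 1) :+ con (+ 1) :- con (+ 0)) :* h :* x)
                                       refl ½ (p - q) ⟩
      (1+1 - 0#) * ½ * (p - q)    ≈⟨ *-congʳ (proj₂ (proj₂ (#⇒invertible 2#0))) ⟩
      1# * (p - q)                ≈⟨ *-identityˡ _ ⟩
      p - q                       ∎
    apart : PairwiseApart (λ k → d * d - fromℕ k * fromℕ k)
    apart {i} {j} i≢j = -#0⇒# (#-congʳ
      (solve 3 (λ d x y → (y :- x) :* (x :+ y) := d :* d :- x :* x :- (d :* d :- y :* y))
        refl d (fromℕ i) (fromℕ j))
      (x#0y#0→xy#0 (#⇒-#0 (fromℕ-# (λ j≡i → i≢j (≡.sym j≡i))))
        (#-congʳ (fromℕ-+ i j) (fromℕ-# {i ℕ.+ j} {0} λ i+j≡0 →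
          i≢j (≡.trans (ℕₚ.m+n≡0⇒m≡0 i i+j≡0) (≡.sym (ℕₚ.m+n≡0⇒n≡0 i i+j≡0)))))))
    agree : ∀ k → charPoly (quadratic p q M) (d * d - fromℕ k * fromℕ k) ≈
                  product (λ θ → d * d - fromℕ k * fromℕ k - θ)
                    (map (λ θ → - ((p - θ) * (q - θ))) θs)
    agree k = begin
      charPoly (quadratic p q M) x
        ≈⟨ det-cong (λ i j → begin
             x * 𝟙 i j - - (shift p M ⊗ shift q M) i j
               ≈⟨ trans (solve 2 (λ y z → y :- :- z := y :+ z) refl _ _)
                    (+-congˡ (shift-⊗ p q M M i j)) ⟩
             x * 𝟙 i j + (p * (q * 𝟙 i j - M i j) + (- q * M i j + (M ⊗ M) i j))
               ≈⟨ +-congʳ (*-congʳ x≈) ⟩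
             (t * (p - q) - t * t) * 𝟙 i j + (p * (q * 𝟙 i j - M i j) + (- q * M i j + (M ⊗ M) i j))
               ≈⟨ solve 6 (λ t p q e m s →
                    (t :* (p :- q) :- t :* t) :* e :+ (p :* (q :* e :- m) :+ (:- q :* m :+ s))
                    := (p :- t) :* ((q :+ t) :* e :- m) :+ (:- (q :+ t) :* m :+ s)) refl
                    t p q (𝟙 i j) (M i j) ((M ⊗ M) i j) ⟩
             (p - t) * ((q + t) * 𝟙 i j - M i j) + (- (q + t) * M i j + (M ⊗ M) i j)
               ≈⟨ shift-⊗ (p - t) (q + t) M M i j ⟨
             (shift (p - t) M ⊗ shift (q + t) M) i j ∎) ⟩
      det (shift (p - t) M ⊗ shift (q + t) M)
        ≈⟨ det-⊗ (shift (p - t) M) (shift (q + t) M) ⟩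
      charPoly M (p - t) * charPoly M (q + t)
        ≈⟨ *-cong (spec .charPoly-splits (p - t)) (spec .charPoly-splits (q + t)) ⟩
      product (λ θ → p - t - θ) θs * product (λ θ → q + t - θ) θs
        ≈⟨ product-* (λ θ → p - t - θ) (λ θ → q + t - θ) θs ⟩
      product (λ θ → (p - t - θ) * (q + t - θ)) θs
        ≈⟨ product-cong (λ θ → trans (solve 4 (λ t p q θ →
             (p :- t :- θ) :* (q :+ t :- θ)
               := (t :* (p :- q) :- t :* t) :- :- ((p :- θ) :* (q :- θ))) refl t p q θ)
             (+-congʳ (sym x≈))) θs ⟩
      product (λ θ → x - - ((p - θ) * (q - θ))) θs
        ≈⟨ product-map (λ θ → x - θ) (λ θ → - ((p - θ) * (q - θ))) θs ⟨
      product (λ θ → x - θ) (map (λ θ → - ((p - θ) * (q - θ))) θs) ∎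
      where
      x = d * d - fromℕ k * fromℕ k
      t = d + fromℕ k
      x≈ : x ≈ t * (p - q) - t * t
      x≈ = trans (solve 2 (λ d k → d :* d :- k :* k
             := (d :+ k) :* ((con (+ 1) :+ con (+ 1)) :* d) :- (d :+ k) :* (d :+ k))
               refl d (fromℕ k))
             (+-congʳ (*-congˡ 2d))

-- Sums of squares and the vanishing of minors.

module SumsOfSquares {c ℓ₁ ℓ₂ ℓ₃} (K : OrderedField c ℓ₁ ℓ₂ ℓ₃) where
  open OrderedField K hiding (zero)
  open OrderedFieldProperties K
  open MatrixOps commutativeRing
  open Determinant commutativeRing
  open Spectrum K
  open PolynomialFunctions K using (trace)
  open SumProperties semiring using (sum; sum-cong-≋; *-distribˡ-sum)
  open IntegerCoefficients commutativeRing
  open SetoidReasoning setoid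

  ¬#⇒≈ : ∀ {x y} → ¬ x # y → x ≈ y
  ¬#⇒≈ {x} {y} = proj₁ (tight x y)

  0<- : ∀ {x} → x < 0# → 0# < - x
  0<- {x} x<0 = <-respˡ-≈ (-‿inverseˡ x) (<-respʳ-≈ (+-identityʳ (- x)) (+-monoʳ-< (- x) x<0))

  -- The order is not assumed decidable, so the weak inequality is the denial of the strict one;
  -- tightness later turns such denials into equations.
  Nonnegative : Carrier → Set ℓ₃
  Nonnegative x = ¬ x < 0#

  -- If `x * x` were negative it would be apart from 0, hence so would `x`; then the sign of `x` is
  -- decided and either case makes the square positive.
  nonnegative-square : ∀ x → Nonnegative (x * x)
  nonnegative-square x xx<0 with #⇒<⊎> (product#0ˡ (<⇒# xx<0))
  ... | inj₂ 0<x = <-irrefl refl (<-trans xx<0 (*-pos 0<x 0<x))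
  ... | inj₁ x<0 = <-irrefl refl (<-trans xx<0 (<-respʳ-≈
    (solve 1 (λ x → :- x :* :- x := x :* x) refl x) (*-pos (0<- x<0) (0<- x<0))))

  positive : ∀ {x} → Nonnegative x → x # 0# → 0# < x
  positive x≥0 x#0 with #⇒<⊎> x#0
  ... | inj₁ x<0 = ⊥-elim (x≥0 x<0)
  ... | inj₂ 0<x = 0<x

  -- If the sum is negative, cotransitivity makes one summand apart from 0, hence positive. The
  -- other then lies below the sum and is negative.
  nonnegative-+ : ∀ {x y} → Nonnegative x → Nonnegative y → Nonnegative (x + y)
  nonnegative-+ {x} {y} x≥0 y≥0 x+y<0 with #-cotrans (<⇒# x+y<0) y
  ... | inj₁ x+y#y = y≥0 (<-trans
    (<-respˡ-≈ (+-identityʳ y) (<-respʳ-≈ (+-comm y x) (+-monoʳ-< y 0<x))) x+y<0)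
    where
    0<x : 0# < x
    0<x = positive x≥0 (#-congʳ (solve 2 (λ x y → x :+ y :- y := x) refl x y) (#⇒-#0 x+y#y))
  ... | inj₂ y#0 = x≥0 (<-trans
    (<-respˡ-≈ (+-identityʳ x) (+-monoʳ-< x (positive y≥0 y#0))) x+y<0)

  nonnegative-sum : ∀ {n} {f : V n} → (∀ i → Nonnegative (f i)) → Nonnegative (sum f)
  nonnegative-sum {ℕ.zero}  f≥0 = <-irrefl refl
  nonnegative-sum {ℕ.suc n} f≥0 = nonnegative-+ (f≥0 zero) (nonnegative-sum (λ i → f≥0 (suc i)))

  +-zeroˡ : ∀ {x y} → Nonnegative x → Nonnegative y → x + y ≈ 0# → x ≈ 0#
  +-zeroˡ {x} {y} x≥0 y≥0 x+y≈0 = ¬#⇒≈ λ x#0 → y≥0 (<-respˡ-≈ (+-identityʳ y)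
    (<-respʳ-≈ (trans (+-comm y x) x+y≈0) (+-monoʳ-< y (positive x≥0 x#0))))

  sum-zero⇒zero : ∀ {n} {f : V n} → (∀ i → Nonnegative (f i)) → sum f ≈ 0# → ∀ i → f i ≈ 0#
  sum-zero⇒zero f≥0 eq zero    = +-zeroˡ (f≥0 zero) (nonnegative-sum (λ i → f≥0 (suc i))) eq
  sum-zero⇒zero f≥0 eq (suc i) = sum-zero⇒zero (λ i → f≥0 (suc i))
    (+-zeroˡ (nonnegative-sum (λ i → f≥0 (suc i))) (f≥0 zero) (trans (+-comm _ _) eq)) i

  square-zero : ∀ {x} → x * x ≈ 0# → x ≈ 0#
  square-zero xx≈0 = ¬#⇒≈ λ x#0 → #-irrefl xx≈0 (x#0y#0→xy#0 x#0 x#0)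

  sum-squares₄-zero : ∀ {n} (m : Fin n → Fin n → Fin n → Fin n → Carrier) →
    sum (λ i → sum (λ j → sum (λ k → sum (λ l → m i j k l * m i j k l)))) ≈ 0# →
    ∀ i j k l → m i j k l ≈ 0#
  sum-squares₄-zero m eq i j k l = square-zero
    (sum-zero⇒zero (λ l → squares≥0 i j k l)
      (sum-zero⇒zero (λ k → nonnegative-sum (squares≥0 i j k))
        (sum-zero⇒zero (λ j → nonnegative-sum λ k → nonnegative-sum (squares≥0 i j k))
          (sum-zero⇒zero (λ i → nonnegative-sum λ j → nonnegative-sum λ k →
            nonnegative-sum (squares≥0 i j k))
            eq i) j) k) l)
    where
    squares≥0 : ∀ i j k l → Nonnegative (m i j k l * m i j k l)
    squares≥0 i j k l = nonnegative-square (m i j k l)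

  minor₂ : ∀ {n} → V n → V n → Fin n → Fin n → Carrier
  minor₂ u v k l = u k * v l - u l * v k

  dot : ∀ {n} → V n → V n → Carrier
  dot u v = sum (λ k → u k * v k)

  2# : Carrier
  2# = 1# + 1#

  -- The sum runs over ordered pairs, so the right side is twice the Gram determinant. It is left as
  -- three terms in order to be summed by `sum-linear₃`.
  lagrange-identity : ∀ {n} (u v : V n) →
    sum (λ k → sum (λ l → minor₂ u v k l * minor₂ u v k l)) ≈
    dot u u * dot v v + (dot v v * dot u u + - 2# * dot u v * dot u v)
  lagrange-identity u v = begin
    sum (λ k → sum (λ l → minor₂ u v k l * minor₂ u v k l))
      ≈⟨ sum-cong-≋ (λ k → trans
           (sum-cong-≋ λ l → solve 4 (λ a b c d → (a :* d :- b :* c) :* (a :* d :- b :* c)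
             := a :* a :* (d :* d) :+ (c :* c :* (b :* b) :+ :- (con (+ 1) :+ con (+ 1))
               :* (a :* c) :* (b :* d))) refl
             (u k) (u l) (v k) (v l))
           (sum-linear₃ (u k * u k) (v k * v k) (- 2# * (u k * v k))
             (λ l → v l * v l) (λ l → u l * u l) (λ l → u l * v l))) ⟩
    sum (λ k → u k * u k * dot v v + (v k * v k * dot u u + - 2# * (u k * v k) * dot u v))
      ≈⟨ sum-cong-≋ (λ k → solve 6 (λ p q r x y z →
           p :* x :+ (q :* y :+ :- (con (+ 1) :+ con (+ 1)) :* r :* z)
           := x :* p :+ (y :* q :+ :- (con (+ 1) :+ con (+ 1)) :* z :* r)) refl
           (u k * u k) (v k * v k) (u k * v k) (dot v v) (dot u u) (dot u v)) ⟩
    sum (λ k → dot v v * (u k * u k) + (dot u u * (v k * v k) + - 2# * dot u v * (u k * v k)))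
      ≈⟨ sum-linear₃ (dot v v) (dot u u) (- 2# * dot u v) (λ k → u k * u k) (λ k → v k * v k)
           (λ k → u k * v k) ⟩
    dot v v * dot u u + (dot u u * dot v v + - 2# * dot u v * dot u v)
      ≈⟨ +-cong (*-comm _ _) (+-congʳ (*-comm _ _)) ⟩
    dot u u * dot v v + (dot v v * dot u u + - 2# * dot u v * dot u v) ∎

  quadratic-zero : ∀ {n} (M : Matrix Carrier n) i j → quadratic 0# 0# M i j ≈ - (M ⊗ M) i j
  quadratic-zero M i j = -‿cong (sum-cong-≋ λ k →
    solve 4 (λ e f x y → (con (+ 0) :* e :- x) :* (con (+ 0) :* f :- y) := x :* y) refl
      (𝟙 i k) (𝟙 k j) (M i k) (M k j))

  -- With G = M Mᵀ = M², the squares of all 2 × 2 minors of M sum to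
  -- 2 ((tr G)² - tr G²), and tr G = κ², tr G² = κ⁴.
  minors₂-vanish : ∀ {n} {M : Matrix Carrier n} {θs κ} → (∀ i j → M i j ≈ M j i) →
    HasSpectrum M θs → (∀ f → f 0# ≈ 0# → (∀ {x y} → x ≈ y → f x ≈ f y) → total f θs ≈ f κ) →
    ∀ i j k l → M i k * M j l ≈ M i l * M j k
  minors₂-vanish {n} {M} {θs} {κ} M-sym spec total-κ i j k l =
    x-y≈0⇒x≈y (sum-squares₄-zero (λ i j → minor₂ (M i) (M j)) all-minors i j k l)
    where
    -- `quadratic 0# 0# M` is - M², with eigenvalues q θ = - θ². Using it twice gives - M⁴, and q (q
    -- κ) = - κ⁴. Since q and its iterate vanish at 0, `total-κ` evaluates both traces.
    q : Carrier → Carrier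
    q θ = - ((0# - θ) * (0# - θ))
    q-cong : ∀ {x y} → x ≈ y → q x ≈ q y
    q-cong x≈y = -‿cong (*-cong (+-congˡ (-‿cong x≈y)) (+-congˡ (-‿cong x≈y)))
    q0 : q 0# ≈ 0#
    q0 = solve 0 (:- ((con (+ 0) :- con (+ 0)) :* (con (+ 0) :- con (+ 0))) := con (+ 0)) refl
    G : Matrix Carrier n
    G i j = dot (M i) (M j)
    -M² : Matrix Carrier n
    -M² = quadratic 0# 0# M
    -M²≈-G : ∀ i j → -M² i j ≈ - G i j
    -M²≈-G i j = trans (quadratic-zero M i j)
      (-‿cong (sum-cong-≋ λ k → *-congˡ {M i k} (M-sym k j)))
    G-sym : ∀ i j → G i j ≈ G j i
    G-sym i j = sum-cong-≋ λ k → *-comm (M i k) (M j k)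
    spec₂ : HasSpectrum -M² (map q θs)
    spec₂ = quadratic-spectrum spec 0# 0#
    sum-neg : ∀ (f : V n) → sum (λ i → - f i) ≈ - sum f
    sum-neg f = trans
      (trans (sum-cong-≋ λ i → solve 1 (λ x → :- x := :- con (+ 1) :* x) refl (f i))
        (sym (*-distribˡ-sum (- 1#) f)))
      (solve 1 (λ x → :- con (+ 1) :* x := :- x) refl (sum f))
    trace-G : trace G ≈ κ * κ
    trace-G = begin
      trace G
        ≈⟨ solve 1 (λ x → x := :- :- x) refl (trace G) ⟩
      - - trace G
        ≈⟨ -‿cong (trans (sum-cong-≋ λ i → -M²≈-G i i) (sum-neg (λ i → G i i))) ⟨
      - trace -M²
        ≈⟨ -‿cong (trans (trace-spectrum spec₂) (trans (total-map id q θs) (total-κ q q0 q-cong))) ⟩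
      - q κ
        ≈⟨ solve 1 (λ x → :- :- ((con (+ 0) :- x) :* (con (+ 0) :- x)) := x :* x) refl κ ⟩
      κ * κ ∎
    trace-G² : sum (λ i → sum (λ j → G i j * G i j)) ≈ κ * κ * (κ * κ)
    trace-G² = begin
      sum (λ i → sum (λ j → G i j * G i j))
        ≈⟨ sum-cong-≋ (λ i → sum-cong-≋ λ j → begin
             G i j * G i j       ≈⟨ *-congˡ (G-sym i j) ⟩
             G i j * G j i       ≈⟨ solve 2 (λ x y → x :* y := :- x :* :- y) refl (G i j) (G j i) ⟩
             - G i j * - G j i   ≈⟨ *-cong (-M²≈-G i j) (-M²≈-G j i) ⟨
             -M² i j * -M² j i   ∎) ⟩
      trace (-M² ⊗ -M²)
        ≈⟨ trans (solve 1 (λ x → x := :- :- x) refl _)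
             (-‿cong (sym (sum-neg (λ i → (-M² ⊗ -M²) i i)))) ⟩
      - sum (λ i → - (-M² ⊗ -M²) i i)
        ≈⟨ -‿cong (sum-cong-≋ λ i → quadratic-zero -M² i i) ⟨
      - trace (quadratic 0# 0# -M²)
        ≈⟨ -‿cong (trans (trace-spectrum (quadratic-spectrum spec₂ 0# 0#))
             (trans (total-map id q (map q θs))
             (trans (total-map q q θs) (total-κ (q ∘ q) (trans (q-cong q0) q0)
               (q-cong ∘ q-cong))))) ⟩
      - q (q κ)
        ≈⟨ solve 1 (λ x → :- :- ((con (+ 0) :- :- ((con (+ 0) :- x) :* (con (+ 0) :- x))) :*
             (con (+ 0) :- :- ((con (+ 0) :- x) :* (con (+ 0) :- x)))) := x :* x :* (x :* x))
               refl κ ⟩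
      κ * κ * (κ * κ) ∎
    all-minors : sum (λ i → sum (λ j → sum (λ k → sum (λ l →
                   minor₂ (M i) (M j) k l * minor₂ (M i) (M j) k l)))) ≈ 0#
    all-minors = begin
      sum (λ i → sum (λ j → sum (λ k → sum (λ l →
        minor₂ (M i) (M j) k l * minor₂ (M i) (M j) k l))))
        ≈⟨ sum-cong-≋ (λ i → trans
             (sum-cong-≋ λ j → trans (lagrange-identity (M i) (M j))
               (solve 3 (λ x y z → x :* y :+ (y :* x :+ :- (con (+ 1) :+ con (+ 1)) :* z :* z)
                 := x :* y :+ (x :* y :+ :- (con (+ 1) :+ con (+ 1)) :* (z :* z))) refl (G i i)
                   (G j j) (G i j)))
             (sum-linear₃ (G i i) (G i i) (- 2#) (λ j → G j j) (λ j → G j j) (λ j →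
               G i j * G i j))) ⟩
      sum (λ i → G i i * trace G + (G i i * trace G + - 2# * sum (λ j → G i j * G i j)))
        ≈⟨ sum-cong-≋ (λ i → +-cong (*-comm (G i i) (trace G))
             (+-congʳ (*-comm (G i i) (trace G)))) ⟩
      sum (λ i → trace G * G i i + (trace G * G i i + - 2# * sum (λ j → G i j * G i j)))
        ≈⟨ sum-linear₃ (trace G) (trace G) (- 2#) (λ i → G i i) (λ i → G i i) (λ i →
             sum (λ j → G i j * G i j)) ⟩
      trace G * trace G + (trace G * trace G + - 2# * sum (λ i → sum (λ j → G i j * G i j)))
        ≈⟨ +-cong (*-cong trace-G trace-G) (+-cong (*-cong trace-G trace-G) (*-congˡ trace-G²)) ⟩
      κ * κ * (κ * κ) + (κ * κ * (κ * κ) + - 2# * (κ * κ * (κ * κ)))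
        ≈⟨ solve 1 (λ x → x :+ (x :+ :- (con (+ 1) :+ con (+ 1)) :* x) := con (+ 0))
             refl (κ * κ * (κ * κ)) ⟩
      0# ∎

-- Seidel matrices over the field with a simple third eigenvalue.

module SeidelOver {c ℓ₁ ℓ₂ ℓ₃} (K : OrderedField c ℓ₁ ℓ₂ ℓ₃) where
  open OrderedField K hiding (zero)
  open OrderedFieldProperties K
  open MatrixOps commutativeRing
  open Determinant commutativeRing hiding (diagonal)
  open PolynomialFunctions K
  open Spectrum K
  open SumsOfSquares K
  open SumProperties semiring using (sum; sum-cong-≋; *-distribˡ-sum; *-distribʳ-sum; ∑-comm)
  open ExpProperties semiring using (_^_)
  open IntegerCoefficients commutativeRing
  open SetoidReasoning setoid

  𝟙-diagonal : ∀ {n} (i : Fin n) → 𝟙 i i ≈ 1#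
  𝟙-diagonal i with i ≟ i
  ... | yes _   = refl
  ... | no  i≢i = ⊥-elim (i≢i ≡.refl)

  𝟙-off-diagonal : ∀ {n} {i j : Fin n} → i ≢ j → 𝟙 i j ≈ 0#
  𝟙-off-diagonal {i = i} {j} i≢j with i ≟ j
  ... | yes i≡j = ⊥-elim (i≢j i≡j)
  ... | no  _   = refl

  sum-const : ∀ n x → sum {n} (λ _ → x) ≈ fromℕ n * x
  sum-const ℕ.zero    x = solve 1 (λ x → con (+ 0) := con (+ 0) :* x) refl x
  sum-const (ℕ.suc n) x = trans (+-congˡ (sum-const n x))
    (solve 2 (λ k x → x :+ k :* x := (con (+ 1) :+ k) :* x) refl (fromℕ n) x)

  sum-1-𝟙 : ∀ {n} (i : Fin n) → sum (λ k → 1# - 𝟙 i k) ≈ fromℕ n - 1#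
  sum-1-𝟙 {n} i = begin
    sum (λ k → 1# - 𝟙 i k)
      ≈⟨ sum-cong-≋ (λ k → solve 1 (λ e →
           con (+ 1) :- e := (:- con (+ 1)) :* (e :* con (+ 1)) :+ con (+ 1)) refl (𝟙 i k)) ⟩
    sum (λ k → - 1# * (𝟙 i k * 1#) + 1#)
      ≈⟨ trans (sum-linear (- 1#) (λ k → 𝟙 i k * 1#) (λ _ → 1#))
           (+-cong (*-congˡ (sum-𝟙 i (λ _ → 1#))) (sum-const n 1#)) ⟩
    - 1# * 1# + fromℕ n * 1#
      ≈⟨ solve 1 (λ k → :- con (+ 1) :* con (+ 1) :+ k :* con (+ 1) := k :- con (+ 1))
           refl (fromℕ n) ⟩
    fromℕ n - 1# ∎

  record IsSeidelOver {n} (s : Matrix Carrier n) : Set (c ⊔ ℓ₁) where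
    field
      symmetric   : ∀ i j → s i j ≈ s j i
      diagonal    : ∀ i → s i i ≈ 0#
      offDiagonal : ∀ {i j} → i ≢ j → s i j * s i j ≈ 1#

  square-diagonal : ∀ {n} {s : Matrix Carrier n} → IsSeidelOver s → ∀ i → (s ⊗ s) i i ≈ fromℕ n - 1#
  square-diagonal {n} {s} seidel i = trans (sum-cong-≋ term) (sum-1-𝟙 i)
    where
    open IsSeidelOver seidel
    term : ∀ k → s i k * s k i ≈ 1# - 𝟙 i k
    term k with i ≟ k
    ... | yes ≡.refl = trans (trans (*-congʳ (diagonal i))
      (solve 1 (λ x → con (+ 0) :* x := con (+ 0)) refl (s i i))) (sym (-‿inverseʳ 1#))
    ... | no  i≢k    = trans (trans (*-congˡ (symmetric k i)) (offDiagonal i≢k))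
      (solve 0 (con (+ 1) := con (+ 1) :- con (+ 0)) refl)

  quadratic-entry : ∀ {n} x y (M : Matrix Carrier n) i j →
                    quadratic x y M i j ≈ (x + y) * M i j - x * y * 𝟙 i j - (M ⊗ M) i j
  quadratic-entry x y M i j = trans (-‿cong (shift-⊗ x y M M i j))
    (solve 5 (λ x y e m p → :- (x :* (y :* e :- m) :+ (:- y :* m :+ p))
      := (x :+ y) :* m :- x :* y :* e :- p) refl
      x y (𝟙 i j) (M i j) ((M ⊗ M) i j))

  -- The sign is chosen by cotransitivity: `y` and `- y` are apart, so `x` is apart from one of
  -- them, and the other factor of (x - y)(x + y) must vanish.
  plus-or-minus : ∀ {x y} → y # 0# → x * x ≈ y * y → x ≈ y ⊎ x ≈ - y
  plus-or-minus {x} {y} y#0 xx≈yy = [ is-minus , is-plus ]′ (#-cotrans y#-y x)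
    where
    y#-y : y # - y
    y#-y = -#0⇒# (#-congʳ (solve 1 (λ y → (con (+ 1) :+ con (+ 1)) :* y := y :- :- y) refl y)
             (x#0y#0→xy#0 2#0 y#0))
    factored : (x - y) * (x - - y) ≈ 0#
    factored = trans (solve 2 (λ x y → (x :- y) :* (x :- :- y) := x :* x :- y :* y) refl x y)
      (x≈y⇒x-y≈0 xx≈yy)
    is-minus : y # x → x ≈ y ⊎ x ≈ - y
    is-minus y#x = inj₂ (x-y≈0⇒x≈y (cancel-zero (#⇒-#0 (#-sym y#x)) factored))
    is-plus : x # - y → x ≈ y ⊎ x ≈ - y
    is-plus x#-y = inj₁ (x-y≈0⇒x≈y (cancel-zero (#⇒-#0 x#-y) (trans (*-comm _ _) factored)))

  module ThreeEigenvalues (lam mu nu : Carrier) (a b : ℕ) (lam#nu : lam # nu)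
    (mu#nu : mu # nu) where

    three : Carrier → Carrier → Carrier → List Carrier
    three x y z = replicate a x ++ replicate b y ++ z ∷ []

    product-three : ∀ f x y z → product f (three x y z) ≈ f x ^ a * (f y ^ b * (f z * 1#))
    product-three f x y z = trans (product-replicate-++ f a x _)
      (*-congˡ (product-replicate-++ f b y _))

    total-three : ∀ f x y z → total f (three x y z) ≈ fromℕ a * f x + (fromℕ b * f y + (f z + 0#))
    total-three f x y z = trans (total-replicate-++ f a x _) (+-congˡ (total-replicate-++ f b y _))

    θs : List Carrier
    θs = three lam mu nu

    length-three : ∀ x y z → length (three x y z) ≡ a ℕ.+ (b ℕ.+ 1)
    length-three x y z = ≡.trans (Listₚ.length-++ (replicate a x))
      (≡.cong₂ ℕ._+_ (Listₚ.length-replicate a)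
      (≡.trans (Listₚ.length-++ (replicate b y)) (≡.cong (ℕ._+ 1) (Listₚ.length-replicate b))))

    q : Carrier → Carrier
    q θ = - ((lam - θ) * (mu - θ))

    -- `Q` below is the negative of the matrix E of the overview, so this is the negative of the κ
    -- given there.
    κ : Carrier
    κ = q nu

    κ#0 : κ # 0#
    κ#0 = #-congʳ (solve 2 (λ x y → :- con (+ 1) :* (x :* y) := :- (x :* y)) refl _ _)
      (x#0y#0→xy#0 (inverse⇒#0 {y = - 1#}
        (solve 0 (:- con (+ 1) :* :- con (+ 1) := con (+ 1)) refl))
        (x#0y#0→xy#0 (#⇒-#0 lam#nu) (#⇒-#0 mu#nu)))

    q-lam : q lam ≈ 0#
    q-lam = solve 2 (λ x y → :- ((x :- x) :* (y :- x)) := con (+ 0)) refl lam mu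

    q-mu : q mu ≈ 0#
    q-mu = solve 2 (λ x y → :- ((x :- y) :* (y :- y)) := con (+ 0)) refl lam mu

    -- Expresses that all eigenvalues of `Q` but one vanish. It is stated for general `f` because
    -- the traces of `Q` and of its second and fourth powers are all wanted.
    total-q : ∀ f → f 0# ≈ 0# → (∀ {x y} → x ≈ y → f x ≈ f y) → total f (map q θs) ≈ f κ
    total-q f f0 f-cong = begin
      total f (map q θs)
        ≈⟨ trans (total-map f q θs) (total-three (f ∘ q) lam mu nu) ⟩
      fromℕ a * f (q lam) + (fromℕ b * f (q mu) + (f κ + 0#))
        ≈⟨ +-cong (*-congˡ (trans (f-cong q-lam) f0)) (+-congʳ (*-congˡ (trans (f-cong q-mu) f0))) ⟩
      fromℕ a * 0# + (fromℕ b * 0# + (f κ + 0#))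
        ≈⟨ solve 3 (λ a b x → a :* con (+ 0) :+ (b :* con (+ 0) :+ (x :+ con (+ 0))) := x) refl
             (fromℕ a) (fromℕ b) (f κ) ⟩
      f κ ∎

    module _ {n} {s : Matrix Carrier n} (seidel : IsSeidelOver s) (spec : HasSpectrum s θs) where
      open IsSeidelOver seidel

      Q : Matrix Carrier n
      Q = quadratic lam mu s

      -- The diagonal entry of `Q`: the diagonal of `s` is 0, and that of its square is n - 1
      -- because each row has n - 1 entries of square 1.
      δ : Carrier
      δ = - (lam * mu) - (fromℕ n - 1#)

      Q-spectrum : HasSpectrum Q (map q θs)
      Q-spectrum = quadratic-spectrum spec lam mu

      square-symmetric : ∀ i j → (s ⊗ s) i j ≈ (s ⊗ s) j i
      square-symmetric i j = sum-cong-≋ λ k →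
        trans (*-cong (symmetric i k) (symmetric k j)) (*-comm (s k i) (s j k))

      Q-symmetric : ∀ i j → Q i j ≈ Q j i
      Q-symmetric i j = trans (quadratic-entry lam mu s i j) (trans
        (+-cong (+-cong (*-congˡ (symmetric i j)) (-‿cong (*-congˡ (𝟙-sym i j))))
          (-‿cong (square-symmetric i j)))
        (sym (quadratic-entry lam mu s j i)))

      Q-diagonal : ∀ i → Q i i ≈ δ
      Q-diagonal i = begin
        Q i i
          ≈⟨ quadratic-entry lam mu s i i ⟩
        (lam + mu) * s i i - lam * mu * 𝟙 i i - (s ⊗ s) i i
          ≈⟨ +-cong (+-cong (*-congˡ (diagonal i)) (-‿cong (*-congˡ (𝟙-diagonal i))))
               (-‿cong (square-diagonal seidel i)) ⟩
        (lam + mu) * 0# - lam * mu * 1# - (fromℕ n - 1#)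
          ≈⟨ solve 3 (λ x y z → (x :+ y) :* con (+ 0) :- x :* y :* con (+ 1) :- z
               := :- (x :* y) :- z) refl
               lam mu (fromℕ n - 1#) ⟩
        δ ∎

      nδ≈κ : fromℕ n * δ ≈ κ
      nδ≈κ = begin
        fromℕ n * δ         ≈⟨ sum-const n δ ⟨
        sum {n} (λ _ → δ)   ≈⟨ sum-cong-≋ Q-diagonal ⟨
        trace Q             ≈⟨ trace-spectrum Q-spectrum ⟩
        total id (map q θs) ≈⟨ total-q id refl id ⟩
        κ                   ∎

      δ#0 : δ # 0#
      δ#0 = product#0ʳ (#-congʳ (sym nδ≈κ) κ#0)

      Q-minors : ∀ i j k l → Q i k * Q j l ≈ Q i l * Q j k
      Q-minors = minors₂-vanish Q-symmetric Q-spectrum total-q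

      -- The principal minor on `i` and `j` vanishes, so the square of the entry is the square of δ.
      Q-sign : ∀ i j → Q i j ≈ δ ⊎ Q i j ≈ - δ
      Q-sign i j = plus-or-minus δ#0 (begin
        Q i j * Q i j ≈⟨ *-congˡ (Q-symmetric i j) ⟩
        Q i j * Q j i ≈⟨ Q-minors i j i j ⟨
        Q i i * Q j j ≈⟨ *-cong (Q-diagonal i) (Q-diagonal j) ⟩
        δ * δ         ∎)

      -- Uses the vanishing minor on rows `i` , `o` and columns `j` , `o`, with the diagonal entry
      -- at `o` as pivot.
      Q-rank-one : ∀ (o : Fin n) (σ : Fin n → Carrier) → (∀ i → Q o i ≈ σ i * δ) →
                   ∀ i j → Q i j ≈ σ i * σ j * δ
      Q-rank-one o σ Qo i j = cancelˡ δ#0 (begin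
        δ * Q i j                 ≈⟨ trans (*-comm _ _) (*-congˡ (sym (Q-diagonal o))) ⟩
        Q i j * Q o o             ≈⟨ Q-minors i o j o ⟩
        Q i o * Q o j             ≈⟨ *-cong (trans (Q-symmetric i o) (Qo i)) (Qo j) ⟩
        σ i * δ * (σ j * δ)       ≈⟨ solve 3 (λ x y d → x :* d :* (y :* d) := d :* (x :* y :* d))
          refl (σ i) (σ j) δ ⟩
        δ * (σ i * σ j * δ)       ∎)

      -- The situation after switching.
      module Normalised (Q≈δ : ∀ i j → Q i j ≈ δ) where

        square-entry : ∀ i j → (s ⊗ s) i j ≈ - (lam * mu) * 𝟙 i j + ((lam + mu) * s i j - δ)
        square-entry i j = begin
          (s ⊗ s) i j
            ≈⟨ solve 4 (λ x y e p → p := :- y :* e :+ (x :- (x :- y :* e :- p))) refl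
                 ((lam + mu) * s i j) (lam * mu) (𝟙 i j) ((s ⊗ s) i j) ⟩
          - (lam * mu) * 𝟙 i j + ((lam + mu) * s i j -
            ((lam + mu) * s i j - lam * mu * 𝟙 i j - (s ⊗ s) i j))
            ≈⟨ +-congˡ (+-congˡ (-‿cong (trans (sym (quadratic-entry lam mu s i j)) (Q≈δ i j)))) ⟩
          - (lam * mu) * 𝟙 i j + ((lam + mu) * s i j - δ) ∎

        -- `Q` is a polynomial in `s`. Both products are brought to the same three-term combination,
        -- the cubic terms agreeing by associativity.
        s-commutes : ∀ i j → (s ⊗ Q) i j ≈ (Q ⊗ s) i j
        s-commutes i j = begin
          sum (λ k → s i k * Q k j)
            ≈⟨ sum-cong-≋ (λ k → trans (*-congˡ (quadratic-entry lam mu s k j))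
                 (solve 5 (λ x y m e p →
                   m :* (x :- y :* e :- p)
                   := :- y :* (m :* e) :+ (con (+ 1) :* (m :* x) :+ :- con (+ 1) :* (m :* p))) refl
                   ((lam + mu) * s k j) (lam * mu) (s i k) (𝟙 k j) ((s ⊗ s) k j))) ⟩
          sum (λ k → - (lam * mu) * (s i k * 𝟙 k j)
            + (1# * (s i k * ((lam + mu) * s k j)) + - 1# * (s i k * (s ⊗ s) k j)))
            ≈⟨ sum-linear₃ (- (lam * mu)) 1# (- 1#) (λ k → s i k * 𝟙 k j) (λ k →
                 s i k * ((lam + mu) * s k j))
                 (λ k → s i k * (s ⊗ s) k j) ⟩
          - (lam * mu) * sum (λ k → s i k * 𝟙 k j)
            + (1# * sum (λ k → s i k * ((lam + mu) * s k j)) + - 1# * (s ⊗ (s ⊗ s)) i j)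
            ≈⟨ +-cong (*-congˡ (trans (sum-𝟙ʳ j (s i)) (sym (sum-𝟙 i (λ k → s k j))))) (+-cong
                 (*-congˡ (sum-cong-≋ λ k →
                   solve 3 (λ x y z → x :* (y :* z) := y :* x :* z) refl (s i k) (lam + mu)
                   (s k j)))
                 (*-congˡ (sym (⊗-assoc s s s i j)))) ⟩
          - (lam * mu) * sum (λ k → 𝟙 i k * s k j) + (1# * sum (λ k →
            (lam + mu) * s i k * s k j) + - 1# * ((s ⊗ s) ⊗ s) i j)
            ≈⟨ sum-linear₃ (- (lam * mu)) 1# (- 1#) (λ k → 𝟙 i k * s k j) (λ k →
                 (lam + mu) * s i k * s k j)
                 (λ k → (s ⊗ s) i k * s k j) ⟨
          sum (λ k → - (lam * mu) * (𝟙 i k * s k j)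
            + (1# * ((lam + mu) * s i k * s k j) + - 1# * ((s ⊗ s) i k * s k j)))
            ≈⟨ sum-cong-≋ (λ k → trans (*-congʳ (quadratic-entry lam mu s i k))
                 (solve 5 (λ x y m e p →
                   (x :- y :* e :- p) :* m
                   := :- y :* (e :* m) :+ (con (+ 1) :* (x :* m) :+ :- con (+ 1) :* (p :* m))) refl
                   ((lam + mu) * s i k) (lam * mu) (s k j) (𝟙 i k) ((s ⊗ s) i k))) ⟨
          sum (λ k → Q i k * s k j) ∎

        rowSum : Fin n → Carrier
        rowSum i = sum (s i)

        -- As `Q` is δ J, the entry at `i` , `j` of s Q is δ times row sum `i`, whereas that of Q s
        -- is δ times column sum `j`; by symmetry the latter is a row sum.
        rowSum-constant : ∀ i j → rowSum i ≈ rowSum j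
        rowSum-constant i j = cancelˡ δ#0 (begin
          δ * rowSum i               ≈⟨ *-distribˡ-sum δ (s i) ⟩
          sum (λ k → δ * s i k)      ≈⟨ sum-cong-≋ (λ k →
            trans (*-comm δ (s i k)) (*-congˡ (sym (Q≈δ k j)))) ⟩
          (s ⊗ Q) i j                ≈⟨ s-commutes i j ⟩
          (Q ⊗ s) i j                ≈⟨ sum-cong-≋ (λ k → *-cong (Q≈δ i k) (symmetric k j)) ⟩
          sum (λ k → δ * s j k)      ≈⟨ *-distribˡ-sum δ (s j) ⟨
          δ * rowSum j               ∎)

        sum-square : ∀ i → sum ((s ⊗ s) i) ≈ rowSum i * rowSum i
        sum-square i = begin
          sum (λ j → sum (λ k → s i k * s k j))
            ≈⟨ ∑-comm (λ j k → s i k * s k j) ⟩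
          sum (λ k → sum (λ j → s i k * s k j))
            ≈⟨ sum-cong-≋ (λ k → trans (sym (*-distribˡ-sum (s i k) (s k)))
                 (*-congˡ (rowSum-constant k i))) ⟩
          sum (λ k → s i k * rowSum i)
            ≈⟨ *-distribʳ-sum (rowSum i) (s i) ⟨
          rowSum i * rowSum i ∎

        -- The sum of row `i` of `Q` is n δ on one side; on the other the all-ones vector is an
        -- eigenvector of `s`, and the quadratic is evaluated at its eigenvalue.
        rowSum-quadratic : ∀ i → - ((rowSum i - lam) * (rowSum i - mu)) ≈ κ
        rowSum-quadratic i = begin
          - ((r - lam) * (r - mu))
            ≈⟨ solve 3 (λ x y r → :- ((r :- x) :* (r :- y))
                 := (x :+ y) :* r :+ (:- (x :* y) :* con (+ 1) :+ :- con (+ 1) :* (r :* r)))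
                 refl lam mu r ⟩
          (lam + mu) * r + (- (lam * mu) * 1# + - 1# * (r * r))
            ≈⟨ +-congˡ (+-cong (*-congˡ (trans (sym (sum-𝟙 i (λ _ → 1#))) (sum-cong-≋ λ k →
                 *-identityʳ (𝟙 i k))))
                 (*-congˡ (sym (sum-square i)))) ⟩
          (lam + mu) * r + (- (lam * mu) * sum (𝟙 i) + - 1# * sum ((s ⊗ s) i))
            ≈⟨ sum-linear₃ (lam + mu) (- (lam * mu)) (- 1#) (s i) (𝟙 i) ((s ⊗ s) i) ⟨
          sum (λ k → (lam + mu) * s i k + (- (lam * mu) * 𝟙 i k + - 1# * (s ⊗ s) i k))
            ≈⟨ sum-cong-≋ (λ k → trans (solve 4 (λ x y e p →
                 x :+ (:- y :* e :+ :- con (+ 1) :* p) := x :- y :* e :- p) refl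
                 ((lam + mu) * s i k) (lam * mu) (𝟙 i k) ((s ⊗ s) i k))
                 (trans (sym (quadratic-entry lam mu s i k)) (Q≈δ i k))) ⟩
          sum {n} (λ _ → δ)
            ≈⟨ trans (sum-const n δ) nδ≈κ ⟩
          κ ∎
          where
          r = rowSum i

        det-I-wQ : ∀ w → det (pencil 1# w Q) ≈ 1# - w * κ
        det-I-wQ w = begin
          det (pencil 1# w Q)
            ≈⟨ det-pencil Q-spectrum 1# w ⟩
          product f (map q θs)
            ≈⟨ trans (product-map f q θs) (product-three (f ∘ q) lam mu nu) ⟩
          f (q lam) ^ a * (f (q mu) ^ b * (f κ * 1#))
            ≈⟨ *-cong (power-one a (f-zero q-lam)) (*-congʳ (power-one b (f-zero q-mu))) ⟩
          1# * (1# * (f κ * 1#))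
            ≈⟨ solve 1 (λ x → con (+ 1) :* (con (+ 1) :* (x :* con (+ 1))) := x) refl (f κ) ⟩
          1# - w * κ ∎
          where
          f : Carrier → Carrier
          f θ = 1# - w * θ
          f-zero : ∀ {x} → x ≈ 0# → f x ≈ 1#
          f-zero x≈0 = trans (+-congˡ (-‿cong (*-congˡ x≈0)))
            (solve 1 (λ w → con (+ 1) :- w :* con (+ 0) := con (+ 1)) refl w)
          power-one : ∀ {x} m → x ≈ 1# → x ^ m ≈ 1#
          power-one ℕ.zero    x≈1 = refl
          power-one (ℕ.suc m) x≈1 = trans (*-cong x≈1 (power-one m x≈1)) (*-identityˡ 1#)

        -- Serves two ends: the product fixes `M` when its rows sum to 0, and for constant nonzero
        -- row sums a suitable `w` makes it subtract J.
        ⊗-I-wQ : ∀ (M : Matrix Carrier n) w i j →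
          (M ⊗ pencil 1# w Q) i j ≈ M i j - w * δ * sum (M i)
        ⊗-I-wQ M w i j = begin
          sum (λ k → M i k * (1# * 𝟙 k j - w * Q k j))
            ≈⟨ sum-cong-≋ (λ k → trans (*-congˡ (+-congˡ (-‿cong (*-congˡ (Q≈δ k j)))))
                 (solve 4 (λ m e w d → m :* (con (+ 1) :* e :- w :* d)
                   := :- (w :* d) :* m :+ m :* e) refl
                   (M i k) (𝟙 k j) w δ)) ⟩
          sum (λ k → - (w * δ) * M i k + M i k * 𝟙 k j)
            ≈⟨ trans (sum-linear (- (w * δ)) (M i) _) (+-congˡ (sum-𝟙ʳ j (M i))) ⟩
          - (w * δ) * sum (M i) + M i j
            ≈⟨ solve 3 (λ x y z → :- x :* y :+ z := z :- x :* y) refl (w * δ) (sum (M i)) (M i j) ⟩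
          M i j - w * δ * sum (M i) ∎

        sum-pencil : ∀ u w i → sum (pencil u w s i) ≈ u - w * rowSum i
        sum-pencil u w i = begin
          sum (λ k → u * 𝟙 i k - w * s i k)
            ≈⟨ sum-cong-≋ (λ k → solve 4 (λ u w e m → u :* e :- w :* m := :- w :* m :+ e :* u)
                 refl u w (𝟙 i k) (s i k)) ⟩
          sum (λ k → - w * s i k + 𝟙 i k * u)
            ≈⟨ trans (sum-linear (- w) (s i) _) (+-congˡ (sum-𝟙 i (λ _ → u))) ⟩
          - w * rowSum i + u
            ≈⟨ solve 3 (λ u w r → :- w :* r :+ u := u :- w :* r) refl u w (rowSum i) ⟩
          u - w * rowSum i ∎

        -- X = r I - s annihilates the all-ones vector, so X (I - Q) = X, and
        -- I - Q has determinant 1 - κ: hence det X = 0.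
        rowSum-is-root : ∀ i → charPoly s (rowSum i) ≈ 0#
        rowSum-is-root o = cancel-zero κ#0 (begin
          κ * det X                       ≈⟨ solve 2 (λ k d →
            k :* d := d :- d :* (con (+ 1) :- con (+ 1) :* k)) refl κ (det X) ⟩
          det X - det X * (1# - 1# * κ)   ≈⟨ +-congˡ (-‿cong (*-congˡ (det-I-wQ 1#))) ⟨
          det X - det X * det (pencil 1# 1# Q) ≈⟨ +-congˡ (-‿cong (det-⊗ X (pencil 1# 1# Q))) ⟨
          det X - det (X ⊗ pencil 1# 1# Q) ≈⟨ +-congˡ (-‿cong (det-cong absorb)) ⟩
          det X - det X                   ≈⟨ -‿inverseʳ _ ⟩
          0#                              ∎)
          where
          X : Matrix Carrier n
          X = shift (rowSum o) s
          X-row : ∀ i → sum (X i) ≈ 0#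
          X-row i = begin
            sum (X i)
              ≈⟨ sum-cong-≋ (λ k → +-congˡ (-‿cong (sym (*-identityˡ (s i k))))) ⟩
            sum (pencil (rowSum o) 1# s i)
              ≈⟨ sum-pencil (rowSum o) 1# i ⟩
            rowSum o - 1# * rowSum i
              ≈⟨ trans (+-congˡ (-‿cong (*-identityˡ _))) (x≈y⇒x-y≈0 (rowSum-constant o i)) ⟩
            0# ∎
          absorb : ∀ i j → (X ⊗ pencil 1# 1# Q) i j ≈ X i j
          absorb i j = trans (⊗-I-wQ X 1# i j) (trans (+-congˡ (-‿cong (*-congˡ (X-row i))))
            (solve 2 (λ x d → x :- con (+ 1) :* d :* con (+ 0) := x) refl (X i j) δ))

        -- The row sum is a root of the characteristic polynomial, and (r - lam)(r - mu), being - κ,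
        -- is apart from 0. The powers of these two factors cancel and leave r - nu.
        rowSum≈nu : ∀ i → rowSum i ≈ nu
        rowSum≈nu i = x-y≈0⇒x≈y (begin
          r - nu        ≈⟨ *-identityʳ _ ⟨
          (r - nu) * 1# ≈⟨ cancel-zero (power#0 r-mu#0 b) (cancel-zero (power#0 r-lam#0 a) (begin
            (r - lam) ^ a * ((r - mu) ^ b * ((r - nu) * 1#)) ≈⟨ product-three (λ θ →
              r - θ) lam mu nu ⟨
            product (λ θ → r - θ) θs                          ≈⟨ HasSpectrum.charPoly-splits spec
              r ⟨
            charPoly s r                                      ≈⟨ rowSum-is-root i ⟩
            0#                                                ∎)) ⟩
          0#            ∎)
          where
          r = rowSum i
          factors#0 : (r - lam) * (r - mu) # 0#
          factors#0 = product#0ʳ {x = - 1#} (#-congʳ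
            (trans (sym (rowSum-quadratic i)) (solve 1 (λ x → :- x := :- con (+ 1) :* x) refl _))
              κ#0)
          r-lam#0 : r - lam # 0#
          r-lam#0 = product#0ˡ factors#0
          r-mu#0 : r - mu # 0#
          r-mu#0 = product#0ʳ factors#0

        order≡ : a ℕ.+ (b ℕ.+ 1) ≡ n
        order≡ = ≡.trans (≡.sym (length-three lam mu nu)) (spectrum-length spec)

        -- With y = 2x + 1, the matrix 2 (x I - A) is (y I + s) - J, and
        -- (y I + s)(I - w Q) = (y I + s) - J for w = 1 / (δ (y + ν)).
        adjacency-spectrum : (A : Matrix Carrier n) → (∀ i j → 2# * A i j ≈ 1# - 𝟙 i j - s i j) →
          HasSpectrum A (three ((- 1# - lam) * ½) ((- 1# - mu) * ½) ((fromℕ n - 1# - nu) * ½))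
        adjacency-spectrum A 2A .HasSpectrum.charPoly-splits = poly-unique-off
          (poly-det (λ x → shift x A) λ i j → poly-+ (poly-* poly-id (poly-const _)) (poly-const _))
          (poly-product {λ x θ → x - θ} (λ θ → poly-+ poly-id (poly-const _)) L)
          -- The zero of y + ν as a function of x, where `w` has its pole.
          ((- 1# - nu) * ½)
          λ x x# → cancelˡ (power#0 2#0 n)
            (off-pole x (#-congʳ (double x nu) (x#0y#0→xy#0 2#0 (#⇒-#0 x#))))
          where
          L : List Carrier
          L = three ((- 1# - lam) * ½) ((- 1# - mu) * ½) ((fromℕ n - 1# - nu) * ½)
          2½ : 2# * ½ ≈ 1#
          2½ = trans (solve 1 (λ h → (con (+ 1) :+ con (+ 1)) :* h
            := (con (+ 1) :+ con (+ 1) :- con (+ 0)) :* h) refl ½)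
            (proj₂ (proj₂ (#⇒invertible 2#0)))
          half : ∀ x z → 2# * (x - z * ½) ≈ 2# * x - z
          half x z = trans (solve 3 (λ x z h → (con (+ 1) :+ con (+ 1)) :* (x :- z :* h)
              := (con (+ 1) :+ con (+ 1)) :* x :- (con (+ 1) :+ con (+ 1)) :* h :* z) refl x z ½)
            (+-congˡ (-‿cong (trans (*-congʳ 2½) (*-identityˡ z))))
          double : ∀ x θ → 2# * (x - (- 1# - θ) * ½) ≈ 2# * x + 1# - - 1# * θ
          double x θ = trans (half x (- 1# - θ))
            (solve 2 (λ y θ → y :- (:- con (+ 1) :- θ) := y :+ con (+ 1) :- :- con (+ 1) :* θ)
              refl (2# * x) θ)
          off-pole : ∀ x → 2# * x + 1# - - 1# * nu # 0# →
                     2# ^ n * charPoly A x ≈ 2# ^ n * product (λ θ → x - θ) L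
          off-pole x y+nu#0 = begin
            2# ^ n * charPoly A x
              ≈⟨ det-scale 2# (shift x A) ⟨
            det (λ i j → 2# * (x * 𝟙 i j - A i j))
              ≈⟨ det-cong (λ i j → trans
                   (trans (solve 3 (λ x e m →
                     (con (+ 1) :+ con (+ 1)) :* (x :* e :- m)
                     := (con (+ 1) :+ con (+ 1)) :* x :* e :- (con (+ 1) :+ con (+ 1)) :* m) refl
                     x (𝟙 i j) (A i j)) (+-congˡ (-‿cong (2A i j))))
                   (trans (solve 3 (λ z e m →
                     z :* e :- (con (+ 1) :- e :- m) := (z :+ con (+ 1)) :* e :- :- con
                     (+ 1) :* m :- con (+ 1)) refl
                     (2# * x) (𝟙 i j) (s i j)) (+-congˡ (-‿cong (sym (pole-free i)))))) ⟩
            det (λ i j → X i j - w * δ * sum (X i))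
              ≈⟨ det-cong (λ i j → ⊗-I-wQ X w i j) ⟨
            det (X ⊗ pencil 1# w Q)
              ≈⟨ trans (det-⊗ X (pencil 1# w Q))
                   (*-cong (trans (det-pencil spec y (- 1#)) (product-three f lam mu nu))
                   (det-I-wQ w)) ⟩
            f lam ^ a * (f mu ^ b * (f nu * 1#)) * (1# - w * κ)
              ≈⟨ solve 4 (λ p q r u → p :* (q :* (r :* con (+ 1))) :* u
                   := p :* (q :* (r :* u :* con (+ 1)))) refl
                   (f lam ^ a) (f mu ^ b) (f nu) (1# - w * κ) ⟩
            f lam ^ a * (f mu ^ b * (f nu * (1# - w * κ) * 1#))
              ≈⟨ *-cong (power-cong a (sym (double x lam)))
                   (*-cong (power-cong b (sym (double x mu))) (*-congʳ last)) ⟩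
            g ((- 1# - lam) * ½) ^ a * (g
              ((- 1# - mu) * ½) ^ b * (g ((fromℕ n - 1# - nu) * ½) * 1#))
              ≈⟨ product-three g _ _ _ ⟨
            product g L
              ≈⟨ product-scale 2# (λ θ → x - θ) L ⟩
            2# ^ length L * product (λ θ → x - θ) L
              ≈⟨ *-congʳ (reflexive (≡.cong (2# ^_) (≡.trans (length-three _ _ _) order≡))) ⟩
            2# ^ n * product (λ θ → x - θ) L ∎
            where
            y : Carrier
            y = 2# * x + 1#
            f g : Carrier → Carrier
            f θ = y - - 1# * θ
            g θ = 2# * (x - θ)
            X : Matrix Carrier n
            X = pencil y (- 1#) s
            z z′ w : Carrier
            z  = proj₁ (inverse y+nu#0)
            z′ = proj₁ (inverse δ#0)
            w  = z * z′
            wδ≈z : w * δ ≈ z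
            wδ≈z = trans (solve 3 (λ z u d → z :* u :* d := d :* u :* z) refl z z′ δ)
              (trans (*-congʳ (proj₂ (inverse δ#0))) (*-identityˡ z))
            pole-free : ∀ i → w * δ * sum (X i) ≈ 1#
            pole-free i = trans (*-cong wδ≈z
              (trans (sum-pencil y (- 1#) i) (+-congˡ (-‿cong (*-congˡ (rowSum≈nu i))))))
              (trans (*-comm _ _) (proj₂ (inverse y+nu#0)))
            power-cong : ∀ {u v} m → u ≈ v → u ^ m ≈ v ^ m
            power-cong ℕ.zero    u≈v = refl
            power-cong (ℕ.suc m) u≈v = *-cong u≈v (power-cong m u≈v)
            -- Here the eigenvalue of the all-ones vector changes: w κ is n / (y + ν), so the factor
            -- y + ν becomes y + ν - n, which is twice the distance of x from the valency.
            last : f nu * (1# - w * κ) ≈ g ((fromℕ n - 1# - nu) * ½)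
            last = begin
              f nu * (1# - w * κ)
                ≈⟨ *-congˡ (+-congˡ (-‿cong (*-congˡ (sym nδ≈κ)))) ⟩
              f nu * (1# - w * (fromℕ n * δ))
                ≈⟨ solve 4 (λ f w k d → f :* (con (+ 1) :- w :* (k :* d))
                     := f :- f :* (w :* d) :* k) refl (f nu) w (fromℕ n) δ ⟩
              f nu - f nu * (w * δ) * fromℕ n
                ≈⟨ +-congˡ (-‿cong (trans (*-congʳ (trans (*-congˡ wδ≈z) (proj₂ (inverse y+nu#0))))
                     (*-identityˡ _))) ⟩
              f nu - fromℕ n
                ≈⟨ solve 3 (λ v x k → x :+ con (+ 1) :- :- con (+ 1) :* v :- k
                     := x :- (k :- con (+ 1) :- v)) refl nu (2# * x) (fromℕ n) ⟩
              2# * x - (fromℕ n - 1# - nu)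
                ≈⟨ half x (fromℕ n - 1# - nu) ⟨
              g ((fromℕ n - 1# - nu) * ½) ∎

-- Integer switching and underlying graphs.

IsSign : ℤ → Set
IsSign z = z ≡ 1ℤ ⊎ z ≡ -1ℤ

sign-* : ∀ {x y} → IsSign x → IsSign y → IsSign (x ℤ.* y)
sign-* (inj₁ ≡.refl) (inj₁ ≡.refl) = inj₁ ≡.refl
sign-* (inj₁ ≡.refl) (inj₂ ≡.refl) = inj₂ ≡.refl
sign-* (inj₂ ≡.refl) (inj₁ ≡.refl) = inj₂ ≡.refl
sign-* (inj₂ ≡.refl) (inj₂ ≡.refl) = inj₁ ≡.refl

module Switching {n} (v : Fin n → ℤ) (v-sign : ∀ i → IsSign (v i)) where
  open Determinant ℤₚ.+-*-commutativeRing using (diagonal; diagonal-conjugate)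

  switch : Matrix ℤ n → Matrix ℤ n
  switch S i j = v i ℤ.* S i j ℤ.* v j

  switch-seidel : ∀ {S} → IsSeidel S → IsSeidel (switch S)
  switch-seidel {S} seidel = record
    { symmetric   = λ i j → ≡.trans (≡.cong (λ z → v i ℤ.* z ℤ.* v j) (symmetric i j))
        (≡.trans (≡.cong (ℤ._* v j) (ℤₚ.*-comm (v i) (S j i)))
          (≡.trans (ℤₚ.*-comm (S j i ℤ.* v i) (v j)) (≡.sym (ℤₚ.*-assoc (v j) (S j i) (v i)))))
    ; diagonal    = λ i → ≡.cong (ℤ._* v i)
      (≡.trans (≡.cong (v i ℤ.*_) (diagonal′ i)) (ℤₚ.*-zeroʳ (v i)))
    ; offDiagonal = λ {i} {j} i≢j → sign-* (sign-* (v-sign i) (offDiagonal i≢j)) (v-sign j)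
    }
    where open IsSeidel seidel renaming (diagonal to diagonal′)

  diagonal-signed : IsSignedPermutation (diagonal v)
  diagonal-signed = record
    { entries = entries
    ; rows    = λ i → i , diagonal≢0 i , λ {j} → off i j
    ; columns = λ j → j , diagonal≢0 j , λ {i} → ≡.sym ∘ off i j
    }
    where
    entries : ∀ i j → diagonal v i j ≡ 0ℤ ⊎ diagonal v i j ≡ 1ℤ ⊎ diagonal v i j ≡ -1ℤ
    entries i j with i ≟ j
    ... | yes _ = inj₂ ([ inj₁ ∘ ≡.trans (ℤₚ.*-identityʳ (v i)) , inj₂ ∘ ≡.trans
      (ℤₚ.*-identityʳ (v i)) ]′ (v-sign i))
    ... | no  _ = inj₁ (ℤₚ.*-zeroʳ (v i))
    diagonal≢0 : ∀ i → diagonal v i i ≢ 0ℤ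
    diagonal≢0 i eq with i ≟ i
    ... | no i≢i = i≢i ≡.refl
    ... | yes _ with v i | v-sign i
    ...   | _ | inj₁ ≡.refl with () ← eq
    ...   | _ | inj₂ ≡.refl with () ← eq
    off : ∀ i j → diagonal v i j ≢ 0ℤ → i ≡ j
    off i j ≢0 with i ≟ j
    ... | yes i≡j = i≡j
    ... | no  _   = ⊥-elim (≢0 (ℤₚ.*-zeroʳ (v i)))

  switch-equivalent : ∀ S → SwitchingEquivalent (switch S) S
  switch-equivalent S = diagonal v , diagonal-signed , λ i j → ≡.sym (diagonal-conjugate v S i j)

-- In (J - I - S) / 2 an edge corresponds to an entry -1 of S; the diagonal 0 and the entries 1 give
-- no adjacency.
isNegative : ℤ → Bool
isNegative (+ _)    = false
isNegative -[1+ _ ] = true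

underlyingGraph : ∀ {n} {S : Matrix ℤ n} → IsSeidel S → Graph n
underlyingGraph {S = S} seidel = record
  { adj       = λ u v → isNegative (S u v)
  ; symmetric = λ u v → ≡.cong isNegative (symmetric u v)
  ; loopless  = λ v → ≡.cong isNegative (diagonal v)
  }
  where open IsSeidel seidel

module _ {n} {S : Matrix ℤ n} (seidel : IsSeidel S) where
  open IsSeidel seidel
  open Graph (underlyingGraph seidel) using (adj)

  adjacent⇒-1 : ∀ {u v} → adj u v ≡ true → S u v ≡ -1ℤ
  adjacent⇒-1 {u} {v} eq with u ≟ v
  ... | yes ≡.refl rewrite diagonal u with () ← eq
  ... | no  u≢v with offDiagonal u≢v
  ...   | inj₂ S≡-1 = S≡-1
  ...   | inj₁ S≡1 rewrite S≡1 with () ← eq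

  nonAdjacent⇒1 : ∀ {u v} → u ≢ v → adj u v ≡ false → S u v ≡ 1ℤ
  nonAdjacent⇒1 {u} {v} u≢v eq with offDiagonal u≢v
  ... | inj₁ S≡1 = S≡1
  ... | inj₂ S≡-1 rewrite S≡-1 with () ← eq

  isUnderlyingGraph : IsUnderlyingGraph (underlyingGraph seidel) S
  isUnderlyingGraph i j with i ≟ j
  ... | yes ≡.refl rewrite diagonal i = ≡.refl
  ... | no  i≢j with offDiagonal i≢j
  ...   | inj₁ S≡1 rewrite S≡1 = ≡.refl
  ...   | inj₂ S≡-1 rewrite S≡-1 = ≡.refl

-- A value must be named even when no pair of the given kind exists. Finite search settles this: a
-- pair found supplies its own count, and otherwise 0 serves vacuously.
commonNeighboursConstant : ∀ {n} (G : Graph n) (β : Bool) →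
  let open Graph G in
  (∀ {u v u′ v′} → u ≢ v → adj u v ≡ β → u′ ≢ v′ → adj u′ v′ ≡ β →
    ∣ neighbours G u ∩ neighbours G v ∣ ≡ ∣ neighbours G u′ ∩ neighbours G v′ ∣) →
  ∃[ e ] ∀ {u v} → u ≢ v → adj u v ≡ β → ∣ neighbours G u ∩ neighbours G v ∣ ≡ e
commonNeighboursConstant G β same
  with any? (λ u → any? λ v → ¬? (u ≟ v) ×-dec (Graph.adj G u v Boolₚ.≟ β))
... | yes (u , v , u≢v , eq) = ∣ neighbours G u ∩ neighbours G v ∣ , λ u′≢v′ eq′ →
  same u′≢v′ eq′ u≢v eq
... | no  none = 0 , λ u≢v eq → ⊥-elim (none (_ , _ , u≢v , eq))

-- From the switched Seidel matrix to the strongly regular graph.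

module SeidelSpectrum {c ℓ₁ ℓ₂ ℓ₃} (K : OrderedField c ℓ₁ ℓ₂ ℓ₃) where
  open OrderedField K hiding (zero)
  open OrderedFieldProperties K
  open MatrixOps commutativeRing
  open Determinant commutativeRing hiding (diagonal)
  open PolynomialFunctions K
  open Spectrum K
  open SumsOfSquares K
  open SeidelOver K
  open IntegerSpectrum K
  open SumProperties semiring using (sum; sum-cong-≋; *-distribˡ-sum)
  open IntegerCoefficients commutativeRing
  open SetoidReasoning setoid

  module _ {n} {s t : Matrix Carrier n} (σ : Fin n → Carrier) (σ² : ∀ i → σ i * σ i ≈ 1#)
           (t≈σsσ : ∀ i j → t i j ≈ σ i * s i j * σ j) where

    𝟙-conjugate : ∀ i j → 𝟙 i j ≈ σ i * 𝟙 i j * σ j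
    𝟙-conjugate i j with i ≟ j
    ... | yes ≡.refl = sym (trans (*-congʳ (*-identityʳ (σ i))) (σ² i))
    ... | no  _      = solve 2 (λ x y → con (+ 0) := x :* con (+ 0) :* y) refl (σ i) (σ j)

    conjugate-spectrum : ∀ {θs} → HasSpectrum s θs → HasSpectrum t θs
    conjugate-spectrum spec .HasSpectrum.charPoly-splits x = trans
      (det-cong λ i j → trans (+-cong (*-congˡ (𝟙-conjugate i j)) (-‿cong (t≈σsσ i j)))
        (solve 5 (λ x p q e m → x :* (p :* e :* q) :- p :* m :* q := p :* (x :* e :- m) :* q) refl
          x (σ i) (σ j) (𝟙 i j) (s i j)))
      (trans (det-conjugate σ σ² (shift x s)) (spec .HasSpectrum.charPoly-splits x))

    conjugate-square : ∀ i j → (t ⊗ t) i j ≈ σ i * σ j * (s ⊗ s) i j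
    conjugate-square i j = begin
      sum (λ k → t i k * t k j)
        ≈⟨ sum-cong-≋ (λ k → begin
             t i k * t k j
               ≈⟨ *-cong (t≈σsσ i k) (t≈σsσ k j) ⟩
             σ i * s i k * σ k * (σ k * s k j * σ j)
               ≈⟨ solve 5 (λ p q r x y →
                    p :* x :* q :* (q :* y :* r) := q :* q :* (p :* r :* (x :* y))) refl
                    (σ i) (σ k) (σ j) (s i k) (s k j) ⟩
             σ k * σ k * (σ i * σ j * (s i k * s k j))
               ≈⟨ trans (*-congʳ (σ² k)) (*-identityˡ _) ⟩
             σ i * σ j * (s i k * s k j) ∎) ⟩
      sum (λ k → σ i * σ j * (s i k * s k j))
        ≈⟨ *-distribˡ-sum (σ i * σ j) (λ k → s i k * s k j) ⟨
      σ i * σ j * (s ⊗ s) i j ∎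

    conjugate-quadratic : ∀ x y i j → quadratic x y t i j ≈ σ i * σ j * quadratic x y s i j
    conjugate-quadratic x y i j = begin
      quadratic x y t i j
        ≈⟨ quadratic-entry x y t i j ⟩
      (x + y) * t i j - x * y * 𝟙 i j - (t ⊗ t) i j
        ≈⟨ +-cong (+-cong (*-congˡ (t≈σsσ i j)) (-‿cong (*-congˡ (𝟙-conjugate i j))))
             (-‿cong (conjugate-square i j)) ⟩
      (x + y) * (σ i * s i j * σ j) - x * y * (σ i * 𝟙 i j * σ j) - σ i * σ j * (s ⊗ s) i j
        ≈⟨ solve 7 (λ z w p q m e r → z :* (p :* m :* q) :- w :* (p :* e :* q) :- p :* q :* r
             := p :* q :* (z :* m :- w :* e :- r)) refl
             (x + y) (x * y) (σ i) (σ j) (s i j) (𝟙 i j) ((s ⊗ s) i j) ⟩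
      σ i * σ j * ((x + y) * s i j - x * y * 𝟙 i j - (s ⊗ s) i j)
        ≈⟨ *-congˡ (quadratic-entry x y s i j) ⟨
      σ i * σ j * quadratic x y s i j ∎

  fromℤ-1 : fromℤ 1ℤ ≈ 1#
  fromℤ-1 = +-identityʳ 1#

  fromℤ--1 : fromℤ -1ℤ ≈ - 1#
  fromℤ--1 = -‿cong (+-identityʳ 1#)

  fromℤ-neg : ∀ z → fromℤ (ℤ.- z) ≈ - fromℤ z
  fromℤ-neg (+ ℕ.zero)  = solve 0 (con (+ 0) := :- con (+ 0)) refl
  fromℤ-neg (+ ℕ.suc n) = refl
  fromℤ-neg -[1+ n ]    = solve 1 (λ x → x := :- :- x) refl (fromℕ (ℕ.suc n))

  fromℤ-sign-* : ∀ {x} → IsSign x → ∀ y → fromℤ (x ℤ.* y) ≈ fromℤ x * fromℤ y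
  fromℤ-sign-* (inj₁ ≡.refl) y = trans (reflexive (≡.cong fromℤ (ℤₚ.*-identityˡ y)))
    (trans (sym (*-identityˡ _)) (*-congʳ (sym fromℤ-1)))
  fromℤ-sign-* (inj₂ ≡.refl) y = trans (reflexive (≡.cong fromℤ (ℤₚ.-1*i≡-i y)))
    (trans (fromℤ-neg y) (trans (solve 1 (λ x → :- x := :- con (+ 1) :* x) refl (fromℤ y))
      (*-congʳ (sym fromℤ--1))))

  sign-square-one : ∀ {x} → IsSign x → fromℤ x * fromℤ x ≈ 1#
  sign-square-one (inj₁ ≡.refl) = trans (*-cong fromℤ-1 fromℤ-1) (*-identityˡ 1#)
  sign-square-one (inj₂ ≡.refl) = trans (*-cong fromℤ--1 fromℤ--1)
    (solve 0 (:- con (+ 1) :* :- con (+ 1) := con (+ 1)) refl)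

  embed : ∀ {n} → Matrix ℤ n → Matrix Carrier n
  embed S i j = fromℤ (S i j)

  seidelOver : ∀ {n} {S : Matrix ℤ n} → IsSeidel S → IsSeidelOver (embed S)
  seidelOver seidel = record
    { symmetric   = λ i j → reflexive (≡.cong fromℤ (symmetric i j))
    ; diagonal    = λ i → reflexive (≡.cong fromℤ (diagonal i))
    ; offDiagonal = λ i≢j → sign-square-one (offDiagonal i≢j)
    }
    where open IsSeidel seidel

  indicator : Bool → Carrier
  indicator β = if β then 1# else 0#

  fromℕ-count : ∀ {n} (f : Fin n → Bool) → fromℕ ∣ Vec.tabulate f ∣ ≈ sum (λ k → indicator (f k))
  fromℕ-count {ℕ.zero}  f = refl
  fromℕ-count {ℕ.suc n} f with f zero
  ... | true  = +-congˡ (fromℕ-count (λ k → f (suc k)))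
  ... | false = trans (fromℕ-count (λ k → f (suc k))) (sym (+-identityˡ _))

  tabulate-∩ : ∀ {n} (f g : Fin n → Bool) →
    Vec.tabulate f ∩ Vec.tabulate g ≡ Vec.tabulate (λ k → f k ∧ g k)
  tabulate-∩ {ℕ.zero}  f g = ≡.refl
  tabulate-∩ {ℕ.suc n} f g = ≡.cong (f zero ∧ g zero Vec.∷_)
    (tabulate-∩ (λ k → f (suc k)) (λ k → g (suc k)))

  indicator-∧ : ∀ α β → indicator (α ∧ β) ≈ indicator α * indicator β
  indicator-∧ true  β = sym (*-identityˡ _)
  indicator-∧ false β = solve 1 (λ x → con (+ 0) := con (+ 0) :* x) refl (indicator β)

  module StronglyRegular (lam mu nu : Carrier) (a b : ℕ) (0<a : 0 ℕ.< a) (0<b : 0 ℕ.< b)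
    (lam#mu : lam # mu) (lam#nu : lam # nu) (mu#nu : mu # nu) where
    open ThreeEigenvalues lam mu nu a b lam#nu mu#nu

    module _ {n} {S : Matrix ℤ n} (seidel : IsSeidel S) (spec : HasSpectrum (embed S) θs)
      (Q≈δ : ∀ i j → Q (seidelOver seidel) spec i j ≈ δ (seidelOver seidel) spec) (o : Fin n) where

      s : Matrix Carrier n
      s = embed S

      d : Carrier
      d = δ (seidelOver seidel) spec

      open IsSeidelOver (seidelOver seidel)
      open Normalised (seidelOver seidel) spec Q≈δ

      G : Graph n
      G = underlyingGraph seidel
      open Graph G using (adj)

      -- Twice the adjacency matrix, so that degrees and common neighbours are counted without
      -- halves.
      B : Matrix Carrier n
      B i j = 1# - 𝟙 i j - s i j

      2-indicator : ∀ i j → 2# * indicator (adj i j) ≈ B i j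
      2-indicator i j with i ≟ j
      ... | yes ≡.refl rewrite IsSeidel.diagonal seidel i =
        solve 0 ((con (+ 1) :+ con (+ 1)) :* con (+ 0) := con (+ 1) :- con (+ 1) :- con (+ 0)) refl
      ... | no i≢j with IsSeidel.offDiagonal seidel i≢j
      ...   | inj₁ S≡1 rewrite S≡1 =
        solve 0 ((con (+ 1) :+ con (+ 1)) :* con (+ 0) := con (+ 1) :- con
          (+ 0) :- (con (+ 1) :+ con (+ 0))) refl
      ...   | inj₂ S≡-1 rewrite S≡-1 =
        solve 0 ((con (+ 1) :+ con (+ 1)) :* con (+ 1) := con (+ 1) :- con
          (+ 0) :- :- (con (+ 1) :+ con (+ 0))) refl

      embed-adjacency : ∀ i j → embed (adjacencyMatrix G) i j ≈ indicator (adj i j)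
      embed-adjacency i j with adj i j
      ... | true  = +-identityʳ 1#
      ... | false = refl

      2-adjacency : ∀ i j → 2# * embed (adjacencyMatrix G) i j ≈ B i j
      2-adjacency i j = trans (*-congˡ (embed-adjacency i j)) (2-indicator i j)

      ρ : Carrier
      ρ = fromℕ n - 1# - nu

      sum-B : ∀ u → sum (B u) ≈ ρ
      sum-B u = begin
        sum (λ k → 1# - 𝟙 u k - s u k)
          ≈⟨ sum-cong-≋ (λ k → solve 2 (λ x y → x :- y := :- con (+ 1) :* y :+ x) refl (1# - 𝟙 u k)
               (s u k)) ⟩
        sum (λ k → - 1# * s u k + (1# - 𝟙 u k))
          ≈⟨ sum-linear (- 1#) (s u) (λ k → 1# - 𝟙 u k) ⟩
        - 1# * sum (s u) + sum (λ k → 1# - 𝟙 u k)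
          ≈⟨ +-cong (*-congˡ (rowSum≈nu u)) (sum-1-𝟙 u) ⟩
        - 1# * nu + (fromℕ n - 1#)
          ≈⟨ solve 2 (λ x y → :- con (+ 1) :* x :+ y := y :- x) refl nu (fromℕ n - 1#) ⟩
        ρ ∎

      degree : ∀ u → 2# * fromℕ ∣ neighbours G u ∣ ≈ ρ
      degree u = begin
        2# * fromℕ ∣ neighbours G u ∣           ≈⟨ *-congˡ (fromℕ-count (adj u)) ⟩
        2# * sum (λ k → indicator (adj u k))    ≈⟨ *-distribˡ-sum 2# (λ k → indicator (adj u k)) ⟩
        sum (λ k → 2# * indicator (adj u k))    ≈⟨ sum-cong-≋ (2-indicator u) ⟩
        sum (B u)                               ≈⟨ sum-B u ⟩
        ρ                                       ∎

      isRegular : IsRegular G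
      isRegular = ∣ neighbours G o ∣ , λ v → fromℕ-injective
        (cancelˡ 2#0 (trans (degree v) (sym (degree o))))

      -- Four times the number of common neighbours of `u` and `v`, as a function of x = `s u v`. It
      -- is the off-diagonal entry of B² = J B - B - s B, with J B = ρ J, s B = ν J - s - s², and s²
      -- a combination of I, s and J; each `0#` stands for an entry of the identity.
      ψ : Carrier → Carrier
      ψ x = ρ - (1# - 0# - x) - (nu - x - (- (lam * mu) * 0# + ((lam + mu) * x - d)))

      ψ-cong : ∀ {x y} → x ≈ y → ψ x ≈ ψ y
      ψ-cong x≈y = +-cong (+-congˡ (-‿cong (+-congˡ (-‿cong x≈y))))
        (-‿cong (+-cong (+-congˡ (-‿cong x≈y)) (-‿cong (+-congˡ (+-congʳ (*-congˡ x≈y))))))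

      sum-BB : ∀ {u v} → u ≢ v → sum (λ k → B u k * B v k) ≈ ψ (s u v)
      sum-BB {u} {v} u≢v = begin
        sum (λ k → B u k * B v k)
          ≈⟨ sum-cong-≋ (λ k → solve 3 (λ e m b → (con (+ 1) :- e :- m) :* b
               := con (+ 1) :* b :+ (:- con (+ 1) :* (e :* b) :+ :- con (+ 1) :* (m :* b)))
                 refl (𝟙 u k) (s u k) (B v k)) ⟩
        sum (λ k → 1# * B v k + (- 1# * (𝟙 u k * B v k) + - 1# * (s u k * B v k)))
          ≈⟨ sum-linear₃ 1# (- 1#) (- 1#) (B v) (λ k → 𝟙 u k * B v k) (λ k → s u k * B v k) ⟩
        1# * sum (B v) + (- 1# * sum (λ k → 𝟙 u k * B v k) + - 1# * sum (λ k → s u k * B v k))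
          ≈⟨ +-cong (*-congˡ (sum-B v)) (+-cong (*-congˡ (sum-𝟙 u (B v))) (*-congˡ sum-sB)) ⟩
        1# * ρ + (- 1# * B v u + - 1# * (nu - s u v - (s ⊗ s) u v))
          ≈⟨ solve 3 (λ x y z → con (+ 1) :* x :+ (:- con (+ 1) :* y :+ :- con (+ 1) :* z)
               := x :- y :- z) refl
               ρ (B v u) (nu - s u v - (s ⊗ s) u v) ⟩
        ρ - B v u - (nu - s u v - (s ⊗ s) u v)
          ≈⟨ +-cong (+-congˡ (-‿cong (+-cong (+-congˡ (-‿cong (𝟙-off-diagonal (u≢v ∘ ≡.sym))))
               (-‿cong (symmetric v u)))))
               (-‿cong (+-congˡ (-‿cong (trans (square-entry u v)
                 (+-congʳ (*-congˡ (𝟙-off-diagonal u≢v))))))) ⟩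
        ψ (s u v) ∎
        where
        sum-sB : sum (λ k → s u k * B v k) ≈ nu - s u v - (s ⊗ s) u v
        sum-sB = begin
          sum (λ k → s u k * B v k)
            ≈⟨ sum-cong-≋ (λ k → trans (*-congˡ (+-congˡ (-‿cong (symmetric v k))))
                 (solve 3 (λ m e p → m :* (con (+ 1) :- e :- p)
                   := con (+ 1) :* m :+ (:- con (+ 1) :* (e :* m) :+ :- con (+ 1) :* (m :* p)))
                     refl (s u k) (𝟙 v k) (s k v))) ⟩
          sum (λ k → 1# * s u k + (- 1# * (𝟙 v k * s u k) + - 1# * (s u k * s k v)))
            ≈⟨ sum-linear₃ 1# (- 1#) (- 1#) (s u) (λ k → 𝟙 v k * s u k) (λ k → s u k * s k v) ⟩
          1# * sum (s u) + (- 1# * sum (λ k → 𝟙 v k * s u k) + - 1# * (s ⊗ s) u v)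
            ≈⟨ +-cong (*-congˡ (rowSum≈nu u)) (+-congʳ (*-congˡ (sum-𝟙 v (s u)))) ⟩
          1# * nu + (- 1# * s u v + - 1# * (s ⊗ s) u v)
            ≈⟨ solve 3 (λ x y z → con (+ 1) :* x :+ (:- con (+ 1) :* y :+ :- con (+ 1) :* z)
                 := x :- y :- z) refl
                 nu (s u v) ((s ⊗ s) u v) ⟩
          nu - s u v - (s ⊗ s) u v ∎

      common : ∀ {u v} → u ≢ v → 2# * 2# * fromℕ ∣ neighbours G u ∩ neighbours G v ∣ ≈ ψ (s u v)
      common {u} {v} u≢v = begin
        2# * 2# * fromℕ ∣ neighbours G u ∩ neighbours G v ∣
          ≈⟨ *-congˡ (trans (reflexive (≡.cong (fromℕ ∘ ∣_∣) (tabulate-∩ (adj u) (adj v))))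
               (fromℕ-count (λ k → adj u k ∧ adj v k))) ⟩
        2# * 2# * sum (λ k → indicator (adj u k ∧ adj v k))
          ≈⟨ *-distribˡ-sum (2# * 2#) (λ k → indicator (adj u k ∧ adj v k)) ⟩
        sum (λ k → 2# * 2# * indicator (adj u k ∧ adj v k))
          ≈⟨ sum-cong-≋ (λ k → trans (*-congˡ (indicator-∧ (adj u k) (adj v k)))
               (trans (solve 3 (λ t x y → t :* t :* (x :* y) := t :* x :* (t :* y))
                 refl 2# (indicator (adj u k)) (indicator (adj v k)))
                 (*-cong (2-indicator u k) (2-indicator v k)))) ⟩
        sum (λ k → B u k * B v k)
          ≈⟨ sum-BB u≢v ⟩
        ψ (s u v) ∎

      common-same : ∀ β x → (∀ {u v} → u ≢ v → adj u v ≡ β → S u v ≡ x) →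
        ∃[ e ] ∀ {u v} → u ≢ v → adj u v ≡ β → ∣ neighbours G u ∩ neighbours G v ∣ ≡ e
      common-same β x entry = commonNeighboursConstant G β λ u≢v eq u′≢v′ eq′ →
        fromℕ-injective (cancelˡ (x#0y#0→xy#0 2#0 2#0) (trans (common u≢v)
          (trans (ψ-cong (reflexive (≡.cong fromℤ
            (≡.trans (entry u≢v eq) (≡.sym (entry u′≢v′ eq′))))))
            (sym (common u′≢v′)))))

      fromℕ-order : fromℕ n ≈ fromℕ a + (fromℕ b + (1# + 0#))
      fromℕ-order = trans (reflexive (≡.cong fromℕ (≡.sym order≡)))
        (trans (fromℕ-+ a (b ℕ.+ 1)) (+-congˡ (fromℕ-+ b 1)))

      fromℕ#0 : ∀ {m} → 0 ℕ.< m → fromℕ m # 0#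
      fromℕ#0 0<m = fromℕ-# (ℕₚ.m<n⇒n≢0 0<m)

      -- If s = ε (J - I), then ν = ε (n - 1) and n δ = κ give
      -- (n - 1) (lam + ε) (mu + ε) = 0, while tr s = 0 reads
      -- a (lam + ε) + b (mu + ε) = 0; both force lam = mu = -ε.
      off-diagonal-not-constant : ∀ ε → ε * ε ≈ 1# → ¬ (∀ {u v} → u ≢ v → s u v ≈ ε)
      -- Since `lam` and `mu` are apart, at least one of them is apart from `- ε`; the vanishing
      -- product then forces the other to equal `- ε`, and the trace gives the contradiction.
      off-diagonal-not-constant ε ε² s≈ε = [ lam-case , mu-case ]′ (#-cotrans lam#mu (- ε))
        where
        N : Carrier
        N = fromℕ n - 1#
        nu≈εN : nu ≈ ε * N
        nu≈εN = begin
          nu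
            ≈⟨ rowSum≈nu o ⟨
          sum (s o)
            ≈⟨ sum-cong-≋ entry ⟩
          sum (λ k → ε * (1# - 𝟙 o k))
            ≈⟨ trans (sym (*-distribˡ-sum ε (λ k → 1# - 𝟙 o k))) (*-congˡ (sum-1-𝟙 o)) ⟩
          ε * N ∎
          where
          entry : ∀ k → s o k ≈ ε * (1# - 𝟙 o k)
          entry k with o ≟ k
          ... | yes ≡.refl = trans (diagonal o)
            (solve 1 (λ x → con (+ 0) := x :* (con (+ 1) :- con (+ 1))) refl ε)
          ... | no  o≢k    = trans (s≈ε o≢k) (solve 1 (λ x → x := x :* (con (+ 1) :- con (+ 0)))
            refl ε)
        N≈a+b : N ≈ fromℕ a + fromℕ b
        N≈a+b = trans (+-congʳ fromℕ-order)
          (solve 2 (λ x y → x :+ (y :+ (con (+ 1) :+ con (+ 0))) :- con (+ 1) := x :+ y)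
            refl (fromℕ a) (fromℕ b))
        N#0 : N # 0#
        N#0 = #-congʳ (trans (fromℕ-+ a b) (sym N≈a+b)) (fromℕ#0 (ℕₚ.<-≤-trans 0<a (ℕₚ.m≤m+n a b)))
        product-zero : (lam + ε) * (mu + ε) ≈ 0#
        product-zero = cancel-zero N#0 (begin
          N * ((lam + ε) * (mu + ε))
            -- With ν = ε N substituted in κ, the left side is N² + N times the relation ε² - 1 = 0,
            -- minus the relation n δ - κ = 0.
            ≈⟨ solve 4 (λ k l m e → (k :- con (+ 1)) :* ((l :+ e) :* (m :+ e))
                 := (e :* e :- con (+ 1))
                   :* ((k :- con (+ 1)) :* (k :- con (+ 1)) :+ (k :- con (+ 1)))
                    :- (k :* (:- (l :* m) :- (k :- con (+ 1)))
                        :- :- ((l :- e :* (k :- con (+ 1))) :* (m :- e :* (k :- con (+ 1)))))) refl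
                 (fromℕ n) lam mu ε ⟩
          (ε * ε - 1#) * (N * N + N) - (fromℕ n * d - - ((lam - ε * N) * (mu - ε * N)))
            ≈⟨ +-cong (*-congʳ (x≈y⇒x-y≈0 ε²))
                 (-‿cong (x≈y⇒x-y≈0 (trans (nδ≈κ (seidelOver seidel) spec)
                 (-‿cong (*-cong (+-congˡ (-‿cong nu≈εN)) (+-congˡ (-‿cong nu≈εN))))))) ⟩
          0# * (N * N + N) - 0#
            ≈⟨ solve 1 (λ x → con (+ 0) :* x :- con (+ 0) := con (+ 0)) refl (N * N + N) ⟩
          0# ∎)
        trace-zero : fromℕ a * (lam + ε) + fromℕ b * (mu + ε) ≈ 0#
        trace-zero = begin
          fromℕ a * (lam + ε) + fromℕ b * (mu + ε)
            ≈⟨ solve 5 (λ a b l m e → a :* (l :+ e) :+ b :* (m :+ e)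
                 := a :* l :+ (b :* m :+ (e :* (a :+ b) :+ con (+ 0)))) refl (fromℕ a)
                   (fromℕ b) lam mu ε ⟩
          fromℕ a * lam + (fromℕ b * mu + (ε * (fromℕ a + fromℕ b) + 0#))
            ≈⟨ +-congˡ (+-congˡ (+-congʳ (trans (*-congˡ (sym N≈a+b)) (sym nu≈εN)))) ⟩
          fromℕ a * lam + (fromℕ b * mu + (nu + 0#))
            ≈⟨ total-three id lam mu nu ⟨
          total id θs
            ≈⟨ trace-spectrum spec ⟨
          trace s
            ≈⟨ sum-zero diagonal ⟩
          0# ∎
        lam-case : lam # - ε → ⊥
        lam-case lam#-ε = #-irrefl (cancel-zero (fromℕ#0 0<a) (begin
          fromℕ a * (lam + ε)
            ≈⟨ solve 2 (λ x y → x := x :+ y :* con (+ 0)) refl _ (fromℕ b) ⟩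
          fromℕ a * (lam + ε) + fromℕ b * 0#
            ≈⟨ +-congˡ (*-congˡ (cancel-zero lam+ε#0 product-zero)) ⟨
          fromℕ a * (lam + ε) + fromℕ b * (mu + ε)
            ≈⟨ trace-zero ⟩
          0# ∎)) lam+ε#0
          where
          lam+ε#0 : lam + ε # 0#
          lam+ε#0 = #-congʳ (solve 2 (λ x e → x :- :- e := x :+ e) refl lam ε) (#⇒-#0 lam#-ε)
        mu-case : - ε # mu → ⊥
        mu-case -ε#mu = #-irrefl (cancel-zero (fromℕ#0 0<b) (begin
          fromℕ b * (mu + ε)
            ≈⟨ solve 2 (λ x y → x := y :* con (+ 0) :+ x) refl _ (fromℕ a) ⟩
          fromℕ a * 0# + fromℕ b * (mu + ε)
            ≈⟨ +-congʳ (*-congˡ (cancel-zero mu+ε#0 (trans (*-comm _ _) product-zero))) ⟨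
          fromℕ a * (lam + ε) + fromℕ b * (mu + ε)
            ≈⟨ trace-zero ⟩
          0# ∎)) mu+ε#0
          where
          mu+ε#0 : mu + ε # 0#
          mu+ε#0 = #-congʳ (solve 2 (λ x e → x :- :- e := x :+ e) refl mu ε) (#⇒-#0 (#-sym -ε#mu))

      isStronglyRegular : IsStronglyRegular G
      isStronglyRegular = record
        { regular     = isRegular
        ; notComplete = λ complete → off-diagonal-not-constant (fromℤ -1ℤ)
          (sign-square-one (inj₂ ≡.refl))
            λ u≢v → reflexive (≡.cong fromℤ (adjacent⇒-1 seidel (complete u≢v)))
        ; notEmpty    = λ empty → off-diagonal-not-constant (fromℤ 1ℤ)
          (sign-square-one (inj₁ ≡.refl))
            λ u≢v → reflexive (≡.cong fromℤ (nonAdjacent⇒1 seidel u≢v (empty _ _)))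
        ; adjacent    = common-same true -1ℤ λ _ → adjacent⇒-1 seidel
        ; nonAdjacent = common-same false 1ℤ (nonAdjacent⇒1 seidel)
        }

      adjacency-eigenvalues : HasEigenvaluesℤ (adjacencyMatrix G)
        ( ((- 1# - lam) /2 , a) ∷ ((- 1# - mu) /2 , b) ∷ ((fromℕ n - 1# - nu) /2 , 1) ∷ [])
      adjacency-eigenvalues x = trans
        (adjacency-spectrum (embed (adjacencyMatrix G)) 2-adjacency .HasSpectrum.charPoly-splits x)
        (trans (product-three (λ θ → x - θ) _ _ _)
          (*-congˡ (*-congˡ (*-congʳ (sym (*-identityʳ _))))))

    -- The vertex `o` selects the row of `Q` whose signs do the switching; by rank one these signs
    -- make every entry of the conjugated `Q` equal to δ.
    switching-class : ∀ {n} (S : Matrix ℤ n) → IsSeidel S → HasSpectrum (embed S) θs → Fin n →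
      Σ[ G ∈ Graph n ] (G ∈SwitchingClass S) × IsStronglyRegular G ×
        HasEigenvaluesℤ (adjacencyMatrix G)
          ( ((- 1# - lam) /2 , a) ∷ ((- 1# - mu) /2 , b) ∷ ((fromℕ n - 1# - nu) /2 , 1) ∷ [])
    switching-class {n} S seidel spec o =
        underlyingGraph S′-seidel
      , (switch S , S′-seidel , switch-equivalent S , isUnderlyingGraph S′-seidel)
      , isStronglyRegular S′-seidel S′-spectrum Q′≈δ o
      , adjacency-eigenvalues S′-seidel S′-spectrum Q′≈δ o
      where
      seidel′ = seidelOver seidel
      normalise : ∀ {x} → x ≈ δ seidel′ spec ⊎ x ≈ - δ seidel′ spec →
                  Σ[ z ∈ ℤ ] IsSign z × x ≈ fromℤ z * δ seidel′ spec
      normalise (inj₁ x≈δ)  = 1ℤ , inj₁ ≡.refl ,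
        trans x≈δ (trans (sym (*-identityˡ _)) (*-congʳ (sym fromℤ-1)))
      normalise (inj₂ x≈-δ) = -1ℤ , inj₂ ≡.refl , trans x≈-δ
        (trans (solve 1 (λ x → :- x := :- con (+ 1) :* x) refl _) (*-congʳ (sym fromℤ--1)))
      signs : ∀ i → Σ[ z ∈ ℤ ] IsSign z × Q seidel′ spec o i ≈ fromℤ z * δ seidel′ spec
      signs i = normalise (Q-sign seidel′ spec o i)
      v : Fin n → ℤ
      v i = proj₁ (signs i)
      v-sign : ∀ i → IsSign (v i)
      v-sign i = proj₁ (proj₂ (signs i))
      open Switching v v-sign
      S′-seidel : IsSeidel (switch S)
      S′-seidel = switch-seidel seidel
      σ : Fin n → Carrier
      σ i = fromℤ (v i)
      σ² : ∀ i → σ i * σ i ≈ 1#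
      σ² i = sign-square-one (v-sign i)
      conjugate : ∀ i j → embed (switch S) i j ≈ σ i * embed S i j * σ j
      conjugate i j = begin
        fromℤ (v i ℤ.* S i j ℤ.* v j)
          ≈⟨ reflexive (≡.cong fromℤ (ℤₚ.*-comm (v i ℤ.* S i j) (v j))) ⟩
        fromℤ (v j ℤ.* (v i ℤ.* S i j))
          ≈⟨ trans (fromℤ-sign-* (v-sign j) _) (*-congˡ (fromℤ-sign-* (v-sign i) (S i j))) ⟩
        σ j * (σ i * fromℤ (S i j))
          ≈⟨ *-comm _ _ ⟩
        σ i * fromℤ (S i j) * σ j ∎
      S′-spectrum : HasSpectrum (embed (switch S)) θs
      S′-spectrum = conjugate-spectrum σ σ² conjugate spec
      -- δ depends only on `lam`, `mu` and `n`, so it is the same element before and after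
      -- switching.
      Q′≈δ : ∀ i j → Q (seidelOver S′-seidel) S′-spectrum i j ≈ δ seidel′ spec
      Q′≈δ i j = begin
        quadratic lam mu (embed (switch S)) i j
          ≈⟨ conjugate-quadratic σ σ² conjugate lam mu i j ⟩
        σ i * σ j * Q seidel′ spec i j
          ≈⟨ *-congˡ (Q-rank-one seidel′ spec o σ (λ i → proj₂ (proj₂ (signs i))) i j) ⟩
        σ i * σ j * (σ i * σ j * δ seidel′ spec)
          ≈⟨ solve 3 (λ x y d → x :* y :* (x :* y :* d) := x :* x :* (y :* y) :* d) refl (σ i)
               (σ j) (δ seidel′ spec) ⟩
        σ i * σ i * (σ j * σ j) * δ seidel′ spec
          ≈⟨ trans (*-congʳ (trans (*-cong (σ² i) (σ² j)) (*-identityˡ 1#))) (*-identityˡ _) ⟩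
        δ seidel′ spec ∎

corollary5p4 : ∀ {c ℓ₁ ℓ₂ ℓ₃} (K : OrderedField c ℓ₁ ℓ₂ ℓ₃) →
    let open OrderedField K
        open IntegerSpectrum K
    in
    (n : ℕ) (S : Matrix ℤ n) → IsSeidel S →
    (lam mu nu : Carrier) (a b : ℕ) → 0 ℕ.< a → 0 ℕ.< b →
    HasThreeEigenvalues S lam a mu b nu 1 →
    Σ[ G ∈ Graph n ] (G ∈SwitchingClass S) ×
      IsStronglyRegular G ×
      HasEigenvaluesℤ (adjacencyMatrix G)
        ( ((- 1# - lam) /2 , a)
        ∷ ((- 1# - mu) /2 , b)
        ∷ ((fromℕ n - 1# - nu) /2 , 1)
        ∷ [])
corollary5p4 K n S seidel lam mu nu a b 0<a 0<b three-eigenvalues =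
  switching-class S seidel spec (vertex n
    (≡.trans (≡.sym (length-three lam mu nu)) (spectrum-length spec)))
  where
  open OrderedField K hiding (zero)
  open IntegerSpectrum K
  open HasThreeEigenvalues three-eigenvalues
  open Spectrum K
  open SeidelSpectrum K
  open SeidelOver.ThreeEigenvalues K lam mu nu a b θ₁#θ₃ θ₂#θ₃
  open StronglyRegular lam mu nu a b 0<a 0<b θ₁#θ₂ θ₁#θ₃ θ₂#θ₃
  spec : HasSpectrum (embed S) θs
  spec .HasSpectrum.charPoly-splits x = trans (eigenvalues x) (trans
    (*-congˡ (*-congˡ (*-congʳ (*-identityʳ _))))
    (sym (product-three (λ θ → x - θ) lam mu nu)))
  vertex : ∀ n → a ℕ.+ (b ℕ.+ 1) ≡ n → Fin n
  vertex (ℕ.suc n) _ = zero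
  vertex ℕ.zero a+b+1≡0 = ⊥-elim (ℕₚ.<⇒≢ 0<a (≡.sym (ℕₚ.m+n≡0⇒m≡0 a a+b+1≡0)))
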